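{- There is an algorithm that decides the following problem, restricted to instances in which $f$ and $g$ are both monic and both split completely over some quadratic (degree-two) extension $\mathbb{K}$ of $\mathbb{Q}$. Input: polynomials $f,g\in\mathbb{Z}[x]$, where $f$ has no non-negative integer zeros, an initial value $u_0\in\mathbb{Q}$, and a target $t\in\mathbb{Q}$. Question: letting $\langle u_n\rangle_{n=0}^\infty$ be the unique sequence of rationals with the given $u_0$ and $f(n)u_n-g(n)u_{n-1}=0$ for all $n\ge 1$, does there exist $n\in\mathbb{N}$ with $u_n=t$?
   Context: A hypergeometric sequence is a rational-valued sequence $\langle u_n\rangle_{n=0}^\infty$ satisfying $f(n)u_n = g(n)u_{n-1}$ for all $n\geq 1$, with $f,g\in\mathbb{Z}[x]$ and $f$ having no non-negative integer zeros; it is determined by $f$, $g$ and $u_0$. The problem above is the Membership Problem for such sequences. -}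

module Defs where

open import Data.Nat as ℕ using (ℕ; zero; suc)
open import Data.Integer as ℤ using (ℤ; +_)
open import Data.Rational as ℚ using (ℚ; 0ℚ; 1ℚ; _÷_; ≢-nonZero)
open import Data.Rational.Properties using () renaming (_≟_ to _≟ℚ_)
open import Data.List using (List; []; _∷_; _∷ʳ_; map)
open import Data.Product using (Σ; _×_; _,_; ∃; ∃-syntax)
open import Relation.Nullary using (yes; no; ¬_)
open import Relation.Binary.PropositionalEquality using (_≡_; _≢_)

-- Integer polynomials as coefficient lists, lowest degree first:
-- a₀ ∷ a₁ ∷ … ∷ aₖ ∷ []  represents  a₀ + a₁ x + … + aₖ xᵏ.
Polyℤ : Set
Polyℤ = List ℤ

evalℤ : Polyℤ → ℤ → ℤ
evalℤ []       x = + 0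
evalℤ (a ∷ p)  x = a ℤ.+ x ℤ.* evalℤ p x

Monic : Polyℤ → Set
Monic p = Σ (List ℤ) λ cs → p ≡ cs ∷ʳ + 1

NoNatZeros : Polyℤ → Set
NoNatZeros f = (n : ℕ) → evalℤ f (+ n) ≢ + 0

toℚ : ℤ → ℚ
toℚ z = z ℚ./ 1

-- The hypergeometric sequence: u 0 = u₀ and f(n) uₙ = g(n) uₙ₋₁ for n ≥ 1,
-- i.e. uₙ = g(n) uₙ₋₁ / f(n).  (If f(n) = 0 — excluded by NoNatZeros —
-- the value is set to 0 only to make the definition total.)
hyperSeq : Polyℤ → Polyℤ → ℚ → ℕ → ℚ
hyperSeq f g u₀ zero    = u₀
hyperSeq f g u₀ (suc n) with toℚ (evalℤ f (+ suc n)) ≟ℚ 0ℚ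
... | yes _  = 0ℚ
... | no f≢0 = (toℚ (evalℤ g (+ suc n)) ℚ.* hyperSeq f g u₀ n) ÷ toℚ (evalℤ f (+ suc n))
  where instance _ = ≢-nonZero f≢0

-- Quadratic extensions ℚ(√d) of ℚ, d ∈ ℚ a non-square.
-- Every quadratic extension of ℚ is of this form (up to isomorphism).

NonSquare : ℚ → Set
NonSquare d = (q : ℚ) → q ℚ.* q ≢ d

-- Element a + b√d represented as (a , b).
K : Set
K = ℚ × ℚ

module QuadField (d : ℚ) where

  _+K_ : K → K → K
  (a , b) +K (c , e) = (a ℚ.+ c , b ℚ.+ e)

  _*K_ : K → K → K
  (a , b) *K (c , e) = (a ℚ.* c ℚ.+ d ℚ.* (b ℚ.* e) , a ℚ.* e ℚ.+ b ℚ.* c)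

  0K 1K : K
  0K = (0ℚ , 0ℚ)
  1K = (1ℚ , 0ℚ)

  -K_ : K → K
  -K (a , b) = (ℚ.- a , ℚ.- b)

  -- Polynomials over K, coefficient lists lowest degree first.
  padd : List K → List K → List K
  padd []      q       = q
  padd p       []      = p
  padd (a ∷ p) (b ∷ q) = (a +K b) ∷ padd p q

  pscale : K → List K → List K
  pscale c = map (c *K_)

  pmul : List K → List K → List K
  pmul []      q = []
  pmul (a ∷ p) q = padd (pscale a q) (0K ∷ pmul p q)

  prodLin : List K → List K
  prodLin []       = 1K ∷ []
  prodLin (r ∷ rs) = pmul ((-K r) ∷ 1K ∷ []) (prodLin rs)

  embed : Polyℤ → List K
  embed = map (λ z → (toℚ z , 0ℚ))

  -- f splits completely (into linear factors) over ℚ(√d);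
  -- for monic f this means f = ∏ (x - rᵢ) with all rᵢ ∈ ℚ(√d).
  SplitsOver : Polyℤ → Set
  SplitsOver f = Σ (List K) λ rs → embed f ≡ prodLin rs

SplitOverCommonQuadratic : Polyℤ → Polyℤ → Set
SplitOverCommonQuadratic f g =
  Σ ℚ λ d → NonSquare d × QuadField.SplitsOver d f × QuadField.SplitsOver d g

-- Squaring, f(k)² is a product of integer quadratics q(k) = k² + b k + c, namely the norms of k - r for the
-- roots r, and likewise for g; all their discriminants are in the same square class.  Quadratics of equal
-- discriminant are translates of each other, so their contributions to (uₙ / u₀)² telescope, and uₙ = t leads to
--   c₁ A(n) ∏_{k ≤ n} F′(k) = c₂ B(n) ∏_{k ≤ n} G′(k)
-- with products of quadratics A, B, F′, G′ such that no discriminant occurs in both F′ and G′.  If F′ and G′ are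
-- empty, this is a polynomial equation for n; if only one of them is, growth excludes large n.  Otherwise let
-- q₀, say in F′, have the nonzero discriminant D of least absolute value.  A prime p much larger than n that
-- divides q₀(k) for some k slightly below n cannot divide the right-hand side.
--
-- Such primes exist for large n.  Otherwise the product of q₀(k) over a window of L = n / w integers is, since q₀
-- has two roots modulo most primes and by Chebyshev's bound for π, at most Cᴸ times the square of the part of L !
-- made of primes modulo which D is a square; so the other primes contribute at most C′ᴸ to L !.  Then a positive
-- proportion of the integers up to X, for a suitable X ≤ L, are squarefree products of primes modulo which D is a
-- square, up to a bounded factor, and the number of pairs (s₁ , s₂) of such products with s₁ s₂ ≤ X exceeds any
-- given multiple of X.  But Thue's lemma assigns to such a pair integers x, y of size at most √X with s₁ s₂
-- dividing x² - D y² ≠ 0, and these determine the pair together with the bounded cofactor: there are O(X) pairs.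
module Submission where

open import Defs
open import Data.Nat as ℕ using (ℕ; zero; suc; s≤s; z≤n; _!)
import Data.Nat.Properties as ℕ
import Data.Nat.Divisibility as ℕ
import Data.Nat.DivMod as ℕ
open import Data.Nat.Primality using (Prime)
open import Data.Integer as ℤ using (ℤ)
import Data.Integer.Properties as ℤ
open import Data.Rational using (ℚ)
open import Data.List using (List; []; _∷_)
open import Data.List.Relation.Unary.All as All using (All; []; _∷_)
open import Data.List.Relation.Unary.Any using (here; there)
open import Data.List.Membership.Propositional using (_∈_)
open import Data.Product using (_×_; _,_; ∃; ∃₂; ∃-syntax; proj₁; proj₂)
open import Data.Sum using (_⊎_; inj₁; inj₂)
open import Data.Empty using (⊥; ⊥-elim)
open import Relation.Nullary using (Dec; yes; no; ¬_; ¬?)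
open import Relation.Unary using (Decidable)
open import Relation.Binary.PropositionalEquality
  using (_≡_; _≢_; refl; sym; trans; cong; cong₂; subst; subst₂; module ≡-Reasoning)

-- Large hits cannot simply be excluded: for `f` equal to `g` the sequence is constant, and if `g`
-- has a positive integer zero all later terms vanish, so `t` may be hit infinitely often. What is
-- proved is that from a computed threshold on a hit at n + 1 forces a hit at n. Every hit then
-- descends to the threshold, and a bounded search decides. Thresholds are therefore part of the
-- algorithm, and all estimates carry explicit constants. Squaring loses the sign of the terms; it
-- is recovered from the eventual positivity of the monic `f` and `g`. The least discriminant is
-- chosen because values of two quadratics divisible by one very large prime have slopes x, y with D
-- y² = D′ x². If |D′| > |D|, then y / x is bounded away from 1 from above, but x belongs to an
-- argument close to the largest one available for y. The quadratic field and the roots are given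
-- only as irrelevant hypotheses. They show that suitable integer quadratics exist; the algorithm
-- finds these by a finite search with decidable conditions that do not mention the field.

-- Finite sums, products and counts over initial segments of ℕ.

module Range where

  open import Data.Nat
  open import Data.Nat.Properties
  open import Data.Nat.Tactic.RingSolver using (solve-∀)

  sumTo prodTo : ℕ → (ℕ → ℕ) → ℕ
  sumTo zero    φ = 0
  sumTo (suc n) φ = sumTo n φ + φ n
  prodTo zero    φ = 1
  prodTo (suc n) φ = prodTo n φ * φ n

  ind : ∀ {P : Set} → Dec P → ℕ
  ind (yes _) = 1
  ind (no _)  = 0

  count : ∀ {P : ℕ → Set} → Decidable P → ℕ → ℕ
  count P? n = sumTo n (λ i → ind (P? i))

  ind-yes : ∀ {P : Set} (P? : Dec P) → P → ind P? ≡ 1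
  ind-yes (yes _) _ = refl
  ind-yes (no ¬p) p = ⊥-elim (¬p p)

  ind-no : ∀ {P : Set} (P? : Dec P) → ¬ P → ind P? ≡ 0
  ind-no (yes p) ¬p = ⊥-elim (¬p p)
  ind-no (no _) _ = refl

  ind≤1 : ∀ {P : Set} (P? : Dec P) → ind P? ≤ 1
  ind≤1 (yes _) = ≤-refl
  ind≤1 (no _)  = z≤n

  ind-mono : ∀ {P Q : Set} (P? : Dec P) (Q? : Dec Q) → (P → Q) → ind P? ≤ ind Q?
  ind-mono (yes p) Q? f = ≤-reflexive (sym (ind-yes Q? (f p)))
  ind-mono (no _)  Q? f = z≤n

  ind-⊎ : ∀ {P Q R : Set} (P? : Dec P) (Q? : Dec Q) (R? : Dec R) → (P → Q ⊎ R) → ind P? ≤ ind Q? + ind R?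
  ind-⊎ (no _) Q? R? f = z≤n
  ind-⊎ (yes p) Q? R? f with f p
  ... | inj₁ q = ≤-trans (≤-reflexive (sym (ind-yes Q? q))) (m≤m+n _ _)
  ... | inj₂ r = ≤-trans (≤-reflexive (sym (ind-yes R? r))) (m≤n+m _ _)

  ^-distribʳ-* : ∀ e x y → (x * y) ^ e ≡ x ^ e * y ^ e
  ^-distribʳ-* zero    x y = refl
  ^-distribʳ-* (suc e) x y = trans (cong (x * y *_) (^-distribʳ-* e x y)) (lem x y (x ^ e) (y ^ e))
    where lem : ∀ a b c d → (a * b) * (c * d) ≡ (a * c) * (b * d)
          lem = solve-∀

  sumTo-cong : ∀ n {φ ψ : ℕ → ℕ} → (∀ i → i < n → φ i ≡ ψ i) → sumTo n φ ≡ sumTo n ψ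
  sumTo-cong zero    h = refl
  sumTo-cong (suc n) h = cong₂ _+_ (sumTo-cong n (λ i l → h i (m<n⇒m<1+n l))) (h n ≤-refl)

  sumTo-mono : ∀ n {φ ψ : ℕ → ℕ} → (∀ i → i < n → φ i ≤ ψ i) → sumTo n φ ≤ sumTo n ψ
  sumTo-mono zero    h = z≤n
  sumTo-mono (suc n) h = +-mono-≤ (sumTo-mono n (λ i l → h i (m<n⇒m<1+n l))) (h n ≤-refl)

  sumTo-+ : ∀ n (φ ψ : ℕ → ℕ) → sumTo n (λ i → φ i + ψ i) ≡ sumTo n φ + sumTo n ψ
  sumTo-+ zero    φ ψ = refl
  sumTo-+ (suc n) φ ψ = trans (cong (_+ (φ n + ψ n)) (sumTo-+ n φ ψ)) (lem (sumTo n φ) (sumTo n ψ) (φ n) (ψ n))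
    where lem : ∀ a b c d → (a + b) + (c + d) ≡ (a + c) + (b + d)
          lem = solve-∀

  sumTo-const : ∀ n c → sumTo n (λ _ → c) ≡ n * c
  sumTo-const zero    c = refl
  sumTo-const (suc n) c = trans (cong (_+ c) (sumTo-const n c)) (+-comm (n * c) c)

  sumTo-*ˡ : ∀ n c (φ : ℕ → ℕ) → sumTo n (λ i → c * φ i) ≡ c * sumTo n φ
  sumTo-*ˡ zero    c φ = sym (*-zeroʳ c)
  sumTo-*ˡ (suc n) c φ = trans (cong (_+ c * φ n) (sumTo-*ˡ n c φ)) (sym (*-distribˡ-+ c _ _))

  sumTo-swap : ∀ m n (φ : ℕ → ℕ → ℕ) → sumTo m (λ i → sumTo n (φ i)) ≡ sumTo n (λ j → sumTo m (λ i → φ i j))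
  sumTo-swap zero    n φ = sym (trans (sumTo-const n 0) (*-zeroʳ n))
  sumTo-swap (suc m) n φ = trans (cong (_+ sumTo n (φ m)) (sumTo-swap m n φ))
    (sym (sumTo-+ n (λ j → sumTo m (λ i → φ i j)) (φ m)))

  sumTo-split : ∀ m n (φ : ℕ → ℕ) → sumTo (m + n) φ ≡ sumTo m φ + sumTo n (λ i → φ (m + i))
  sumTo-split m zero    φ = trans (cong (λ z → sumTo z φ) (+-identityʳ m)) (sym (+-identityʳ _))
  sumTo-split m (suc n) φ = trans (cong (λ z → sumTo z φ) (+-suc m n))
    (trans (cong (_+ φ (m + n)) (sumTo-split m n φ)) (+-assoc (sumTo m φ) _ _))

  sumTo-≤-range : ∀ {m n} (φ : ℕ → ℕ) → m ≤ n → sumTo m φ ≤ sumTo n φ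
  sumTo-≤-range {m} {n} φ m≤n = ≤-trans (m≤m+n _ _)
    (≤-reflexive (trans (sym (sumTo-split m (n ∸ m) φ)) (cong (λ z → sumTo z φ) (m+[n∸m]≡n m≤n))))

  sumTo-≥-term : ∀ n (φ : ℕ → ℕ) i → i < n → φ i ≤ sumTo n φ
  sumTo-≥-term (suc n) φ i i<sn with m≤n⇒m<n∨m≡n (s≤s⁻¹ i<sn)
  ... | inj₁ i<n  = ≤-trans (sumTo-≥-term n φ i i<n) (m≤m+n _ _)
  ... | inj₂ refl = m≤n+m _ _

  prodTo-cong : ∀ n {φ ψ : ℕ → ℕ} → (∀ i → i < n → φ i ≡ ψ i) → prodTo n φ ≡ prodTo n ψ
  prodTo-cong zero    h = refl
  prodTo-cong (suc n) h = cong₂ _*_ (prodTo-cong n (λ i l → h i (m<n⇒m<1+n l))) (h n ≤-refl)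

  prodTo-mono : ∀ n {φ ψ : ℕ → ℕ} → (∀ i → i < n → φ i ≤ ψ i) → prodTo n φ ≤ prodTo n ψ
  prodTo-mono zero    h = ≤-refl
  prodTo-mono (suc n) h = *-mono-≤ (prodTo-mono n (λ i l → h i (m<n⇒m<1+n l))) (h n ≤-refl)

  prodTo-* : ∀ n (φ ψ : ℕ → ℕ) → prodTo n (λ i → φ i * ψ i) ≡ prodTo n φ * prodTo n ψ
  prodTo-* zero    φ ψ = refl
  prodTo-* (suc n) φ ψ = trans (cong (_* (φ n * ψ n)) (prodTo-* n φ ψ)) (lem (prodTo n φ) (prodTo n ψ) (φ n) (ψ n))
    where lem : ∀ a b c d → (a * b) * (c * d) ≡ (a * c) * (b * d)
          lem = solve-∀

  prodTo-const : ∀ n c → prodTo n (λ _ → c) ≡ c ^ n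
  prodTo-const zero    c = refl
  prodTo-const (suc n) c = trans (cong (_* c) (prodTo-const n c)) (*-comm (c ^ n) c)

  prodTo-pow : ∀ n c (φ : ℕ → ℕ) → prodTo n (λ i → c ^ φ i) ≡ c ^ sumTo n φ
  prodTo-pow zero    c φ = refl
  prodTo-pow (suc n) c φ = trans (cong (_* c ^ φ n) (prodTo-pow n c φ)) (sym (^-distribˡ-+-* c (sumTo n φ) (φ n)))

  prodTo-^ : ∀ n e (φ : ℕ → ℕ) → prodTo n (λ i → φ i ^ e) ≡ prodTo n φ ^ e
  prodTo-^ zero    e φ = sym (^-zeroˡ e)
  prodTo-^ (suc n) e φ = trans (cong (_* φ n ^ e) (prodTo-^ n e φ)) (sym (^-distribʳ-* e (prodTo n φ) (φ n)))

  prodTo-pos : ∀ n (φ : ℕ → ℕ) → (∀ i → i < n → 1 ≤ φ i) → 1 ≤ prodTo n φ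
  prodTo-pos n φ h = ≤-trans (≤-reflexive (sym (trans (prodTo-const n 1) (^-zeroˡ n)))) (prodTo-mono n h)

  prodTo-split : ∀ m n (φ : ℕ → ℕ) → prodTo (m + n) φ ≡ prodTo m φ * prodTo n (λ i → φ (m + i))
  prodTo-split m zero    φ = trans (cong (λ z → prodTo z φ) (+-identityʳ m)) (sym (*-identityʳ _))
  prodTo-split m (suc n) φ = trans (cong (λ z → prodTo z φ) (+-suc m n))
    (trans (cong (_* φ (m + n)) (prodTo-split m n φ)) (*-assoc (prodTo m φ) _ _))

  -- A factor present only for indices with the property. Products over all `p < X` with such
  -- factors replace products over filtered lists of primes.
  choose : ∀ {P : Set} → Dec P → ℕ → ℕ
  choose (yes _) x = x
  choose (no _)  x = 1

  choose-yes : ∀ {P : Set} (P? : Dec P) {x} → P → choose P? x ≡ x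
  choose-yes (yes _) _ = refl
  choose-yes (no ¬p) p = ⊥-elim (¬p p)

  choose≡^ind : ∀ {P : Set} (P? : Dec P) x → choose P? x ≡ x ^ ind P?
  choose≡^ind (yes _) x = sym (*-identityʳ x)
  choose≡^ind (no _)  x = refl

  prodTo-choose : ∀ {P : ℕ → Set} (P? : Decidable P) n x → prodTo n (λ i → choose (P? i) x) ≡ x ^ count P? n
  prodTo-choose P? n x = trans (prodTo-cong n (λ i _ → choose≡^ind (P? i) x)) (prodTo-pow n x _)

  count-mono : ∀ {P Q : ℕ → Set} (P? : Decidable P) (Q? : Decidable Q) n → (∀ i → i < n → P i → Q i) → count P? n ≤
      count Q? n
  count-mono P? Q? n h = sumTo-mono n (λ i l → ind-mono (P? i) (Q? i) (h i l))

  count-⊎ : ∀ {P Q R : ℕ → Set} (P? : Decidable P) (Q? : Decidable Q) (R? : Decidable R) n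
    → (∀ i → i < n → P i → Q i ⊎ R i) → count P? n ≤ count Q? n + count R? n
  count-⊎ P? Q? R? n h = ≤-trans (sumTo-mono n (λ i l → ind-⊎ (P? i) (Q? i) (R? i) (h i l)))
    (≤-reflexive (sumTo-+ n _ _))

  count-zero : ∀ {P : ℕ → Set} (P? : Decidable P) n → (∀ i → i < n → ¬ P i) → count P? n ≡ 0
  count-zero P? n h = trans (sumTo-cong n (λ i l → ind-no (P? i) (h i l))) (trans (sumTo-const n 0) (*-zeroʳ n))

  count≤ : ∀ {P : ℕ → Set} (P? : Decidable P) n → count P? n ≤ n
  count≤ P? n = ≤-trans (sumTo-mono n (λ i _ → ind≤1 (P? i))) (≤-reflexive (trans (sumTo-const n 1) (*-identityʳ n)))

-- Prime factorisations, valuations, and the part of a number made of selected primes.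

module Factor where

  open Range
  open import Data.Nat
  open import Data.Nat.Properties
  open import Data.Nat.Divisibility
  open import Data.Nat.Primality
  open import Data.Nat.Primality.Factorisation using
      (factorise; factors; factorisationUnique; factorisationHasAllPrimeFactors; PrimeFactorisation)
  open import Data.Nat.ListAction using (product)
  open import Data.Nat.ListAction.Properties using (product-++; product-↭; ∈⇒∣product)
  open import Data.List using (_++_; filter)
  open import Data.List.Properties using (filter-++)
  open import Data.List.Relation.Unary.All using (lookup; tabulate)
  open import Data.List.Relation.Unary.All.Properties using (++⁺)
  open import Data.List.Membership.Propositional.Properties using (∈-filter⁻)
  open import Data.List.Relation.Binary.Permutation.Propositional using (_↭_) renaming
      (refl to ↭refl; prep to ↭prep; swap to ↭swap; trans to ↭trans)
  open import Data.List.Relation.Binary.Permutation.Propositional.Properties using (filter-↭)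
  open import Relation.Unary.Properties using (∁?)
  open import Data.Nat.Tactic.RingSolver using (solve-∀)

  primes : ℕ → List ℕ
  primes zero    = []
  primes (suc n) = factors (factorise (suc n))

  primes-product : ∀ {n} → 1 ≤ n → product (primes n) ≡ n
  primes-product {suc n} _ = sym (PrimeFactorisation.isFactorisation (factorise (suc n)))

  primes-Prime : ∀ n → All Prime (primes n)
  primes-Prime zero    = []
  primes-Prime (suc n) = PrimeFactorisation.factorsPrime (factorise (suc n))

  ≥1⇒≢0 : ∀ {n} → 1 ≤ n → NonZero n
  ≥1⇒≢0 {suc n} _ = _

  prime≥2 : ∀ {p} → Prime p → 2 ≤ p
  prime≥2 {suc (suc p)} pp = s≤s (s≤s z≤n)
  prime≥2 {zero} pp = ⊥-elim (¬prime[0] pp)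
  prime≥2 {suc zero} pp = ⊥-elim (¬prime[1] pp)

  *-≥1 : ∀ {a b} → 1 ≤ a → 1 ≤ b → 1 ≤ a * b
  *-≥1 = *-mono-≤

  primes-* : ∀ {a b} → 1 ≤ a → 1 ≤ b → primes (a * b) ↭ primes a ++ primes b
  primes-* {a} {b} ha hb with a * b in eq | *-≥1 ha hb
  ... | suc n | _ = factorisationUnique (factorise (suc n)) record
    { factors = primes a ++ primes b
    ; isFactorisation = sym (trans (product-++ (primes a) (primes b))
        (trans (cong₂ _*_ (primes-product ha) (primes-product hb)) eq))
    ; factorsPrime = ++⁺ (primes-Prime a) (primes-Prime b) }

  ∈primes⇒∣ : ∀ {p n} → p ∈ primes n → p ∣ n
  ∈primes⇒∣ {p} {suc n} p∈ = subst (p ∣_) (primes-product {suc n} (s≤s z≤n)) (∈⇒∣product p∈)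

  ∣⇒∈primes : ∀ {p n} → Prime p → 1 ≤ n → p ∣ n → p ∈ primes n
  ∣⇒∈primes {p} {n} pp hn p∣n =
    factorisationHasAllPrimeFactors pp (subst (p ∣_) (sym (primes-product hn)) p∣n) (primes-Prime n)

  ∣⇒≤′ : ∀ {m n} → 1 ≤ n → m ∣ n → m ≤ n
  ∣⇒≤′ {m} {suc n} _ = ∣⇒≤

  ∣⇒≥1 : ∀ {m n} → 1 ≤ n → m ∣ n → 1 ≤ m
  ∣⇒≥1 {zero}  {suc n} _ 0∣n with () ← 0∣⇒≡0 0∣n
  ∣⇒≥1 {suc m} _ _ = s≤s z≤n

  occ : ℕ → List ℕ → ℕ
  occ p []       = 0
  occ p (x ∷ xs) = ind (p ≟ x) + occ p xs

  occ-++ : ∀ p xs ys → occ p (xs ++ ys) ≡ occ p xs + occ p ys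
  occ-++ p []       ys = refl
  occ-++ p (x ∷ xs) ys = trans (cong (ind (p ≟ x) +_) (occ-++ p xs ys)) (sym (+-assoc (ind (p ≟ x)) _ _))

  occ-↭ : ∀ p {xs ys} → xs ↭ ys → occ p xs ≡ occ p ys
  occ-↭ p ↭refl         = refl
  occ-↭ p (↭prep x r)   = cong (ind (p ≟ x) +_) (occ-↭ p r)
  occ-↭ p (↭swap x y r) = trans (lem (ind (p ≟ x)) (ind (p ≟ y)) _)
      (cong (λ z → ind (p ≟ y) + (ind (p ≟ x) + z)) (occ-↭ p r))
    where lem : ∀ a b c → a + (b + c) ≡ b + (a + c)
          lem = solve-∀
  occ-↭ p (↭trans r s)  = trans (occ-↭ p r) (occ-↭ p s)

  ∈⇒occ : ∀ {p xs} → p ∈ xs → 1 ≤ occ p xs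
  ∈⇒occ {p} (here refl) = ≤-trans (≤-reflexive (sym (ind-yes (p ≟ p) refl))) (m≤m+n _ _)
  ∈⇒occ {p} (there p∈)  = ≤-trans (∈⇒occ p∈) (m≤n+m _ _)

  occ⇒∈ : ∀ {p} xs → 1 ≤ occ p xs → p ∈ xs
  occ⇒∈ {p} (x ∷ xs) h with p ≟ x
  ... | yes refl = here refl
  ... | no _     = there (occ⇒∈ xs h)

  -- The `p`-adic valuation. It is 0 for every `p` that is not prime, so it can stand in products
  -- over all `p < X`; it is also 0 for `n` equal to 0.
  v : ℕ → ℕ → ℕ
  v p n = occ p (primes n)

  v-* : ∀ p {a b} → 1 ≤ a → 1 ≤ b → v p (a * b) ≡ v p a + v p b
  v-* p {a} {b} ha hb = trans (occ-↭ p (primes-* ha hb)) (occ-++ p (primes a) (primes b))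

  ∣⇒v≥1 : ∀ {p n} → Prime p → 1 ≤ n → p ∣ n → 1 ≤ v p n
  ∣⇒v≥1 pp hn p∣n = ∈⇒occ (∣⇒∈primes pp hn p∣n)

  v≥1⇒∣ : ∀ {p n} → 1 ≤ v p n → p ∣ n
  v≥1⇒∣ {p} {n} h = ∈primes⇒∣ {p} {n} (occ⇒∈ (primes n) h)

  v≥1⇒Prime : ∀ {p n} → 1 ≤ v p n → Prime p
  v≥1⇒Prime {p} {n} h = lookup (primes-Prime n) (occ⇒∈ (primes n) h)

  ∤⇒v≡0 : ∀ {p n} → ¬ p ∣ n → v p n ≡ 0
  ∤⇒v≡0 {p} {n} h with v p n in eq
  ... | zero  = refl
  ... | suc k = ⊥-elim (h (v≥1⇒∣ {p} {n} (subst (1 ≤_) (sym eq) (s≤s z≤n))))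

  ¬Prime⇒v≡0 : ∀ {p} n → ¬ Prime p → v p n ≡ 0
  ¬Prime⇒v≡0 {p} n h with v p n in eq
  ... | zero  = refl
  ... | suc k = ⊥-elim (h (v≥1⇒Prime {p} {n} (subst (1 ≤_) (sym eq) (s≤s z≤n))))

  prime≥1 : ∀ {p} → Prime p → 1 ≤ p
  prime≥1 pp = ≤-trans (s≤s z≤n) (prime≥2 pp)

  ^-≥1 : ∀ {a} k → 1 ≤ a → 1 ≤ a ^ k
  ^-≥1 {a} k ha = m^n>0 a {{≥1⇒≢0 ha}} k

  v-1 : ∀ p → v p 1 ≡ 0
  v-1 p with v p 1 in eq
  ... | zero = refl
  ... | suc k = ⊥-elim (¬prime[1] (subst Prime (∣1⇒≡1 (v≥1⇒∣ {p} {1} h)) (v≥1⇒Prime {p} {1} h)))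
    where h : 1 ≤ v p 1
          h = subst (1 ≤_) (sym eq) (s≤s z≤n)

  v-self : ∀ {p} → Prime p → v p p ≡ 1
  v-self {p} pp = trans (occ-↭ p (perm p pp)) (trans (+-identityʳ _) (ind-yes (p ≟ p) refl))
    where
      perm : ∀ p → Prime p → primes p ↭ p ∷ []
      perm zero    pp = ⊥-elim (¬prime[0] pp)
      perm (suc n) pp = factorisationUnique (factorise (suc n)) record
        { factors = suc n ∷ [] ; isFactorisation = sym (*-identityʳ (suc n)) ; factorsPrime = pp ∷ [] }

  v-^ : ∀ p {a} k → 1 ≤ a → v p (a ^ k) ≡ k * v p a
  v-^ p zero    ha = v-1 p
  v-^ p {a} (suc k) ha = trans (v-* p ha (^-≥1 k ha)) (cong (v p a +_) (v-^ p k ha))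

  ^∣⇒≤v : ∀ {p n} j → Prime p → 1 ≤ n → p ^ j ∣ n → j ≤ v p n
  ^∣⇒≤v {p} {n} j pp hn (divides k eq) = subst (j ≤_) (sym e) (≤-trans (≤-reflexive (sym vj)) (m≤n+m _ _))
    where
      hp = ^-≥1 j (prime≥1 pp)
      hk : 1 ≤ k
      hk = ∣⇒≥1 hn (divides (p ^ j) (trans eq (*-comm k _)))
      vj : v p (p ^ j) ≡ j
      vj = trans (v-^ p j (prime≥1 pp)) (trans (cong (j *_) (v-self pp)) (*-identityʳ j))
      e : v p n ≡ v p k + v p (p ^ j)
      e = trans (cong (v p) eq) (v-* p hk hp)

  ≤v⇒^∣ : ∀ {p n} j → 1 ≤ n → j ≤ v p n → p ^ j ∣ n
  ≤v⇒^∣ zero    hn h = 1∣ _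
  ≤v⇒^∣ {p} {n} (suc j) hn h with v≥1⇒∣ {p} {n} (≤-trans (s≤s z≤n) h)
  ... | divides k eq = subst (p ^ suc j ∣_) (sym (trans eq (*-comm k p)))
      (*-monoʳ-∣ p (≤v⇒^∣ {p} {k} j hk (s≤s⁻¹ h′)))
    where
      pp = v≥1⇒Prime {p} {n} (≤-trans (s≤s z≤n) h)
      hk : 1 ≤ k
      hk = ∣⇒≥1 hn (divides p (trans eq (*-comm k _)))
      e : v p n ≡ suc (v p k)
      e = trans (cong (v p) eq) (trans (v-* p hk (prime≥1 pp)) (trans (cong (v p k +_) (v-self pp)) (+-comm _ 1)))
      h′ : suc j ≤ suc (v p k)
      h′ = subst (suc j ≤_) e h

  prodTo-single : ∀ X (φ : ℕ → ℕ) x → x < X → (∀ p → p ≢ x → φ p ≡ 1) → prodTo X φ ≡ φ x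
  prodTo-single (suc X) φ x x<sX h with m≤n⇒m<n∨m≡n (s≤s⁻¹ x<sX)
  ... | inj₁ x<X  = trans (cong₂ _*_ (prodTo-single X φ x x<X h) (h X (λ e → <-irrefl (sym e) x<X))) (*-identityʳ _)
  ... | inj₂ refl = trans (cong (_* φ X) (trans (prodTo-cong X (λ i i<X → h i (λ e → <-irrefl e i<X)))
                      (trans (prodTo-const X 1) (^-zeroˡ X)))) (*-identityˡ _)

  module _ {P : ℕ → Set} (P? : Decidable P) where

    -- Indexing by all `p < X` instead of by the prime factors gives different numbers a common
    -- index set, so that they can be compared and multiplied factor by factor.
    product-filter : ∀ X xs → All (_< X) xs →
      product (filter P? xs) ≡ prodTo X (λ p → choose (P? p) (p ^ occ p xs))
    product-filter X [] [] = sym (trans (prodTo-cong X (λ p _ → lem p)) (trans (prodTo-const X 1) (^-zeroˡ X)))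
      where lem : ∀ p → choose (P? p) 1 ≡ 1
            lem p with P? p
            ... | yes _ = refl
            ... | no _  = refl
    product-filter X (x ∷ xs) (x<X ∷ a) = trans step (sym (trans (prodTo-cong X (λ p _ → split p)) (prodTo-* X _ _)))
      where
        split : ∀ p → choose (P? p) (p ^ (ind (p ≟ x) + occ p xs)) ≡ choose (P? p) (p ^ ind (p ≟ x)) * choose (P? p)
            (p ^ occ p xs)
        split p with P? p
        ... | yes _ = ^-distribˡ-+-* p (ind (p ≟ x)) (occ p xs)
        ... | no _  = refl
        off : ∀ p → p ≢ x → choose (P? p) (p ^ ind (p ≟ x)) ≡ 1
        off p p≢x with P? p
        ... | yes _ = cong (p ^_) (ind-no (p ≟ x) p≢x)
        ... | no _  = refl
        on : choose (P? x) (x ^ ind (x ≟ x)) ≡ choose (P? x) x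
        on = cong (choose (P? x)) (trans (cong (x ^_) (ind-yes (x ≟ x) refl)) (*-identityʳ x))
        filt : product (filter P? (x ∷ xs)) ≡ choose (P? x) x * product (filter P? xs)
        filt with P? x
        ... | yes _ = refl
        ... | no _  = sym (*-identityˡ _)
        step = trans filt (cong₂ _*_ (sym (trans (prodTo-single X _ x x<X off) on)) (product-filter X xs a))

    part : ℕ → ℕ
    part n = product (filter P? (primes n))

    part-* : ∀ {a b} → 1 ≤ a → 1 ≤ b → part (a * b) ≡ part a * part b
    part-* {a} {b} ha hb = trans (product-↭ (filter-↭ P? (primes-* ha hb)))
      (trans (cong product (filter-++ P? (primes a) (primes b))) (product-++ (filter P? (primes a)) _))

    part≥1 : ∀ n → 1 ≤ part n
    part≥1 n = productOfPrimes≥1 (tabulate λ x∈ → lookup (primes-Prime n) (proj₁ (∈-filter⁻ P? x∈)))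

    part-∣ : ∀ {a b} → 1 ≤ b → a ∣ b → part a ∣ part b
    part-∣ {a} {b} hb (divides k eq) = divides (part k) (trans (cong part eq)
      (part-* (∣⇒≥1 hb (divides a (trans eq (*-comm k a)))) (∣⇒≥1 hb (divides k eq))))

    part-prodTo : ∀ n X → (∀ p → Prime p → p ∣ n → p < X) → part n ≡ prodTo X (λ p → choose (P? p) (p ^ v p n))
    part-prodTo n X h = product-filter X (primes n)
        (tabulate λ {p} p∈ → h p (lookup (primes-Prime n) p∈) (∈primes⇒∣ {p} {n} p∈))

    part-1 : part 1 ≡ 1
    part-1 = trans (part-prodTo 1 2 λ p _ p∣1 → s≤s (∣⇒≤ p∣1)) (trans (prodTo-cong 2 (λ p _ → c p)) refl)
      where c : ∀ p → choose (P? p) (p ^ v p 1) ≡ 1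
            c p with P? p
            ... | yes _ = cong (p ^_) (v-1 p)
            ... | no _  = refl

    part-prodTo-* : ∀ n (φ : ℕ → ℕ) → (∀ i → i < n → 1 ≤ φ i) → part (prodTo n φ) ≡ prodTo n (λ i → part (φ i))
    part-prodTo-* zero    φ h = part-1
    part-prodTo-* (suc n) φ h = trans (part-* (prodTo-pos n φ (λ i l → h i (m<n⇒m<1+n l))) (h n ≤-refl))
      (cong (_* part (φ n)) (part-prodTo-* n φ (λ i l → h i (m<n⇒m<1+n l))))

  part-compl : ∀ {P : ℕ → Set} (P? : Decidable P) {n} → 1 ≤ n → part P? n * part (∁? P?) n ≡ n
  part-compl P? {n} hn = trans (go (primes n)) (primes-product hn)
    where
      go : ∀ xs → product (filter P? xs) * product (filter (∁? P?) xs) ≡ product xs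
      go [] = refl
      go (x ∷ xs) with P? x
      ... | yes _ = trans (*-assoc x _ _) (cong (x *_) (go xs))
      ... | no _  = trans (lem (product (filter P? xs)) x (product (filter (∁? P?) xs))) (cong (x *_) (go xs))
        where lem : ∀ a b c → a * (b * c) ≡ b * (a * c)
              lem = solve-∀

  ≡prodTo : ∀ {n} X → 1 ≤ n → (∀ p → Prime p → p ∣ n → p < X) → n ≡ prodTo X (λ p → p ^ v p n)
  ≡prodTo {n} X hn h = trans (trans (sym (primes-product hn)) (cong product (sym (all-filter (primes n)))))
      (part-prodTo (λ _ → yes tt) n X h)
    where
      open import Data.Unit using (⊤; tt)
      all-filter : ∀ xs → filter {P = λ _ → ⊤} (λ _ → yes tt) xs ≡ xs
      all-filter []       = refl
      all-filter (x ∷ xs) = cong (x ∷_) (all-filter xs)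

  v-prodTo : ∀ p n (φ : ℕ → ℕ) → (∀ i → i < n → 1 ≤ φ i) → v p (prodTo n φ) ≡ sumTo n (λ i → v p (φ i))
  v-prodTo p zero    φ h = v-1 p
  v-prodTo p (suc n) φ h = trans (v-* p (prodTo-pos n φ (λ i l → h i (m<n⇒m<1+n l))) (h n ≤-refl))
    (cong (_+ v p (φ n)) (v-prodTo p n φ (λ i l → h i (m<n⇒m<1+n l))))

  prodTo-∣ : ∀ n {φ ψ : ℕ → ℕ} → (∀ i → φ i ∣ ψ i) → prodTo n φ ∣ prodTo n ψ
  prodTo-∣ zero    h = ∣-refl
  prodTo-∣ (suc n) h = *-pres-∣ (prodTo-∣ n h) (h n)

  -- Both numbers are products of prime powers over the same range, which ends above `a` and `b` so
  -- that no prime is lost; divisibility then holds factor by factor.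
  v-≤⇒∣ : ∀ {a b} → 1 ≤ a → 1 ≤ b → (∀ p → Prime p → v p a ≤ v p b) → a ∣ b
  v-≤⇒∣ {a} {b} ha hb h = subst₂ _∣_ (sym (≡prodTo X ha (λ p _ d → s≤s (≤-trans (∣⇒≤′ ha d) (m≤m+n a b)))))
      (sym (≡prodTo X hb (λ p _ d → s≤s (≤-trans (∣⇒≤′ hb d) (m≤n+m b a))))) (prodTo-∣ X (λ p → pow p))
    where
      X = suc (a + b)
      pow : ∀ p → p ^ v p a ∣ p ^ v p b
      pow p with prime? p
      ... | yes pp = divides (p ^ (v p b ∸ v p a))
          (trans (cong (p ^_) (sym (m∸n+n≡m (h p pp)))) (^-distribˡ-+-* p (v p b ∸ v p a) (v p a)))
      ... | no ¬pp rewrite ¬Prime⇒v≡0 a ¬pp = 1∣ _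

  v-∣-mono : ∀ p {a b} → 1 ≤ b → a ∣ b → v p a ≤ v p b
  v-∣-mono p {a} {b} hb (divides k eq) = ≤-trans (m≤n+m (v p a) (v p k))
    (≤-reflexive (trans (sym (v-* p (∣⇒≥1 hb (divides a (trans eq (*-comm k a)))) (∣⇒≥1 hb (divides k eq))))
        (cong (v p) (sym eq))))

  part-^ : ∀ {P : ℕ → Set} (P? : Decidable P) {a} m → 1 ≤ a → part P? (a ^ m) ≡ part P? a ^ m
  part-^ P? zero    h = part-1 P?
  part-^ P? {a} (suc m) h = trans (part-* P? h (^-≥1 m h)) (cong (part P? a *_) (part-^ P? m h))

  n≤2^n : ∀ n → n ≤ 2 ^ n
  n≤2^n zero    = z≤n
  n≤2^n (suc n) = ≤-trans (+-mono-≤ (m^n>0 2 n) (n≤2^n n)) (≤-reflexive (cong (2 ^ n +_) (sym (+-identityʳ (2 ^ n)))))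

-- Chebyshev's upper bound for the number of primes.

module Chebyshev where

  open Range
  open Factor
  open import Data.Nat
  open import Data.Nat.Properties
  open import Data.Nat.Divisibility
  open import Data.Nat.Primality
  open import Data.Nat.Combinatorics using (k![n∸k]!∣n!)
  open import Data.Nat.Tactic.RingSolver using (solve-∀)

  !≥1 : ∀ n → 1 ≤ n !
  !≥1 n = n≢0⇒n>0 (≢-nonZero⁻¹ (n !) {{n !≢0}})

  prime∣!⇒≤ : ∀ {p} n → Prime p → p ∣ n ! → p ≤ n
  prime∣!⇒≤ zero    pp h = ⊥-elim (¬prime[1] (subst Prime (∣1⇒≡1 h) pp))
  prime∣!⇒≤ (suc n) pp h with euclidsLemma (suc n) (n !) pp h
  ... | inj₁ d = ∣⇒≤ d
  ... | inj₂ d = m≤n⇒m≤1+n (prime∣!⇒≤ n pp d)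

  ≤⇒∣! : ∀ {p n} → 1 ≤ p → p ≤ n → p ∣ n !
  ≤⇒∣! {suc p} _ p≤n = ∣-trans (m∣m*n (p !)) (m≤n⇒m!∣n! p≤n)

  -- The bound 4ᵐ for the central binomial coefficient, without division. One step multiplies (2m)!
  -- by (2m + 2)(2m + 1), which is at most 4 (m + 1)².
  central-≤ : ∀ m → (m + m) ! ≤ 4 ^ m * (m ! * m !)
  central-≤ zero    = ≤-refl
  central-≤ (suc m) = begin
    (suc m + suc m) !                             ≡⟨ cong _! (cong suc (+-suc m m)) ⟩
    suc (suc (m + m)) * (suc (m + m) * (m + m) !) ≤⟨ *-monoʳ-≤ (suc (suc (m + m)))
        (*-mono-≤ (n≤1+n (suc (m + m))) (central-≤ m)) ⟩
    suc (suc (m + m)) * (suc (suc (m + m)) * (4 ^ m * (m ! * m !))) ≡⟨ lem m (4 ^ m) (m !) ⟩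
    4 ^ suc m * (suc m ! * suc m !) ∎
    where
      open ≤-Reasoning
      lem : ∀ m a f → (2 + (m + m)) * ((2 + (m + m)) * (a * (f * f))) ≡ (4 * a) * (((1 + m) * f) * ((1 + m) * f))
      lem = solve-∀

  ^-cancelʳ-≤ : ∀ b {m n} → 2 ≤ b → b ^ m ≤ b ^ n → m ≤ n
  ^-cancelʳ-≤ b {m} {n} hb h with m ≤? n
  ... | yes q = q
  ... | no ¬q = ⊥-elim (<⇒≱ (^-monoʳ-< b hb (≰⇒> ¬q)) h)

  -- Only primes strictly below the argument count, so π(x) in the usual sense is `π (suc x)`.
  π : ℕ → ℕ
  π = count prime?

  π-upper-half : ℕ → ℕ
  π-upper-half m = sumTo m (λ i → ind (prime? (suc m + i)))

  π-double : ∀ m → π (suc m + m) ≡ π (suc m) + π-upper-half m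
  π-double m = sumTo-split (suc m) m _

  ^v≥1 : ∀ p n → 1 ≤ p ^ v p n
  ^v≥1 p n with prime? p
  ... | yes pp = ^-≥1 (v p n) (prime≥1 pp)
  ... | no ¬pp = ≤-reflexive (sym (cong (p ^_) (¬Prime⇒v≡0 n ¬pp)))

  -- Every prime in (m , 2m] divides (2m)! but not m!, hence divides the binomial coefficient `B`.
  -- The product of these primes, at least `m` to the power of their number, is thus at most
  -- `B ≤ 4 ^ m`.
  upper-half-bound : ∀ m → m ^ π-upper-half m ≤ 4 ^ m
  upper-half-bound m with subst (λ z → m ! * z ! ∣ (m + m) !) (m+n∸m≡n m m) (k![n∸k]!∣n! (m≤m+n m m))
  ... | divides B eq = begin
    m ^ π-upper-half m                               ≡⟨ prodTo-choose (λ i → prime? (suc m + i)) m m ⟨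
    prodTo m (λ i → choose (prime? (suc m + i)) m)   ≤⟨ prodTo-mono m term ⟩
    prodTo m (λ i → (suc m + i) ^ v (suc m + i) B)   ≤⟨ m≤n*m _ (prodTo (suc m) (λ p → p ^ v p B))
        {{≥1⇒≢0 (prodTo-pos (suc m) _ (λ p _ → ^v≥1 p B))}} ⟩
    prodTo (suc m) (λ p → p ^ v p B) * prodTo m (λ i → (suc m + i) ^ v (suc m + i) B) ≡⟨ prodTo-split (suc m) m _ ⟨
    prodTo (suc m + m) (λ p → p ^ v p B)             ≡⟨ ≡prodTo (suc m + m) B≥1
        (λ p pp d → s≤s (prime∣!⇒≤ (m + m) pp (∣-trans d B∣))) ⟨
    B                                                ≤⟨ *-cancelʳ-≤ B (4 ^ m) (m ! * m !) {{≥1⇒≢0 f≥1}}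
        (subst (_≤ 4 ^ m * (m ! * m !)) eq (central-≤ m)) ⟩
    4 ^ m ∎
    where
      open ≤-Reasoning
      f≥1 : 1 ≤ m ! * m !
      f≥1 = *-≥1 (!≥1 m) (!≥1 m)
      B∣ : B ∣ (m + m) !
      B∣ = divides (m ! * m !) (trans eq (*-comm B _))
      B≥1 : 1 ≤ B
      B≥1 = ∣⇒≥1 (!≥1 (m + m)) B∣
      p∣B : ∀ i → i < m → Prime (suc m + i) → suc m + i ∣ B
      p∣B i i<m pp with euclidsLemma B (m ! * m !) pp (subst (suc m + i ∣_) eq (≤⇒∣! (s≤s z≤n) (+-monoʳ-< m i<m)))
      ... | inj₁ d = d
      ... | inj₂ d with euclidsLemma (m !) (m !) pp d
      ...   | inj₁ e = ⊥-elim (<⇒≱ (s≤s (m≤m+n m i)) (prime∣!⇒≤ m pp e))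
      ...   | inj₂ e = ⊥-elim (<⇒≱ (s≤s (m≤m+n m i)) (prime∣!⇒≤ m pp e))
      term : ∀ i → i < m → choose (prime? (suc m + i)) m ≤ (suc m + i) ^ v (suc m + i) B
      term i i<m with prime? (suc m + i)
      ... | no _   = ^v≥1 (suc m + i) B
      ... | yes pp = ≤-trans (m≤n⇒m≤1+n (m≤m+n m i)) (≤-trans (≤-reflexive (sym (*-identityʳ (suc m + i))))
                       (^-monoʳ-≤ (suc m + i) (∣⇒v≥1 {suc m + i} {B} pp B≥1 (p∣B i i<m pp))))

  -- π(2ⁱ) ≤ 6 · 2ⁱ / i by doubling. At most 2 · 2ⁱ / i primes lie between 2ⁱ and 2ⁱ⁺¹, and the step
  -- closes because 8 (i + 1) ≤ 12 i for i ≥ 2. This inequality is the origin of the constant 6 and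
  -- of the starting exponent 2.
  chebyshev : ∀ j → (2 + j) * π (suc (2 ^ (2 + j))) ≤ 6 * 2 ^ (2 + j)
  chebyshev zero = ≤-trans (*-monoʳ-≤ 2 (count≤ prime? 5)) (m≤m+n 10 14)
  chebyshev (suc j) = *-cancelˡ-≤ i (begin
    i * (suc i * π (suc (2 ^ suc i)))   ≡⟨ cong (λ z → i * (suc i * π (suc z)))
        (cong (2 ^ i +_) (+-identityʳ (2 ^ i))) ⟩
    i * (suc i * π (suc (2 ^ i) + 2 ^ i)) ≡⟨ cong (λ z → i * (suc i * z)) (π-double (2 ^ i)) ⟩
    i * (suc i * (π (suc (2 ^ i)) + D)) ≡⟨ l1 i (π (suc (2 ^ i))) D ⟩
    suc i * (i * π (suc (2 ^ i)) + i * D) ≤⟨ *-monoʳ-≤ (suc i) (+-mono-≤ (chebyshev j) iD) ⟩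
    suc i * (6 * 2 ^ i + 2 * 2 ^ i)     ≡⟨ l2 j (2 ^ i) ⟩
    (24 + 8 * j) * 2 ^ i                ≤⟨ *-monoˡ-≤ (2 ^ i) (+-monoʳ-≤ 24 (*-monoˡ-≤ j (m≤m+n 8 4))) ⟩
    (24 + 12 * j) * 2 ^ i               ≡⟨ l3 j (2 ^ i) ⟩
    i * (6 * 2 ^ suc i) ∎)
    where
      open ≤-Reasoning
      i = suc (suc j)
      D = π-upper-half (2 ^ i)
      iD : i * D ≤ 2 * 2 ^ i
      iD = ^-cancelʳ-≤ 2 ≤-refl (begin
        2 ^ (i * D)     ≡⟨ ^-*-assoc 2 i D ⟨
        (2 ^ i) ^ D     ≤⟨ upper-half-bound (2 ^ i) ⟩
        4 ^ (2 ^ i)     ≡⟨ ^-*-assoc 2 2 (2 ^ i) ⟩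
        2 ^ (2 * 2 ^ i) ∎)
      l1 : ∀ i a b → i * (suc i * (a + b)) ≡ suc i * (i * a + i * b)
      l1 = solve-∀
      l2 : ∀ j x → (3 + j) * (6 * x + 2 * x) ≡ (24 + 8 * j) * x
      l2 = solve-∀
      l3 : ∀ j x → (24 + 12 * j) * x ≡ (2 + j) * (6 * (2 * x))
      l3 = solve-∀

-- Multiples in an interval, and Legendre's formula for factorials.

module Multiples where

  open Range
  open Factor
  open import Data.Nat
  open import Data.Nat.Properties
  open import Data.Nat.Divisibility
  open import Data.Nat.Tactic.RingSolver using (solve-∀)

  !≡prodTo : ∀ n → n ! ≡ prodTo n suc
  !≡prodTo zero    = refl
  !≡prodTo (suc n) = trans (*-comm (suc n) (n !)) (cong (_* suc n) (!≡prodTo n))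

  count-multiples : ∀ m Y → m * count (λ i → m ∣? suc i) Y ≤ Y
  count-multiples m Y = go Y (last Y)
    where
      C = count (λ i → m ∣? suc i)
      -- The invariant compares the count with the last multiple `k` met instead of with `Y`,
      -- because consecutive multiples are at least `m` apart.
      last : ∀ Y → ∃ λ k → m * C Y ≤ k × k ≤ Y × m ∣ k
      last zero = 0 , ≤-reflexive (*-zeroʳ m) , z≤n , m ∣0
      last (suc Y) with m ∣? suc Y | last Y
      ... | no _  | k , a , b , c = k , subst (λ z → m * z ≤ k) (sym (+-identityʳ (C Y))) a , m≤n⇒m≤1+n b , c
      ... | yes d | k , a , b , c = suc Y , ≤-trans (≤-reflexive (lem m (C Y))) (≤-trans (+-monoʳ-≤ m a) m+k≤) ,
          ≤-refl , d
        where
          lem : ∀ m c → m * (c + 1) ≡ m + m * c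
          lem = solve-∀
          m+k≤ : m + k ≤ suc Y
          m+k≤ = ≤-trans (+-monoˡ-≤ k (∣⇒≤′ (m<n⇒0<n∸m (s≤s b))
              (∣m+n∣m⇒∣n (subst (m ∣_) (sym (m+[n∸m]≡n (m≤n⇒m≤1+n b))) d) c)))
            (≤-reflexive (m∸n+n≡m (m≤n⇒m≤1+n b)))
      go : ∀ Y → (∃ λ k → m * C Y ≤ k × k ≤ Y × m ∣ k) → m * C Y ≤ Y
      go Y (k , a , b , c) = ≤-trans a b

  multiples : ℕ → ℕ → ℕ
  multiples L m = count (λ i → m ∣? suc i) L

  -- The first `m * t` positive integers fall into `t` blocks of length `m`, each ending in a
  -- multiple of `m`.
  multiples-≥ : ∀ {L m} t → 1 ≤ m → m * t ≤ L → t ≤ multiples L m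
  multiples-≥ {L} {m} t hm h = ≤-trans (go t) (sumTo-≤-range _ h)
    where
      go : ∀ t → t ≤ multiples (m * t) m
      go zero    = z≤n
      go (suc t) = subst (λ z → suc t ≤ multiples z m) (trans (+-comm (m * t) m) (sym (*-suc m t)))
        (≤-trans (≤-trans (≤-reflexive (+-comm 1 t)) (+-mono-≤ (go t) one))
            (≤-reflexive (sym (sumTo-split (m * t) m _))))
        where
          last : ∀ {m} → 1 ≤ m → suc (m * t + (m ∸ 1)) ≡ m * suc t
          last {suc m} _ = trans (sym (+-suc (suc m * t) m))
              (trans (+-comm (suc m * t) (suc m)) (sym (*-suc (suc m) t)))
          pred< : ∀ {m} → 1 ≤ m → m ∸ 1 < m
          pred< {suc m} _ = ≤-refl
          one : 1 ≤ sumTo m (λ i → ind (m ∣? suc (m * t + i)))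
          one = ≤-trans (≤-reflexive (sym
              (ind-yes (m ∣? suc (m * t + (m ∸ 1))) (subst (m ∣_) (sym (last hm)) (m∣m*n (suc t))))))
            (sumTo-≥-term m _ (m ∸ 1) (pred< hm))

  -- Members of one residue class are spaced by at least `m`, so those after the first are no more
  -- numerous than the multiples of `m` up to `L`. Counting against `multiples` instead of a
  -- quotient lets these bounds add up to Legendre's sum.
  count-congruent : ∀ {P : ℕ → Set} (P? : Decidable P) L m → 1 ≤ m →
    (∀ i j → i < j → j < L → P i → P j → m ∣ j ∸ i) → count P? L ≤ suc (multiples L m)
  count-congruent P? L m hm h = go (last L h)
    where
      C = count P?
      last : ∀ L → (∀ i j → i < j → j < L → _ → _ → m ∣ j ∸ i) → C L ≡ 0 ⊎ (∃ λ k → k < L × _ × m * C L ≤ m + k)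
      last zero h = inj₁ refl
      last (suc L) h with P? L | last L (λ i j i<j j<L → h i j i<j (m<n⇒m<1+n j<L))
      ... | no _  | inj₁ e = inj₁ (trans (+-identityʳ _) e)
      ... | no _  | inj₂ (k , k<L , pk , le) = inj₂
          (k , m<n⇒m<1+n k<L , pk , subst (λ z → m * z ≤ m + k) (sym (+-identityʳ (C L))) le)
      ... | yes p | inj₁ e = inj₂ (L , ≤-refl , p , ≤-trans
          (≤-reflexive (trans (cong (λ z → m * (z + 1)) e) (*-identityʳ m))) (m≤m+n m L))
      ... | yes p | inj₂ (k , k<L , pk , le) = inj₂
          (L , ≤-refl , p , ≤-trans (≤-reflexive (lem m (C L))) (+-monoʳ-≤ m (≤-trans le
              (≤-trans (+-monoˡ-≤ k (∣⇒≤′ (m<n⇒0<n∸m k<L) (h k L k<L ≤-refl pk p)))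
                  (≤-reflexive (m∸n+n≡m (<⇒≤ k<L)))))))
        where lem : ∀ m c → m * (c + 1) ≡ m + m * c
              lem = solve-∀
      go : C L ≡ 0 ⊎ (∃ λ k → k < L × _ × m * C L ≤ m + k) → C L ≤ suc (multiples L m)
      go (inj₁ e) = ≤-trans (≤-reflexive e) z≤n
      go (inj₂ (k , k<L , _ , le)) = bound (C L) le
        where
          bound : ∀ c → m * c ≤ m + k → c ≤ suc (multiples L m)
          bound zero    _  = z≤n
          bound (suc c) le = s≤s (multiples-≥ {L} {m} c hm
              (≤-trans (+-cancelˡ-≤ m _ _ (≤-trans (≤-reflexive (sym (*-suc m c))) le)) (<⇒≤ k<L)))

  ≤count-below : ∀ J n → n ≤ J → n ≤ count (λ j → suc j ≤? n) J
  ≤count-below J n h = ≤-trans (≤-reflexive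
      (sym (trans (sumTo-cong n (λ j j<n → ind-yes (suc j ≤? n) j<n)) (trans (sumTo-const n 1) (*-identityʳ n)))))
    (sumTo-≤-range _ h)

  count-below≤ : ∀ J n → count (λ j → suc j ≤? n) J ≤ n
  count-below≤ zero    n = z≤n
  count-below≤ (suc J) n = go (suc J ≤? n)
    where
      go : Dec (suc J ≤ n) → count (λ j → suc j ≤? n) (suc J) ≤ n
      go (yes h) = ≤-trans (count≤ (λ j → suc j ≤? n) (suc J)) h
      go (no ¬h) = ≤-trans (≤-reflexive
          (trans (cong (count (λ j → suc j ≤? n) J +_) (ind-no (suc J ≤? n) ¬h)) (+-identityʳ _))) (count-below≤ J n)

  v≤count : ∀ {p a} J → Prime p → 1 ≤ a → v p a ≤ J → v p a ≤ count (λ j → p ^ suc j ∣? a) J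
  v≤count {p} {a} J pp ha h = ≤-trans (≤count-below J (v p a) h)
    (count-mono (λ j → suc j ≤? v p a) (λ j → p ^ suc j ∣? a) J (λ j _ → ≤v⇒^∣ {p} {a} (suc j) ha))

  count≤v : ∀ {p a} J → Prime p → 1 ≤ a → count (λ j → p ^ suc j ∣? a) J ≤ v p a
  count≤v {p} {a} J pp ha = ≤-trans
      (count-mono (λ j → p ^ suc j ∣? a) (λ j → suc j ≤? v p a) J (λ j _ → ^∣⇒≤v {p} {a} (suc j) pp ha))
    (count-below≤ J (v p a))

  -- Legendre's sum for the valuation of `L !`, cut off after the first `J` powers of `p`.
  legendre : ℕ → ℕ → ℕ → ℕ
  legendre p L J = sumTo J (λ j → multiples L (p ^ suc j))

  legendre≤v : ∀ {p} L J → Prime p → legendre p L J ≤ v p (L !)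
  legendre≤v {p} L J pp = ≤-trans (≤-reflexive (sumTo-swap J L _))
      (≤-trans (sumTo-mono L (λ i _ → count≤v {p} {suc i} J pp (s≤s z≤n)))
    (≤-reflexive (trans (sym (v-prodTo p L suc (λ _ _ → s≤s z≤n))) (cong (v p) (sym (!≡prodTo L))))))

  -- The geometric bound L / p + L / p² + ... ≤ L, meant for the finitely many small primes. The
  -- invariant counts the last term twice, as its own remainder: there are at least twice as many
  -- multiples of `p ^ J` as of `p ^ suc J`.
  legendre≤ : ∀ {p} L J → 2 ≤ p → legendre p L J ≤ L
  legendre≤ {p} L J hp = ≤-trans (m≤m+n _ _) (go J)
    where
      go : ∀ J → legendre p L J + multiples L (p ^ J) ≤ L
      go zero    = count≤ (λ i → 1 ∣? suc i) L
      go (suc J) = ≤-trans (≤-reflexive (+-assoc (legendre p L J) m′ m′))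
          (≤-trans (+-monoʳ-≤ (legendre p L J) two) (go J))
        where
          m′ = multiples L (p ^ suc J)
          p^≥1 = ^-≥1 {p} J (≤-trans (s≤s z≤n) hp)
          two : m′ + m′ ≤ multiples L (p ^ J)
          two = ≤-trans (≤-reflexive (cong (m′ +_) (sym (+-identityʳ m′)))) (≤-trans (*-monoˡ-≤ m′ hp)
            (multiples-≥ {L} {p ^ J} (p * m′) p^≥1
                (≤-trans (≤-reflexive (trans (sym (*-assoc (p ^ J) p m′)) (cong (_* m′) (*-comm (p ^ J) p))))
                (count-multiples (p ^ suc J) L))))

  argmax : ∀ L (φ : ℕ → ℕ) → 1 ≤ L → ∃ λ i → i < L × (∀ j → j < L → φ j ≤ φ i)
  argmax (suc zero) φ _ = 0 , s≤s z≤n , λ { zero _ → ≤-refl ; (suc j) (s≤s ()) }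
  argmax (suc L@(suc _)) φ _ = go (argmax L φ (s≤s z≤n))
    where
      go : (∃ λ i → i < L × (∀ j → j < L → φ j ≤ φ i)) → ∃ λ i → i < suc L × (∀ j → j < suc L → φ j ≤ φ i)
      go (i , i<L , h) with φ L ≤? φ i
      ... | yes q = i , m<n⇒m<1+n i<L , λ j j<sL → split j (m≤n⇒m<n∨m≡n (s≤s⁻¹ j<sL))
        where split : ∀ j → j < L ⊎ j ≡ L → φ j ≤ φ i
              split j (inj₁ j<L) = h j j<L
              split j (inj₂ refl) = q
      ... | no ¬q = L , ≤-refl , λ j j<sL → split j (m≤n⇒m<n∨m≡n (s≤s⁻¹ j<sL))
        where split : ∀ j → j < L ⊎ j ≡ L → φ j ≤ φ L
              split j (inj₁ j<L) = ≤-trans (h j j<L) (<⇒≤ (≰⇒> ¬q))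
              split j (inj₂ refl) = ≤-refl

-- Counting by pigeonhole on lists.

module ListCount where

  open import Data.Nat
  open import Data.Nat.Properties
  open import Data.Fin using (Fin; zero; suc)
  open import Data.Fin.Properties using (pigeonhole)
  import Data.Fin as Fin
  import Data.Fin.Properties as Fin
  open import Data.List using (length; lookup; cartesianProduct; map; filter; downFrom)
  open import Data.List.Properties using (length-++; length-map)
  open import Data.List.Membership.Propositional.Properties using (∈-lookup)
  import Data.List.Relation.Unary.Any as Any
  import Data.List.Relation.Unary.Any.Properties as Any
  open import Data.List.Relation.Unary.AllPairs using ([]; _∷_)
  open import Data.List.Relation.Unary.Unique.Propositional using (Unique)
  open Range

  lookup-unique : ∀ {A : Set} {xs : List A} → Unique xs → ∀ i j → lookup xs i ≡ lookup xs j → i ≡ j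
  lookup-unique {xs = x ∷ xs} (x∉ ∷ u) zero    zero    e = refl
  lookup-unique {xs = x ∷ xs} (x∉ ∷ u) zero    (suc j) e = ⊥-elim (All.lookup x∉ (∈-lookup j) e)
  lookup-unique {xs = x ∷ xs} (x∉ ∷ u) (suc i) zero    e = ⊥-elim (All.lookup x∉ (∈-lookup i) (sym e))
  lookup-unique {xs = x ∷ xs} (x∉ ∷ u) (suc i) (suc j) e = cong suc (lookup-unique u i j e)

  -- Pigeonhole for a relation instead of a function: in the main application the partner of a pair
  -- comes from Thue's lemma together with evidence, and injectivity is a statement about that
  -- evidence.
  length-≤ : ∀ {A B : Set} (R : A → B → Set) {xs : List A} {ys : List B} → Unique xs
    → (∀ {x} → x ∈ xs → ∃ λ y → y ∈ ys × R x y)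
    → (∀ {x x′ y} → R x y → R x′ y → x ≡ x′)
    → length xs ≤ length ys
  length-≤ R {xs} {ys} u f inj with length xs ≤? length ys
  ... | yes h = h
  ... | no ¬h = ⊥-elim (clash (pigeonhole (≰⇒> ¬h) g))
    where
      F = λ i → f (∈-lookup {xs = xs} i)
      g : Fin (length xs) → Fin (length ys)
      g i = Any.index (proj₁ (proj₂ (F i)))
      Rg : ∀ i → R (lookup xs i) (lookup ys (g i))
      Rg i = subst (R (lookup xs i)) (Any.lookup-index (proj₁ (proj₂ (F i)))) (proj₂ (proj₂ (F i)))
      clash : ¬ (∃ λ i → ∃ λ j → (i Fin.< j) × g i ≡ g j)
      clash (i , j , i<j , e) = Fin.<-irrefl (lookup-unique u i j
        (inj (Rg i) (subst (λ k → R (lookup xs j) (lookup ys k)) (sym e) (Rg j)))) i<j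

  length-cartesianProduct : ∀ {A B : Set} (xs : List A) (ys : List B) → length (cartesianProduct xs ys) ≡ length xs *
      length ys
  length-cartesianProduct []       ys = refl
  length-cartesianProduct (x ∷ xs) ys = trans (length-++ (map (x ,_) ys))
    (cong₂ _+_ (length-map (x ,_) ys) (length-cartesianProduct xs ys))

  length-filter-downFrom : ∀ {P : ℕ → Set} (P? : Decidable P) n → length (filter P? (downFrom n)) ≡ count P? n
  length-filter-downFrom P? zero = refl
  length-filter-downFrom P? (suc n) with P? n
  ... | yes _ = trans (cong suc (length-filter-downFrom P? n)) (+-comm 1 _)
  ... | no _  = trans (length-filter-downFrom P? n) (sym (+-identityʳ _))

-- Divisibility of integers by primes and by squares.

module IntDiv where

  open Factor
  open import Data.Nat.Primality using (euclidsLemma)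
  open import Data.Integer hiding (suc; pred)
  open import Data.Integer.Properties
  open import Data.Integer.Divisibility.Signed renaming (_∣_ to _∥_)
  open import Data.Integer.Tactic.RingSolver using (solve-∀)

  prime-∣* : ∀ {p} i j → Prime p → + p ∥ i * j → + p ∥ i ⊎ + p ∥ j
  prime-∣* {p} i j pp d with euclidsLemma ∣ i ∣ ∣ j ∣ pp (subst (p ℕ.∣_) (abs-* i j) (∣⇒∣ᵤ d))
  ... | inj₁ e = inj₁ (∣ᵤ⇒∣ e)
  ... | inj₂ e = inj₂ (∣ᵤ⇒∣ e)

  ∣-small⇒0 : ∀ {p} i → + p ∥ i → ∣ i ∣ ℕ.< p → i ≡ 0ℤ
  ∣-small⇒0 {p} i d lt with ∣ i ∣ in eq
  ... | zero  = ∣i∣≡0⇒i≡0 eq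
  ... | suc k = ⊥-elim (ℕ.<⇒≱ lt (ℕ.∣⇒≤ (subst (p ℕ.∣_) eq (∣⇒∣ᵤ d))))

  *≡0⇒ : ∀ i j → i * j ≡ 0ℤ → i ≡ 0ℤ ⊎ j ≡ 0ℤ
  *≡0⇒ i j = i*j≡0⇒i≡0∨j≡0 i

  *-≢0 : ∀ {i j} → i ≢ 0ℤ → j ≢ 0ℤ → i * j ≢ 0ℤ
  *-≢0 {i} {j} hi hj e with *≡0⇒ i j e
  ... | inj₁ h = hi h
  ... | inj₂ h = hj h

  ≢0⇒abs≥1 : ∀ {i} → i ≢ 0ℤ → 1 ℕ.≤ ∣ i ∣
  ≢0⇒abs≥1 {i} h with ∣ i ∣ in eq
  ... | zero  = ⊥-elim (h (∣i∣≡0⇒i≡0 eq))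
  ... | suc _ = ℕ.s≤s ℕ.z≤n

  ∣i∣²≡i² : ∀ i → + (∣ i ∣ ℕ.* ∣ i ∣) ≡ i * i
  ∣i∣²≡i² (+ n)    = pos-* n n
  ∣i∣²≡i² -[1+ n ] = refl

  sq∣sq⇒∣ : ∀ {i j} → i ≢ 0ℤ → j ≢ 0ℤ → i * i ∥ j * j → i ∥ j
  sq∣sq⇒∣ {i} {j} hi hj d = ∣ᵤ⇒∣ (v-≤⇒∣ ai aj λ p _ → ℕ.*-cancelˡ-≤ 2 (ℕ.≤-trans (ℕ.≤-reflexive (sym (v-sq p ai)))
      (ℕ.≤-trans (v-mono p) (ℕ.≤-reflexive (v-sq p aj)))))
    where
      ai = ≢0⇒abs≥1 hi
      aj = ≢0⇒abs≥1 hj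
      v-sq : ∀ p {n} → 1 ℕ.≤ n → v p (n ℕ.* n) ≡ 2 ℕ.* v p n
      v-sq p {n} h = trans (v-* p h h) (cong (v p n ℕ.+_) (sym (ℕ.+-identityʳ (v p n))))
      d′ : ∣ i ∣ ℕ.* ∣ i ∣ ℕ.∣ ∣ j ∣ ℕ.* ∣ j ∣
      d′ = subst₂ ℕ._∣_ (abs-* i i) (abs-* j j) (∣⇒∣ᵤ d)
      v-mono : ∀ p → v p (∣ i ∣ ℕ.* ∣ i ∣) ℕ.≤ v p (∣ j ∣ ℕ.* ∣ j ∣)
      v-mono p = v-∣-mono p (*-≥1 aj aj) d′

  -- Y² divides X², so Y divides X by comparing valuations, and the quotient is a square root of
  -- `D`. Valuations say nothing about 0, hence the separate case, where `D` itself is 0.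
  sq≡*sq⇒square : ∀ {D X Y} → Y ≢ 0ℤ → X * X ≡ D * (Y * Y) → ∃ λ e → e * e ≡ D
  sq≡*sq⇒square {D} {X} {Y} hY eq with X ≟ 0ℤ
  ... | yes refl = 0ℤ , sym (go (*≡0⇒ D (Y * Y) (sym eq)))
    where go : D ≡ 0ℤ ⊎ Y * Y ≡ 0ℤ → D ≡ 0ℤ
          go (inj₁ h) = h
          go (inj₂ h) = ⊥-elim (*-≢0 hY hY h)
  ... | no hX with sq∣sq⇒∣ {Y} {X} hY hX (divides D eq)
  ...   | divides k X≡kY = k , *-cancelʳ-≡ _ _ (Y * Y) {{≢-nonZero (*-≢0 hY hY)}}
            (trans (lem k Y) (trans (cong₂ _*_ (sym X≡kY) (sym X≡kY)) eq))
    where lem : ∀ k Y → k * k * (Y * Y) ≡ (k * Y) * (k * Y)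
          lem = solve-∀

  -- Shifts [-R , R] to the natural numbers below 2R + 1, so that boxes of integers can be
  -- enumerated by `upTo`.
  recentre : ∀ {R} X → ∣ X ∣ ℕ.≤ R → ∃ λ a → a ℕ.< suc (R ℕ.+ R) × + a - + R ≡ X
  recentre {R} (+ n)     h = n ℕ.+ R , s≤s (ℕ.+-monoˡ-≤ R h) , lem (+ n) (+ R)
    where lem : ∀ n R → n + R - R ≡ n
          lem = solve-∀
  recentre {R} -[1+ n ] h = R ℕ.∸ suc n , s≤s (ℕ.≤-trans (ℕ.m∸n≤m R (suc n)) (ℕ.m≤m+n R R))
    , trans (cong (_- + R) (sym (trans (m-n≡m⊖n R (suc n)) (⊖-≥ h)))) (lem (+ R) (+ suc n))
    where lem : ∀ R n → R - n - R ≡ - n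
          lem = solve-∀

-- Thue's lemma for several moduli at once.

module Thue where

  open import Data.Integer hiding (suc; pred)
  open import Data.Integer.Properties
  open import Data.Integer.Divisibility.Signed renaming (_∣_ to _∥_)
  open import Data.Integer.Tactic.RingSolver using (solve-∀)
  open import Data.Nat.ListAction using (product)
  open import Data.Fin as Fin using (Fin; toℕ; fromℕ<)
  import Data.Fin.Properties as Fin
  open import Data.List using (map)

  -- At modulus 0 the remainder is `a` itself, which keeps `rem≡⇒∥` true there.
  rem : ℕ → ℕ → ℕ
  rem a zero      = a
  rem a p@(suc _) = a ℕ.% p

  rem≡⇒∥ : ∀ {a b} p → rem a p ≡ rem b p → + p ∥ + a - + b
  rem≡⇒∥ {a} {b} zero      refl = divides 0ℤ (+-inverseʳ (+ a))
  rem≡⇒∥ {a} {b} p@(suc _) e    = divides (+ (a ℕ./ p) - + (b ℕ./ p))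
    (trans (cong₂ _-_ (split a) (split b))
        (trans (cong (λ r → + (a ℕ.% p) + + (a ℕ./ p) * + p - (+ r + + (b ℕ./ p) * + p)) (sym e))
      (lem (+ (a ℕ.% p)) (+ (a ℕ./ p)) (+ (b ℕ./ p)) (+ p))))
    where
      split : ∀ n → + n ≡ + (n ℕ.% p) + + (n ℕ./ p) * + p
      split n = trans (cong +_ (ℕ.m≡m%n+[m/n]*n n p)) (cong (λ z → + (n ℕ.% p) + z) (pos-* (n ℕ./ p) p))
      lem : ∀ r x y p → r + x * p - (r + y * p) ≡ (x - y) * p
      lem = solve-∀

  modulus : List (ℕ × ℕ) → ℕ
  modulus l = product (map proj₁ l)

  -- Mixed-radix encoding of the residues of x + e y modulo the p, for (p , e) in the list.
  code : List (ℕ × ℕ) → ℕ → ℕ → ℕ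
  code []            x y = 0
  code ((p , e) ∷ l) x y = rem (x ℕ.+ e ℕ.* y) p ℕ.+ p ℕ.* code l x y

  code-< : ∀ l x y → All (λ pe → 1 ℕ.≤ proj₁ pe) l → code l x y ℕ.< modulus l
  code-< [] x y [] = s≤s z≤n
  code-< ((p@(suc _) , e) ∷ l) x y (h ∷ hs) = ℕ.≤-trans (ℕ.+-monoˡ-< (p ℕ.* code l x y) (ℕ.m%n<n (x ℕ.+ e ℕ.* y) p))
    (ℕ.≤-trans (ℕ.≤-reflexive (sym (ℕ.*-suc p (code l x y)))) (ℕ.*-monoʳ-≤ p (code-< l x y hs)))

  code-≡⇒∥ : ∀ l {x y x′ y′} → All (λ pe → 1 ℕ.≤ proj₁ pe) l → code l x y ≡ code l x′ y′
    → All (λ pe → + proj₁ pe ∥ (+ x - + x′) + + proj₂ pe * (+ y - + y′)) l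
  code-≡⇒∥ [] [] _ = []
  code-≡⇒∥ ((p@(suc _) , e) ∷ l) {x} {y} {x′} {y′} (_ ∷ hs) eq =
    subst (+ p ∥_) (trans (cong₂ _-_ (split x y) (split x′ y′)) (lem (+ x) (+ x′) (+ e) (+ y) (+ y′)))
        (rem≡⇒∥ {x ℕ.+ e ℕ.* y} {x′ ℕ.+ e ℕ.* y′} p r≡)
    ∷ code-≡⇒∥ l hs (ℕ.*-cancelˡ-≡ _ _ p (ℕ.+-cancelˡ-≡ (rem (x ℕ.+ e ℕ.* y) p) _ _
        (trans eq (cong (ℕ._+ p ℕ.* code l x′ y′) (sym r≡)))))
    where
      split : ∀ x y → + (x ℕ.+ e ℕ.* y) ≡ + x + + e * + y
      split x y = cong (λ z → + x + z) (pos-* e y)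
      lem : ∀ x x′ e y y′ → (x + e * y) - (x′ + e * y′) ≡ (x - x′) + e * (y - y′)
      lem = solve-∀
      low : ∀ a c → (a ℕ.% p ℕ.+ p ℕ.* c) ℕ.% p ≡ a ℕ.% p
      low a c = trans (cong (λ z → (a ℕ.% p ℕ.+ z) ℕ.% p) (ℕ.*-comm p c))
        (trans (ℕ.[m+kn]%n≡m%n (a ℕ.% p) c p) (ℕ.m<n⇒m%n≡m (ℕ.m%n<n a p)))
      r≡ : rem (x ℕ.+ e ℕ.* y) p ≡ rem (x′ ℕ.+ e ℕ.* y′) p
      r≡ = trans (sym (low (x ℕ.+ e ℕ.* y) (code l x y)))
          (trans (cong (ℕ._% p) eq) (low (x′ ℕ.+ e ℕ.* y′) (code l x′ y′)))

  isqrt : ∀ m → ∃ λ R → R ℕ.* R ℕ.≤ m × m ℕ.< suc R ℕ.* suc R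
  isqrt zero = 0 , z≤n , s≤s z≤n
  isqrt (suc m) with isqrt m
  ... | R , lo , hi with suc m ℕ.<? suc R ℕ.* suc R
  ...   | yes h = R , ℕ.m≤n⇒m≤1+n lo , h
  ...   | no ¬h = suc R , ℕ.≮⇒≥ ¬h , ℕ.≤-trans (s≤s hi)
      (ℕ.*-mono-< {suc R} {suc (suc R)} {suc R} {suc (suc R)} (ℕ.n<1+n _) (ℕ.n<1+n _))

  abs-sub-≤ : ∀ {a b} R → a ℕ.≤ R → b ℕ.≤ R → ∣ + a - + b ∣ ℕ.≤ R
  abs-sub-≤ {a} {b} R ha hb = ℕ.≤-trans (ℕ.≤-reflexive (cong ∣_∣ (m-n≡m⊖n a b)))
      (ℕ.≤-trans (∣m⊝n∣≤m⊔n a b) (ℕ.⊔-lub ha hb))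

  -- There are (R + 1)² points in the square [0 , R]² but fewer codes, so two points agree in all
  -- residues and their difference is the solution. Residues are recorded separately for each entry,
  -- so a prime may occur twice with different coefficients; this happens when it divides both
  -- members of a pair.
  thue : ∀ l → All (λ pe → 1 ℕ.≤ proj₁ pe) l → ∀ R → modulus l ℕ.< suc R ℕ.* suc R →
    ∃₂ λ X Y → ¬ (X ≡ 0ℤ × Y ≡ 0ℤ) × ∣ X ∣ ℕ.≤ R × ∣ Y ∣ ℕ.≤ R × All (λ pe → + proj₁ pe ∥ X + + proj₂ pe * Y) l
  thue l hl R lt with Fin.pigeonhole lt (λ i → fromℕ< (code-< l (toℕ i ℕ./ suc R) (toℕ i ℕ.% suc R) hl))
  ... | i , j , i<j , eq = + x i - + x j , + y i - + y j , nz , abs-sub-≤ R (x≤ i) (x≤ j) , abs-sub-≤ R (y≤ i) (y≤ j)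
      , code-≡⇒∥ l hl (Fin.fromℕ<-injective _ _ (code-< l (x i) (y i) hl) (code-< l (x j) (y j) hl) eq)
    where
      -- A point of the square is read off from the two digits of the index in base R + 1.
      x y : Fin (suc R ℕ.* suc R) → ℕ
      x i = toℕ i ℕ./ suc R
      y i = toℕ i ℕ.% suc R
      x≤ : ∀ i → x i ℕ.≤ R
      x≤ i = ℕ.s≤s⁻¹ (ℕ.m<n*o⇒m/o<n (Fin.toℕ<n i))
      y≤ : ∀ i → y i ℕ.≤ R
      y≤ i = ℕ.s≤s⁻¹ (ℕ.m%n<n (toℕ i) (suc R))
      nz : ¬ (+ x i - + x j ≡ 0ℤ × + y i - + y j ≡ 0ℤ)
      nz (ex , ey) = ℕ.<-irrefl (trans (ℕ.m≡m%n+[m/n]*n (toℕ i) (suc R))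
        (trans (cong₂ (λ a b → a ℕ.+ b ℕ.* suc R) (+-injective (i-j≡0⇒i≡j (+ y i) (+ y j) ey))
            (+-injective (i-j≡0⇒i≡j (+ x i) (+ x j) ex)))
          (sym (ℕ.m≡m%n+[m/n]*n (toℕ j) (suc R))))) i<j

-- Squarefree products of split primes, represented by the norm form X² - D Y².

module GoodPairs (D : ℤ) (nsq : ∀ e → e ℤ.* e ≢ D) where

  open Range
  open Factor
  open IntDiv
  open Thue
  open ListCount
  open import Data.Nat.Primality using (prime?; euclidsLemma)
  open import Data.Nat.ListAction using (product)
  open import Data.Nat.ListAction.Properties using (product-++)
  open import Data.Integer hiding (suc; pred; _<_; _≤_; _<?_)
  open import Data.Integer.Properties hiding (_≤?_; _<?_)
  open import Data.Integer.Divisibility.Signed renaming (_∣_ to _∥_; _∣?_ to _∥?_)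
  open import Data.Integer.Tactic.RingSolver using (solve-∀)
  open import Data.Nat.Tactic.RingSolver using () renaming (solve-∀ to solve-∀ₙ)
  open import Data.List using (map; _++_; upTo; cartesianProduct; length)
  open import Data.List.Properties using (map-++; map-∘; map-id; length-upTo)
  import Data.List.Relation.Unary.All.Properties as All
  open import Data.List.Relation.Unary.Unique.Propositional using (Unique)
  open import Data.List.Membership.Propositional.Properties using (∈-cartesianProduct⁺; ∈-upTo⁺)
  open import Relation.Nullary.Decidable using (_×-dec_)

  private
    -- Primes above `H` are odd, do not divide `D`, and exceed the cofactor `h` of every
    -- representation below.
    H : ℕ
    H = 2 ℕ.+ ∣ D ∣

  RootAt Good GoodNumber : ℕ → Set

  Split : ℕ → Set
  Split p = ∃ λ z → z ℕ.< p × + p ∥ + z * + z - D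

  split? : ∀ p → Dec (Split p)
  split? p = ℕ.anyUpTo? (λ z → + p ∥? + z * + z - D) p

  Good p = Prime p × H ℕ.< p × Split p

  good? : ∀ p → Dec (Good p)
  good? p = prime? p ×-dec (H ℕ.<? p) ×-dec split? p

  GoodNumber s = 1 ℕ.≤ s × All (λ p → Good p × v p s ℕ.≤ 1) (primes s)

  goodNumber? : ∀ s → Dec (GoodNumber s)
  goodNumber? s = (1 ℕ.≤? s) ×-dec All.all? (λ p → good? p ×-dec (v p s ℕ.≤? 1)) (primes s)

  -- One root of `D` modulo each split `p`, fixed for all pairs: a prime of `s₁` imposes X ≡ ρ Y and
  -- a prime of `s₂` imposes X ≡ -ρ Y, so that (X , Y) remembers which factor the prime came from.
  -- The value 0 at other `p` is a default.
  ρ : ℕ → ℕ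
  ρ p with split? p
  ... | yes (z , _) = z
  ... | no _        = 0

  ρ-root : ∀ {p} → Split p → + p ∥ + ρ p * + ρ p - D
  ρ-root {p} s with split? p
  ... | yes (_ , _ , d) = d
  ... | no ¬s           = ⊥-elim (¬s s)

  ρ≤ : ∀ p → ρ p ℕ.≤ p
  ρ≤ p with split? p
  ... | yes (_ , lt , _) = ℕ.<⇒≤ lt
  ... | no _             = z≤n

  RootAt p = + p ∥ + ρ p * + ρ p - D

  goodNumber-∣ : ∀ {s p} → GoodNumber s → Prime p → p ℕ.∣ s → Good p
  goodNumber-∣ (hs , a) pp d = proj₁ (All.lookup a (∣⇒∈primes pp hs d))

  goodNumber-v≤1 : ∀ {s p} → GoodNumber s → v p s ℕ.≤ 1
  goodNumber-v≤1 {s} {p} (hs , a) with v p s in eq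
  ... | zero  = z≤n
  ... | suc k = subst (ℕ._≤ 1) eq (proj₂ (All.lookup a (occ⇒∈ (primes s) (subst (1 ℕ.≤_) (sym eq) (s≤s z≤n)))))

  -- Here the assumption p > H rules out p = 2 and p ∣ D.
  both-roots : ∀ {p X Y} → Good p → + p ∥ X - + ρ p * Y → + p ∥ X + + ρ p * Y → + p ∥ X × + p ∥ Y
  both-roots {p} {X} {Y} (pp , H<p , sp) d₁ d₂ = p∥X , p∥Y (prime-∣* (+ ρ p) Y pp p∥ρY)
    where
      cancel : ∀ {i} → + p ∥ + 2 * i → + p ∥ i
      cancel {i} d with prime-∣* (+ 2) i pp d
      ... | inj₂ e = e
      ... | inj₁ e with () ← ∣-small⇒0 (+ 2) e (ℕ.≤-<-trans (ℕ.m≤m+n 2 ∣ D ∣) H<p)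
      l₁ : ∀ x r y → (x - r * y) + (x + r * y) ≡ + 2 * x
      l₁ = solve-∀
      l₂ : ∀ x r y → (x + r * y) - (x - r * y) ≡ + 2 * (r * y)
      l₂ = solve-∀
      p∥X = cancel (subst (+ p ∥_) (l₁ X (+ ρ p) Y) (∣m∣n⇒∣m+n d₁ d₂))
      p∥ρY = cancel (subst (+ p ∥_) (l₂ X (+ ρ p) Y) (∣m∣n⇒∣m-n d₂ d₁))
      p∥Y : + p ∥ + ρ p ⊎ + p ∥ Y → + p ∥ Y
      p∥Y (inj₂ e) = e
      p∥Y (inj₁ e) = ⊥-elim (nsq 0ℤ (sym (∣-small⇒0 D
          (subst (+ p ∥_) (l₃ (+ ρ p) D) (∣m∣n⇒∣m-n (∣m⇒∣m*n (+ ρ p) e) (ρ-root sp)))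
          (ℕ.≤-<-trans (ℕ.m≤n+m ∣ D ∣ 2) H<p))))
        where l₃ : ∀ r d → r * r - (r * r - d) ≡ d
              l₃ = solve-∀

  norm : ℤ → ℤ → ℤ
  norm X Y = X * X - D * (Y * Y)

  p²∥norm : ∀ {p X Y} → + p ∥ X → + p ∥ Y → p ℕ.^ 2 ℕ.∣ ∣ norm X Y ∣
  p²∥norm {p} (divides x refl) (divides y refl) = subst (ℕ._∣ ∣ norm (x * + p) (y * + p) ∣) (abs-sq p)
      (∣⇒∣ᵤ {+ p * + p} (divides (norm x y) (lem x y (+ p) D)))
    where
      lem : ∀ x y p D → (x * p) * (x * p) - D * ((y * p) * (y * p)) ≡ (x * x - D * (y * y)) * (p * p)
      lem = solve-∀
      abs-sq : ∀ p → ∣ + p * + p ∣ ≡ p ℕ.^ 2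
      abs-sq p = trans (abs-* (+ p) (+ p)) (cong (p ℕ.*_) (sym (ℕ.*-identityʳ p)))

  p∥norm : ∀ {p X Y} → RootAt p → + p ∥ X - + ρ p * Y ⊎ + p ∥ X + + ρ p * Y → + p ∥ norm X Y
  p∥norm {p} {X} {Y} r d = subst (+ p ∥_) (lem X Y (+ ρ p) D) (∣m∣n⇒∣m+n (prod d) (∣m⇒∣m*n (Y * Y) r))
    where
      prod : + p ∥ X - + ρ p * Y ⊎ + p ∥ X + + ρ p * Y → + p ∥ (X - + ρ p * Y) * (X + + ρ p * Y)
      prod (inj₁ e) = ∣m⇒∣m*n (X + + ρ p * Y) e
      prod (inj₂ e) = ∣n⇒∣m*n (X - + ρ p * Y) e
      lem : ∀ X Y r D → (X - r * Y) * (X + r * Y) + (r * r - D) * (Y * Y) ≡ X * X - D * (Y * Y)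
      lem = solve-∀

  norm≢0 : ∀ {X Y} → ¬ (X ≡ 0ℤ × Y ≡ 0ℤ) → norm X Y ≢ 0ℤ
  norm≢0 {X} {Y} nz e with Y ≟ 0ℤ | i-j≡0⇒i≡j (X * X) (D * (Y * Y)) e
  ... | no hY | eq with sq≡*sq⇒square {D} {X} {Y} hY eq
  ...   | e , h = nsq e h
  norm≢0 {X} {Y} nz e | yes refl | eq with *≡0⇒ X X (trans eq (*-zeroʳ D))
  ... | inj₁ h = nz (h , refl)
  ... | inj₂ h = nz (h , refl)

  norm-≤ : ∀ {X Y R} → ∣ X ∣ ℕ.≤ R → ∣ Y ∣ ℕ.≤ R → ∣ norm X Y ∣ ℕ.≤ suc ∣ D ∣ ℕ.* (R ℕ.* R)
  norm-≤ {X} {Y} {R} hX hY = ℕ.≤-trans (∣i-j∣≤∣i∣+∣j∣ (X * X) (D * (Y * Y)))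
    (ℕ.+-mono-≤ (ℕ.≤-trans (ℕ.≤-reflexive (abs-* X X)) (ℕ.*-mono-≤ hX hX))
      (ℕ.≤-trans (ℕ.≤-reflexive (trans (abs-* D (Y * Y)) (cong (∣ D ∣ ℕ.*_) (abs-* Y Y))))
          (ℕ.*-monoʳ-≤ ∣ D ∣ (ℕ.*-mono-≤ hY hY))))

  -- The norm fixes the product of the pair once `h` is known; the opposite signs in `roots₁` and
  -- `roots₂` tell how the primes are distributed over the two factors.
  record Represents (s₁ s₂ : ℕ) (X Y : ℤ) (h : ℕ) : Set where
    constructor represents
    field
      good₁  : GoodNumber s₁
      good₂  : GoodNumber s₂
      norm≡  : ∣ norm X Y ∣ ≡ h ℕ.* (s₁ ℕ.* s₂)
      h≥1    : 1 ℕ.≤ h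
      h≤     : h ℕ.≤ suc ∣ D ∣
      roots₁ : ∀ p → Prime p → p ℕ.∣ s₁ → + p ∥ X - + ρ p * Y
      roots₂ : ∀ p → Prime p → p ℕ.∣ s₂ → + p ∥ X + + ρ p * Y

  -- Thue's lemma with one congruence for each prime factor and `R` the integer square root of the
  -- product. The norm is nonzero as `D` is not a square, and at most (1 + |D|) s₁ s₂ in absolute
  -- value, which bounds the cofactor.
  exists-representation : ∀ {s₁ s₂ R} → GoodNumber s₁ → GoodNumber s₂ → R ℕ.* R ℕ.≤ s₁ ℕ.* s₂ → s₁ ℕ.* s₂ ℕ.< suc R
      ℕ.* suc R →
    ∃₂ λ X Y → ∃ λ h → ∣ X ∣ ℕ.≤ R × ∣ Y ∣ ℕ.≤ R × Represents s₁ s₂ X Y h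
  exists-representation {s₁} {s₂} {R} g₁ g₂ lo hi
    with thue (l₁ ++ l₂) hl R (subst (ℕ._< suc R ℕ.* suc R) (sym mod≡) hi)
    where
      -- `p ∸ ρ p` stands for -ρ modulo `p`, as `thue` takes natural coefficients.
      l₁ = map (λ p → p , p ℕ.∸ ρ p) (primes s₁)
      l₂ = map (λ p → p , ρ p) (primes s₂)
      hl : All (λ pe → 1 ℕ.≤ proj₁ pe) (l₁ ++ l₂)
      hl = All.++⁺ (All.map⁺ (All.map prime≥1 (primes-Prime s₁))) (All.map⁺ (All.map prime≥1 (primes-Prime s₂)))
      mod≡ : modulus (l₁ ++ l₂) ≡ s₁ ℕ.* s₂
      mod≡ = trans (cong product (map-++ proj₁ l₁ l₂)) (trans (product-++ (map proj₁ l₁) (map proj₁ l₂))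
        (cong₂ ℕ._*_ (trans (cong product (trans (sym (map-∘ (primes s₁))) (map-id (primes s₁))))
            (primes-product (proj₁ g₁)))
                     (trans (cong product (trans (sym (map-∘ (primes s₂))) (map-id (primes s₂))))
                         (primes-product (proj₁ g₂)))))
  ... | X , Y , nz , hX , hY , a = X , Y , ℕ.quotient s∣N , hX , hY , record
    { good₁ = g₁ ; good₂ = g₂ ; norm≡ = ℕ._∣_.equality s∣N
    ; h≥1 = ∣⇒≥1 N≥1 (ℕ.quotient-∣ s∣N)
    ; h≤ = ℕ.*-cancelʳ-≤ _ _ (s₁ ℕ.* s₂) {{≥1⇒≢0 S≥1}} (ℕ.≤-trans (ℕ.≤-reflexive (sym (ℕ._∣_.equality s∣N)))
             (ℕ.≤-trans (norm-≤ {X} {Y} hX hY) (ℕ.*-monoʳ-≤ (suc ∣ D ∣) lo)))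
    ; roots₁ = roots₁ ; roots₂ = roots₂ }
    where
      S≥1 = *-≥1 (proj₁ g₁) (proj₁ g₂)
      N≥1 = ≢0⇒abs≥1 (norm≢0 nz)
      roots₁ : ∀ p → Prime p → p ℕ.∣ s₁ → + p ∥ X - + ρ p * Y
      roots₁ p pp d = subst (+ p ∥_)
          (trans (cong (λ z → X + z * Y - + p * Y) (sym (trans (m-n≡m⊖n p (ρ p)) (⊖-≥ (ρ≤ p)))))
          (lem X (+ p) (+ ρ p) Y))
          (∣m∣n⇒∣m-n (All.lookup (All.map⁻ (All.++⁻ˡ (map (λ p → p , p ℕ.∸ ρ p) (primes s₁)) a))
              (∣⇒∈primes pp (proj₁ g₁) d)) (∣m⇒∣m*n Y ∣-refl))
        where lem : ∀ X p r Y → X + (p - r) * Y - p * Y ≡ X - r * Y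
              lem = solve-∀
      roots₂ : ∀ p → Prime p → p ℕ.∣ s₂ → + p ∥ X + + ρ p * Y
      roots₂ p pp d = All.lookup (All.map⁻ (All.++⁻ʳ (map (λ p → p , p ℕ.∸ ρ p) (primes s₁)) a))
          (∣⇒∈primes pp (proj₁ g₂) d)
      v≤ : ∀ p → Prime p → v p (s₁ ℕ.* s₂) ℕ.≤ v p ∣ norm X Y ∣
      v≤ p pp with p ℕ.∣? s₁ | p ℕ.∣? s₂
      -- A common prime has to divide the norm twice: the two congruences together make it divide
      -- both `X` and `Y`.
      ... | yes d₁ | yes d₂ = ℕ.≤-trans
          (ℕ.≤-trans (ℕ.≤-reflexive (v-* p (proj₁ g₁) (proj₁ g₂)))
          (ℕ.+-mono-≤ (goodNumber-v≤1 {s₁} {p} g₁) (goodNumber-v≤1 {s₂} {p} g₂)))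
          (^∣⇒≤v 2 pp N≥1 (p²∥norm {p} {X} {Y} (proj₁ pXY) (proj₂ pXY)))
        where pXY = both-roots {p} {X} {Y} (goodNumber-∣ g₁ pp d₁) (roots₁ p pp d₁) (roots₂ p pp d₂)
      ... | no n₁ | no n₂ = ℕ.≤-trans
          (ℕ.≤-reflexive (trans (v-* p (proj₁ g₁) (proj₁ g₂)) (cong₂ ℕ._+_ (∤⇒v≡0 {p} {s₁} n₁) (∤⇒v≡0 {p} {s₂} n₂))))
          z≤n
      ... | yes d₁ | no n₂ = ℕ.≤-trans
          (ℕ.≤-trans (ℕ.≤-reflexive (trans (v-* p (proj₁ g₁) (proj₁ g₂)) (cong (v p s₁ ℕ.+_) (∤⇒v≡0 {p} {s₂} n₂))))
          (ℕ.+-monoˡ-≤ 0 (goodNumber-v≤1 {s₁} {p} g₁)))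
          (∣⇒v≥1 pp N≥1 (∣⇒∣ᵤ (p∥norm {p} {X} {Y} (ρ-root (proj₂ (proj₂ (goodNumber-∣ g₁ pp d₁))))
              (inj₁ (roots₁ p pp d₁)))))
      ... | no n₁ | yes d₂ = ℕ.≤-trans
          (ℕ.≤-trans (ℕ.≤-reflexive (trans (v-* p (proj₁ g₁) (proj₁ g₂)) (cong (ℕ._+ v p s₂) (∤⇒v≡0 {p} {s₁} n₁))))
          (goodNumber-v≤1 {s₂} {p} g₂))
          (∣⇒v≥1 pp N≥1 (∣⇒∣ᵤ (p∥norm {p} {X} {Y} (ρ-root (proj₂ (proj₂ (goodNumber-∣ g₂ pp d₂))))
              (inj₂ (roots₂ p pp d₂)))))
      s∣N : s₁ ℕ.* s₂ ℕ.∣ ∣ norm X Y ∣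
      s∣N = v-≤⇒∣ S≥1 N≥1 v≤

  module _ {s₁ s₂ t₁ t₂ : ℕ} {X Y : ℤ} {h : ℕ} (a : Represents s₁ s₂ X Y h) (b : Represents t₁ t₂ X Y h) where
    private
      module A = Represents a
      module B = Represents b

    product-unique : s₁ ℕ.* s₂ ≡ t₁ ℕ.* t₂
    product-unique = ℕ.*-cancelˡ-≡ _ _ h {{≥1⇒≢0 A.h≥1}} (trans (sym A.norm≡) B.norm≡)

    -- If p divided t₂ instead, both roots ± ρ would apply and p² would divide the norm h t₁ t₂, where p > h.
    prime-transfer : ∀ p → Prime p → p ℕ.∣ s₁ → p ℕ.∣ t₁
    prime-transfer p pp d with p ℕ.∣? t₁
    ... | yes e = e
    ... | no ¬e with euclidsLemma t₁ t₂ pp (subst (p ℕ.∣_) product-unique (ℕ.∣m⇒∣m*n s₂ d))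
    ...   | inj₁ e = e
    ...   | inj₂ e = ⊥-elim (ℕ.<⇒≱ {1} {2} (s≤s (s≤s z≤n))
        (ℕ.≤-trans (^∣⇒≤v 2 pp N≥1 (p²∥norm {p} {X} {Y} (proj₁ pXY) (proj₂ pXY)))
              (ℕ.≤-trans (ℕ.≤-reflexive vN) (goodNumber-v≤1 {t₂} {p} B.good₂))))
      where
        good = goodNumber-∣ A.good₁ pp d
        pXY = both-roots {p} {X} {Y} good (A.roots₁ p pp d) (B.roots₂ p pp e)
        N≥1 : 1 ℕ.≤ ∣ norm X Y ∣
        N≥1 = subst (1 ℕ.≤_) (sym B.norm≡) (*-≥1 B.h≥1 (*-≥1 (proj₁ B.good₁) (proj₁ B.good₂)))
        p∤h : ¬ p ℕ.∣ h
        p∤h e = ℕ.<⇒≱ (ℕ.≤-<-trans (ℕ.≤-trans B.h≤ (ℕ.n≤1+n _)) (proj₁ (proj₂ good))) (∣⇒≤′ B.h≥1 e)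
        vN : v p ∣ norm X Y ∣ ≡ v p t₂
        vN = trans (cong (v p) B.norm≡) (trans (v-* p B.h≥1 (*-≥1 (proj₁ B.good₁) (proj₁ B.good₂)))
          (trans (cong₂ ℕ._+_ (∤⇒v≡0 {p} {h} p∤h) (v-* p (proj₁ B.good₁) (proj₁ B.good₂)))
              (cong (ℕ._+ v p t₂) (∤⇒v≡0 {p} {t₁} ¬e))))

    first-∣ : s₁ ℕ.∣ t₁
    first-∣ = v-≤⇒∣ (proj₁ A.good₁) (proj₁ B.good₁) λ p pp → le p pp
      where
        le : ∀ p → Prime p → v p s₁ ℕ.≤ v p t₁
        le p pp with p ℕ.∣? s₁
        ... | no n  = ℕ.≤-trans (ℕ.≤-reflexive (∤⇒v≡0 {p} {s₁} n)) z≤n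
        ... | yes d = ℕ.≤-trans (goodNumber-v≤1 {s₁} {p} A.good₁) (∣⇒v≥1 pp (proj₁ B.good₁) (prime-transfer p pp d))

  -- By `prime-transfer` in both directions the squarefree numbers `s₁` and `t₁` have the same
  -- primes, hence are equal; the second components follow from the common product.
  representation-injective : ∀ {s₁ s₂ t₁ t₂ X Y h} → Represents s₁ s₂ X Y h → Represents t₁ t₂ X Y h → (s₁ , s₂) ≡
      (t₁ , t₂)
  representation-injective {s₁} {s₂} {t₁} {t₂} a b with ℕ.∣-antisym (first-∣ a b) (first-∣ b a)
  ... | refl = cong (s₁ ,_) (ℕ.*-cancelˡ-≡ s₂ t₂ s₁ {{≥1⇒≢0 (proj₁ (Represents.good₁ a))}} (product-unique a b))

  -- 9 bounds (2R + 1)² / R² for R ≥ 1, and 2 + |D| is the size of the range enumerated for `h`,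
  -- with 0 included.
  K₀ : ℕ
  K₀ = 9 ℕ.* (2 ℕ.+ ∣ D ∣)

  private
    isqrt-mono : ∀ {r R Z} → r ℕ.* r ℕ.≤ Z → Z ℕ.< suc R ℕ.* suc R → r ℕ.≤ R
    isqrt-mono {r} {R} h hi with r ℕ.≤? R
    ... | yes q = q
    ... | no ¬q = ⊥-elim (ℕ.<⇒≱ hi (ℕ.≤-trans (ℕ.*-mono-≤ (ℕ.≰⇒> ¬q) (ℕ.≰⇒> ¬q)) h))

    Rep : ℕ → ℕ × ℕ → ℕ × ℕ × ℕ → Set
    Rep R (s₁ , s₂) (a , b , h) = Represents s₁ s₂ (+ a - + R) (+ b - + R) h

  bounded-representation : ∀ {s₁ s₂ R Z} → Z ℕ.< suc R ℕ.* suc R → GoodNumber s₁ → GoodNumber s₂ → s₁ ℕ.* s₂ ℕ.≤ Z →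
    ∃₂ λ a b → ∃ λ h → (a ℕ.< suc (R ℕ.+ R) × b ℕ.< suc (R ℕ.+ R) × h ℕ.< 2 ℕ.+ ∣ D ∣) × Rep R (s₁ , s₂) (a , b , h)
  bounded-representation {s₁} {s₂} {R} {Z} hi g₁ g₂ le = go (isqrt (s₁ ℕ.* s₂))
    where
      Goal = ∃₂ λ a b → ∃ λ h → (a ℕ.< suc (R ℕ.+ R) × b ℕ.< suc (R ℕ.+ R) × h ℕ.< 2 ℕ.+ ∣ D ∣) × Rep R (s₁ , s₂)
          (a , b , h)
      go₂ : ∀ {X Y h} → Represents s₁ s₂ X Y h → (∃ λ a → a ℕ.< suc (R ℕ.+ R) × + a - + R ≡ X) →
          (∃ λ b → b ℕ.< suc (R ℕ.+ R) × + b - + R ≡ Y) → Goal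
      go₂ {h = h} rep (a , a< , refl) (b , b< , refl) = a , b , h , (a< , b< , s≤s (Represents.h≤ rep)) , rep
      go₁ : ∀ {r} → r ℕ.≤ R → (∃₂ λ X Y → ∃ λ h → ∣ X ∣ ℕ.≤ r × ∣ Y ∣ ℕ.≤ r × Represents s₁ s₂ X Y h) → Goal
      go₁ r≤R (X , Y , h , hX , hY , rep) = go₂ rep (recentre {R} X (ℕ.≤-trans hX r≤R))
          (recentre {R} Y (ℕ.≤-trans hY r≤R))
      go : (∃ λ r → r ℕ.* r ℕ.≤ s₁ ℕ.* s₂ × s₁ ℕ.* s₂ ℕ.< suc r ℕ.* suc r) → Goal
      go (r , lo′ , hi′) = go₁ (isqrt-mono {r} {R} {Z} (ℕ.≤-trans lo′ le) hi) (exists-representation g₁ g₂ lo′ hi′)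

  private
    box-≤ : ∀ R Z k → 1 ℕ.≤ R → R ℕ.* R ℕ.≤ Z → suc (R ℕ.+ R) ℕ.* (suc (R ℕ.+ R) ℕ.* k) ℕ.≤ 9 ℕ.* k ℕ.* Z
    box-≤ R Z k R≥1 lo = begin
      suc (R ℕ.+ R) ℕ.* (suc (R ℕ.+ R) ℕ.* k) ≤⟨ ℕ.*-mono-≤ three (ℕ.*-monoˡ-≤ k three) ⟩
      (R ℕ.+ (R ℕ.+ R)) ℕ.* ((R ℕ.+ (R ℕ.+ R)) ℕ.* k) ≡⟨ lem R k ⟩
      9 ℕ.* k ℕ.* (R ℕ.* R) ≤⟨ ℕ.*-monoʳ-≤ (9 ℕ.* k) lo ⟩
      9 ℕ.* k ℕ.* Z ∎
      where
        open ℕ.≤-Reasoning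
        three : suc (R ℕ.+ R) ℕ.≤ R ℕ.+ (R ℕ.+ R)
        three = ℕ.+-monoˡ-≤ (R ℕ.+ R) R≥1
        lem : ∀ R k → (R ℕ.+ (R ℕ.+ R)) ℕ.* ((R ℕ.+ (R ℕ.+ R)) ℕ.* k) ≡ 9 ℕ.* k ℕ.* (R ℕ.* R)
        lem = solve-∀ₙ

    boxes : ∀ n k → length (cartesianProduct (upTo n) (cartesianProduct (upTo n) (upTo k))) ≡ n ℕ.* (n ℕ.* k)
    boxes n k = trans (length-cartesianProduct (upTo n) (cartesianProduct (upTo n) (upTo k)))
      (cong₂ ℕ._*_ (length-upTo n) (trans (length-cartesianProduct (upTo n) (upTo k))
          (cong₂ ℕ._*_ (length-upTo n) (length-upTo k))))

  -- Pairs map injectively to triples in a box of volume O(Z). The gain is a logarithm: pairs of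
  -- arbitrary natural numbers with product at most Z number about Z log Z, which a positive density
  -- of good numbers would reproduce.
  pair-count : ∀ {Z} → 1 ℕ.≤ Z → ∀ {xs} → Unique xs → All
      (λ s → GoodNumber (proj₁ s) × GoodNumber (proj₂ s) × proj₁ s ℕ.* proj₂ s ℕ.≤ Z) xs
    → length xs ℕ.≤ K₀ ℕ.* Z
  pair-count {Z} hZ {xs} u a = go (isqrt Z)
    where
      go : (∃ λ R → R ℕ.* R ℕ.≤ Z × Z ℕ.< suc R ℕ.* suc R) → length xs ℕ.≤ K₀ ℕ.* Z
      go (R , lo , hi) = ℕ.≤-trans (length-≤ (Rep R) u witness representation-injective)
          (ℕ.≤-trans (ℕ.≤-reflexive (boxes (suc (R ℕ.+ R)) (2 ℕ.+ ∣ D ∣)))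
              (box-≤ R Z (2 ℕ.+ ∣ D ∣) (isqrt-mono {1} {R} {Z} hZ hi) lo))
        where
          witness : ∀ {s} → s ∈ xs → ∃ λ y → y ∈ cartesianProduct (upTo (suc (R ℕ.+ R)))
              (cartesianProduct (upTo (suc (R ℕ.+ R))) (upTo (2 ℕ.+ ∣ D ∣))) × Rep R s y
          witness s∈ = found (bounded-representation {R = R} hi (proj₁ (All.lookup a s∈))
              (proj₁ (proj₂ (All.lookup a s∈))) (proj₂ (proj₂ (All.lookup a s∈))))
            where
              found : ∀ {s} → (∃₂ λ a b → ∃ λ h → (a ℕ.< suc (R ℕ.+ R) × b ℕ.< suc (R ℕ.+ R) × h ℕ.< 2 ℕ.+ ∣ D ∣) ×
                  Rep R s (a , b , h))
                → ∃ λ y → y ∈ cartesianProduct (upTo (suc (R ℕ.+ R)))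
                    (cartesianProduct (upTo (suc (R ℕ.+ R))) (upTo (2 ℕ.+ ∣ D ∣))) × Rep R s y
              found (a , b , h , (a< , b< , h<) , rep) = (a , b , h) , ∈-cartesianProduct⁺ (∈-upTo⁺ a<)
                  (∈-cartesianProduct⁺ (∈-upTo⁺ b<) (∈-upTo⁺ h<)) , rep

-- The part of `L !` outside the good primes outgrows every exponential in `L`.

module BadPart (D : ℤ) (nsq : ∀ e → e ℤ.* e ≢ D) where

  open Range
  open Factor
  open Multiples
  open Chebyshev using (!≥1; ^-cancelʳ-≤)
  open ListCount
  open GoodPairs D nsq using (Good; good?; GoodNumber; goodNumber?; K₀; pair-count)
  open import Data.Nat
  open import Data.Nat.Properties
  open import Data.Nat.DivMod using (_/_; _%_; m≡m%n+[m/n]*n; m%n<n; m≥n⇒m/n>0)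
  open import Data.Nat.Divisibility
  open import Data.Nat.Primality.Factorisation using (factorisationHasAllPrimeFactors)
  open import Data.Nat.Combinatorics using (k![n∸k]!∣n!)
  open import Data.Nat.Tactic.RingSolver using (solve-∀)
  open import Data.List using (_++_; upTo; downFrom; filter; cartesianProduct; length)
  open import Data.List.Properties using (length-upTo; length-++)
  import Data.List.Relation.Unary.All.Properties as All
  open import Data.List.Relation.Unary.AllPairs using ([])
  open import Data.List.Relation.Unary.Unique.Propositional using (Unique)
  import Data.List.Relation.Unary.Unique.Propositional.Properties as Unique
  open import Data.List.Membership.Propositional.Properties using
      (∈-cartesianProduct⁺; ∈-cartesianProduct⁻; ∈-upTo⁺; ∈-filter⁺; ∈-filter⁻; ∈-downFrom⁺; ∈-downFrom⁻)
  open import Relation.Nullary.Decidable using (_×-dec_)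
  open import Relation.Unary using (∁)
  open import Relation.Unary.Properties using (∁?)

  σ : ℕ → ℕ
  σ Y = count goodNumber? (suc Y)

  interval? : ∀ lo s → Dec (1 ≤ s × s ≤ lo)
  interval? lo s = (1 ≤? s) ×-dec (s ≤? lo)

  count-interval-suc : ∀ lo n → count (interval? lo) (suc n) ≤ n
  count-interval-suc lo zero    = ≤-reflexive (ind-no (interval? lo 0) (λ ()))
  count-interval-suc lo (suc n) = ≤-trans (+-mono-≤ (count-interval-suc lo n) (ind≤1 (interval? lo (suc n))))
      (≤-reflexive (+-comm n 1))

  count-interval : ∀ lo n → count (interval? lo) n ≤ lo
  count-interval lo zero    = z≤n
  count-interval lo (suc n) = go (n ≤? lo)
    where
      go : Dec (n ≤ lo) → count (interval? lo) (suc n) ≤ lo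
      go (yes h) = ≤-trans (count-interval-suc lo n) h
      go (no ¬h) = ≤-trans (≤-reflexive
          (trans (cong (count (interval? lo) n +_) (ind-no (interval? lo n) (λ x → ¬h (proj₂ x)))) (+-identityʳ _)))
                     (count-interval lo n)

  above? : ∀ lo s → Dec (GoodNumber s × lo < s)
  above? lo s = goodNumber? s ×-dec (lo <? s)

  above : ℕ → ℕ → List ℕ
  above lo hi = filter (above? lo) (downFrom (suc hi))

  above-∈ : ∀ {lo hi s} → s ∈ above lo hi → GoodNumber s × lo < s × s ≤ hi
  above-∈ {lo} {hi} s∈ = proj₁ (proj₂ m) , proj₂ (proj₂ m) , s≤s⁻¹ (∈-downFrom⁻ (proj₁ m))
    where m = ∈-filter⁻ (above? lo) {xs = downFrom (suc hi)} s∈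

  σ≤ : ∀ lo hi → σ hi ≤ lo + length (above lo hi)
  σ≤ lo hi = ≤-trans (count-⊎ goodNumber? (interval? lo) (above? lo) (suc hi) split)
    (+-mono-≤ (count-interval lo (suc hi)) (≤-reflexive (sym (length-filter-downFrom (above? lo) (suc hi)))))
    where
      split : ∀ i → i < suc hi → GoodNumber i → (1 ≤ i × i ≤ lo) ⊎ (GoodNumber i × lo < i)
      split i _ g with i ≤? lo
      ... | yes h = inj₁ (proj₁ g , h)
      ... | no ¬h = inj₂ (g , ≰⇒> ¬h)

  -- Each of the J blocks of pairs with product at most X₀ has size at least X₀ / (A B): too many for pair-count.
  module Blocks (B : ℕ) (hB : 1 ≤ B) where

    A J X₀ : ℕ
    A = 2 * B
    J = suc (B * (K₀ * A))
    X₀ = A ^ J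

    A≥1 : 1 ≤ A
    A≥1 = *-≥1 {2} (s≤s z≤n) hB

    module _ (dense : ∀ Y → 1 ≤ Y → Y ≤ X₀ → Y ≤ B * σ Y) where

      -- First components lie in (Aʲ , Aʲ⁺¹], which makes the blocks disjoint; the range of the
      -- second components keeps all products at most `X₀`.
      block : ℕ → List (ℕ × ℕ)
      block j = cartesianProduct (above (A ^ j) (A ^ suc j)) (above 0 (A ^ (J ∸ suc j)))

      pairs : ℕ → List (ℕ × ℕ)
      pairs zero    = []
      pairs (suc j) = pairs j ++ block j

      A^≥1 : ∀ j → 1 ≤ A ^ j
      A^≥1 j = ^-≥1 j A≥1

      A^-mono : ∀ {i j} → i ≤ j → A ^ i ≤ A ^ j
      A^-mono h = ^-monoʳ-≤ A {{≥1⇒≢0 A≥1}} h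

      denseA : ∀ j → j ≤ J → A ^ j ≤ B * σ (A ^ j)
      denseA j h = dense (A ^ j) (A^≥1 j) (A^-mono h)

      -- Density gives at least Aʲ⁺¹ / B = 2 Aʲ good numbers up to Aʲ⁺¹, and at most Aʲ of them are
      -- not above Aʲ. This is why `A` is `2 * B`.
      above₁ : ∀ j → suc j ≤ J → A ^ j ≤ length (above (A ^ j) (A ^ suc j))
      above₁ j h = *-cancelˡ-≤ B {{≥1⇒≢0 hB}} (+-cancelˡ-≤ (B * A ^ j) _ _ (begin
        B * A ^ j + B * A ^ j                                       ≡⟨ lem B (A ^ j) ⟩
        A ^ suc j                                                   ≤⟨ denseA (suc j) h ⟩
        B * σ (A ^ suc j)                                           ≤⟨ *-monoʳ-≤ B (σ≤ (A ^ j) (A ^ suc j)) ⟩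
        B * (A ^ j + length (above (A ^ j) (A ^ suc j)))            ≡⟨ *-distribˡ-+ B (A ^ j) _ ⟩
        B * A ^ j + B * length (above (A ^ j) (A ^ suc j))          ∎))
        where
          open ≤-Reasoning
          lem : ∀ b x → b * x + b * x ≡ (2 * b) * x
          lem = solve-∀

      above₂ : ∀ j → j ≤ J → A ^ j ≤ B * length (above 0 (A ^ j))
      above₂ j h = ≤-trans (denseA j h) (*-monoʳ-≤ B (σ≤ 0 (A ^ j)))

      exponents : ∀ j → suc j ≤ J → A ^ j * A ^ (J ∸ suc j) ≡ A ^ (B * (K₀ * A))
      exponents j h = trans (sym (^-distribˡ-+-* A j (J ∸ suc j))) (cong (A ^_) (suc-injective (m+[n∸m]≡n h)))

      block-length : ∀ j → suc j ≤ J → A ^ (B * (K₀ * A)) ≤ B * length (block j)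
      block-length j h = begin
        A ^ (B * (K₀ * A))                ≡⟨ exponents j h ⟨
        A ^ j * A ^ (J ∸ suc j)           ≤⟨ *-mono-≤ (above₁ j h) (above₂ (J ∸ suc j) (m∸n≤m J (suc j))) ⟩
        a * (B * b)                       ≡⟨ lem a B b ⟩
        B * (a * b)                       ≡⟨ cong (B *_)
            (length-cartesianProduct (above (A ^ j) (A ^ suc j)) (above 0 (A ^ (J ∸ suc j)))) ⟨
        B * length (block j)              ∎
        where
          open ≤-Reasoning
          a = length (above (A ^ j) (A ^ suc j))
          b = length (above 0 (A ^ (J ∸ suc j)))
          lem : ∀ a B b → a * (B * b) ≡ B * (a * b)
          lem = solve-∀

      pairs-length : ∀ j → j ≤ J → j * A ^ (B * (K₀ * A)) ≤ B * length (pairs j)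
      pairs-length zero    h = z≤n
      pairs-length (suc j) h = begin
        A ^ (B * (K₀ * A)) + j * A ^ (B * (K₀ * A)) ≤⟨ +-mono-≤ (block-length j h)
            (pairs-length j (≤-trans (n≤1+n j) h)) ⟩
        B * length (block j) + B * length (pairs j) ≡⟨ lem B (length (block j)) (length (pairs j)) ⟩
        B * (length (pairs j) + length (block j))   ≡⟨ cong (B *_) (length-++ (pairs j)) ⟨
        B * length (pairs (suc j))                  ∎
        where
          open ≤-Reasoning
          lem : ∀ B x y → B * x + B * y ≡ B * (y + x)
          lem = solve-∀

      P : ℕ → ℕ × ℕ → Set
      P j s = (GoodNumber (proj₁ s) × GoodNumber (proj₂ s) × proj₁ s * proj₂ s ≤ X₀) × proj₁ s ≤ A ^ j

      block-∈ : ∀ j → suc j ≤ J → ∀ {s} → s ∈ block j → P (suc j) s × A ^ j < proj₁ s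
      block-∈ j h {s₁ , s₂} s∈ = ((g₁ , g₂ , ≤-trans (*-mono-≤ hi₁ hi₂)
          (≤-reflexive (trans (*-assoc A (A ^ j) _) (cong (A *_) (exponents j h))))) , hi₁) , lo₁
        where
          m = ∈-cartesianProduct⁻ (above (A ^ j) (A ^ suc j)) (above 0 (A ^ (J ∸ suc j))) s∈
          g₁ = proj₁ (above-∈ {A ^ j} {A ^ suc j} (proj₁ m))
          lo₁ = proj₁ (proj₂ (above-∈ {A ^ j} {A ^ suc j} (proj₁ m)))
          hi₁ = proj₂ (proj₂ (above-∈ {A ^ j} {A ^ suc j} (proj₁ m)))
          g₂ = proj₁ (above-∈ {0} {A ^ (J ∸ suc j)} (proj₂ m))
          hi₂ = proj₂ (proj₂ (above-∈ {0} {A ^ (J ∸ suc j)} (proj₂ m)))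

      pairs-All : ∀ j → j ≤ J → All (P j) (pairs j)
      pairs-All zero    h = []
      pairs-All (suc j) h = All.++⁺
        (All.map (λ (g , le) → g , ≤-trans le (A^-mono (n≤1+n j))) (pairs-All j (≤-trans (n≤1+n j) h)))
        (All.tabulate (λ s∈ → proj₁ (block-∈ j h s∈)))

      pairs-unique : ∀ j → j ≤ J → Unique (pairs j)
      pairs-unique zero    h = []
      pairs-unique (suc j) h = Unique.++⁺ (pairs-unique j h′)
        (Unique.cartesianProduct⁺ (Unique.filter⁺ (above? (A ^ j)) (Unique.downFrom⁺ (suc (A ^ suc j))))
            (Unique.filter⁺ (above? 0) (Unique.downFrom⁺ (suc (A ^ (J ∸ suc j))))))
        (λ (s∈ , s∈′) → <⇒≱ (proj₂ (block-∈ j h s∈′)) (proj₂ (All.lookup (pairs-All j h′) s∈)))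
        where h′ = ≤-trans (n≤1+n j) h

      -- There are at least J X₀ / (A B) pairs, against the K₀ X₀ that `pair-count` allows; `J`
      -- exceeds B K₀ A by one.
      not-dense : ⊥
      not-dense = <-irrefl refl (*-cancelʳ-≤ J (B * (K₀ * A)) (A ^ (B * (K₀ * A))) {{≥1⇒≢0 (A^≥1 (B * (K₀ * A)))}}
          (begin
        J * A ^ (B * (K₀ * A))            ≤⟨ pairs-length J ≤-refl ⟩
        B * length (pairs J)              ≤⟨ *-monoʳ-≤ B
            (pair-count (A^≥1 J) (pairs-unique J ≤-refl) (All.map proj₁ (pairs-All J ≤-refl))) ⟩
        B * (K₀ * A ^ J)                  ≡⟨ lem B K₀ A (A ^ (B * (K₀ * A))) ⟩
        B * (K₀ * A) * A ^ (B * (K₀ * A)) ∎))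
        where
          open ≤-Reasoning
          lem : ∀ B K A x → B * (K * (A * x)) ≡ B * (K * A) * x
          lem = solve-∀

  bad? : Decidable (∁ Good)
  bad? = ∁? good?

  badPart : ℕ → ℕ
  badPart = part bad?

  !^∣! : ∀ m Y → (Y !) ^ m ∣ (m * Y) !
  !^∣! zero    Y = 1∣ _
  !^∣! (suc m) Y = ∣-trans (*-monoʳ-∣ (Y !) (!^∣! m Y))
    (subst (λ z → Y ! * z ! ∣ (Y + m * Y) !) (m+n∸m≡n Y (m * Y)) (k![n∸k]!∣n! (m≤m+n Y (m * Y))))

  ^-cancelˡ-≤ : ∀ m {a b} → 1 ≤ m → a ^ m ≤ b ^ m → a ≤ b
  ^-cancelˡ-≤ m {a} {b} hm h with a ≤? b
  ... | yes q = q
  ... | no ¬q = ⊥-elim (<⇒≱ (^-monoˡ-< m {{≥1⇒≢0 hm}} (≰⇒> ¬q)) h)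

  -- A bound at one large `L` passes to every `Y ≤ L`, because the `m`-th power of `Y !` divides
  -- `L !` for m = L / Y. The factor 2 in the exponent pays for the rounding, L ≤ 2 m Y.
  badPart-!-≤ : ∀ {C L Y} → badPart (L !) ≤ 2 ^ (C * L) → 1 ≤ Y → Y ≤ L → badPart (Y !) ≤ 2 ^ (2 * C * Y)
  badPart-!-≤ {C} {L} {Y@(suc _)} h hY Y≤L = ^-cancelˡ-≤ m m≥1 (begin
    badPart (Y !) ^ m      ≡⟨ part-^ bad? m (!≥1 Y) ⟨
    badPart ((Y !) ^ m)    ≤⟨ ∣⇒≤′ (part≥1 bad? (L !)) (part-∣ bad? (!≥1 L) (∣-trans (!^∣! m Y) (m≤n⇒m!∣n! mY≤L))) ⟩
    badPart (L !)          ≤⟨ h ⟩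
    2 ^ (C * L)            ≤⟨ ^-monoʳ-≤ 2 (*-monoʳ-≤ C L≤) ⟩
    2 ^ (C * (2 * (m * Y))) ≡⟨ cong (2 ^_) (lem C m Y) ⟩
    2 ^ (2 * C * Y * m)    ≡⟨ ^-*-assoc 2 (2 * C * Y) m ⟨
    (2 ^ (2 * C * Y)) ^ m  ∎)
    where
      open ≤-Reasoning
      m = L / Y
      m≥1 : 1 ≤ m
      m≥1 = m≥n⇒m/n>0 Y≤L
      mY≤L : m * Y ≤ L
      mY≤L = ≤-trans (m≤n+m (m * Y) (L % Y)) (≤-reflexive (sym (m≡m%n+[m/n]*n L Y)))
      L≤ : L ≤ 2 * (m * Y)
      L≤ = ≤-trans (≤-reflexive (m≡m%n+[m/n]*n L Y)) (≤-trans
        (+-monoˡ-≤ (m * Y) (≤-trans (<⇒≤ (m%n<n L Y))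
            (≤-trans (≤-reflexive (sym (*-identityˡ Y))) (*-monoˡ-≤ Y m≥1))))
        (≤-reflexive (cong (m * Y +_) (sym (+-identityʳ (m * Y))))))
      lem : ∀ C m Y → C * (2 * (m * Y)) ≡ 2 * C * Y * m
      lem = solve-∀

  large? : ∀ B i → Dec (B < badPart (suc i))
  large? B i = B <? badPart (suc i)

  -- Markov's inequality in multiplicative form: the bad parts of 1, ..., Y multiply to that of
  -- `Y !`, and each large one contributes a factor above `B`.
  markov : ∀ B Y → B ^ count (large? B) Y ≤ badPart (Y !)
  markov B Y = begin
    B ^ count (large? B) Y                    ≡⟨ prodTo-choose (large? B) Y B ⟨
    prodTo Y (λ i → choose (large? B i) B)    ≤⟨ prodTo-mono Y (λ i _ → term i) ⟩
    prodTo Y (λ i → badPart (suc i))          ≡⟨ part-prodTo-* bad? Y suc (λ i _ → s≤s z≤n) ⟨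
    badPart (prodTo Y suc)                    ≡⟨ cong badPart (!≡prodTo Y) ⟨
    badPart (Y !)                             ∎
    where
      open ≤-Reasoning
      term : ∀ i → choose (large? B i) B ≤ badPart (suc i)
      term i with large? B i
      ... | yes h = <⇒≤ h
      ... | no _  = part≥1 bad? (suc i)

  squareful? : ∀ i → Dec (∃ λ e → e < i × (2 + e) * (2 + e) ∣ suc i)
  squareful? i = anyUpTo? (λ e → (2 + e) * (2 + e) ∣? suc i) i

  private
    squares : ℕ → ℕ → ℕ
    squares Y e = count (λ i → (2 + e) * (2 + e) ∣? suc i) Y

  -- From 1/3² + … + 1/(E+2)² ≤ 1/(2·3) + … + 1/((E+1)(E+2)) = 1/2 - 1/(E+2).
  squares-sum : ∀ Y E → 2 * (2 + E) * sumTo E (λ e → squares Y (suc e)) ≤ E * Y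
  squares-sum Y zero    = z≤n
  squares-sum Y (suc E) = *-cancelˡ-≤ (2 + E) (begin
    (2 + E) * (2 * (3 + E) * (T + c))               ≡⟨ l₁ E T c ⟩
    (3 + E) * (2 * (2 + E) * T) + 2 * ((2 + E) * (3 + E) * c) ≤⟨ +-mono-≤ (*-monoʳ-≤ (3 + E) (squares-sum Y E))
                                                       (*-monoʳ-≤ 2 (≤-trans (*-monoˡ-≤ c
                                                           (*-monoˡ-≤ (3 + E) (n≤1+n (2 + E))))
                                                           (count-multiples ((3 + E) * (3 + E)) Y))) ⟩
    (3 + E) * (E * Y) + 2 * Y                       ≡⟨ l₂ E Y ⟩
    (2 + E) * (suc E * Y) ∎)
    where
      open ≤-Reasoning
      T = sumTo E (λ e → squares Y (suc e))
      c = squares Y (suc E)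
      l₁ : ∀ E T c → (2 + E) * (2 * (3 + E) * (T + c)) ≡ (3 + E) * (2 * (2 + E) * T) + 2 * ((2 + E) * (3 + E) * c)
      l₁ = solve-∀
      l₂ : ∀ E Y → (3 + E) * (E * Y) + 2 * Y ≡ (2 + E) * (suc E * Y)
      l₂ = solve-∀

  -- Multiples of 4 account for at most a quarter and multiples of larger squares for at most a
  -- half, so at least a quarter of the integers up to `Y` is squarefree.
  squareful-count : ∀ Y → 4 * count squareful? Y ≤ 3 * Y
  squareful-count Y = begin
    4 * count squareful? Y                                        ≤⟨ *-monoʳ-≤ 4 union ⟩
    4 * sumTo (suc Y) (squares Y)                                 ≡⟨ cong (4 *_) (sumTo-split 1 Y (squares Y)) ⟩
    4 * (squares Y 0 + T)                                         ≡⟨ l (squares Y 0) T ⟩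
    4 * squares Y 0 + 2 * (2 * T)                                 ≤⟨ +-mono-≤ (count-multiples 4 Y) (*-monoʳ-≤ 2 2T≤)
        ⟩
    Y + 2 * Y                                                     ∎
    where
      open ≤-Reasoning
      T = sumTo Y (λ e → squares Y (suc e))
      l : ∀ a t → 4 * (a + t) ≡ 4 * a + 2 * (2 * t)
      l = solve-∀
      2T≤ : 2 * T ≤ Y
      2T≤ = *-cancelˡ-≤ (2 + Y) (≤-trans (≤-reflexive (l′ Y T))
          (≤-trans (squares-sum Y Y) (*-monoˡ-≤ Y (≤-trans (n≤1+n Y) (n≤1+n (suc Y))))))
        where l′ : ∀ Y T → (2 + Y) * (2 * T) ≡ 2 * (2 + Y) * T
              l′ = solve-∀
      term : ∀ i → i < Y → ind (squareful? i) ≤ sumTo (suc Y) (λ e → ind ((2 + e) * (2 + e) ∣? suc i))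
      term i i<Y = go (squareful? i)
        where
          go : (q : Dec (∃ λ e → e < i × (2 + e) * (2 + e) ∣ suc i)) → ind q ≤ sumTo (suc Y)
              (λ e → ind ((2 + e) * (2 + e) ∣? suc i))
          go (no _) = z≤n
          go (yes (e , e<i , d)) = ≤-trans (≤-reflexive (sym (ind-yes ((2 + e) * (2 + e) ∣? suc i) d)))
            (sumTo-≥-term (suc Y) _ e (<-trans e<i (<-trans i<Y (n<1+n Y))))
      union : count squareful? Y ≤ sumTo (suc Y) (squares Y)
      union = ≤-trans (sumTo-mono Y term) (≤-reflexive (sumTo-swap Y (suc Y) _))

  SmallBad : ℕ → ℕ → Set
  SmallBad B i = badPart (suc i) ≤ B × ¬ (∃ λ e → e < i × (2 + e) * (2 + e) ∣ suc i)

  smallBad? : ∀ B → Decidable (SmallBad B)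
  smallBad? B i = (badPart (suc i) ≤? B) ×-dec ¬? (squareful? i)

  squarefree⇒v≤1 : ∀ {i} p → ¬ (∃ λ e → e < i × (2 + e) * (2 + e) ∣ suc i) → v p (suc i) ≤ 1
  squarefree⇒v≤1 {i} p h with 2 ≤? v p (suc i)
  ... | no ¬q = s≤s⁻¹ (≰⇒> ¬q)
  ... | yes q = ⊥-elim (go p (prime≥2 (v≥1⇒Prime {p} {suc i} (≤-trans (s≤s z≤n) q)))
      (subst (_∣ suc i) (cong (p *_) (*-identityʳ p)) (≤v⇒^∣ {p} {suc i} 2 (s≤s z≤n) q)))
    where
      go : ∀ p → 2 ≤ p → p * p ∣ suc i → ⊥
      go (suc zero) (s≤s ()) d
      go (suc (suc e)) _ d = h (e , s≤s⁻¹ (≤-trans le (∣⇒≤ d)) , d)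
        where
          le : suc (suc e) ≤ (2 + e) * (2 + e)
          le = m≤m*n (2 + e) (2 + e)

  good-part : ∀ {B i} → SmallBad B i → GoodNumber (part good? (suc i))
  good-part {B} {i} (_ , sf) = part≥1 good? (suc i) , All.tabulate λ {p} p∈ →
      isGood p (All.lookup (primes-Prime (part good? (suc i))) p∈) (∈primes⇒∣ {p} {part good? (suc i)} p∈)
    , ≤-trans (v-∣-mono p (s≤s z≤n)
        (divides (badPart (suc i)) (trans (sym (part-compl good? {suc i} (s≤s z≤n)))
        (*-comm (part good? (suc i)) _)))) (squarefree⇒v≤1 p sf)
    where
      isGood : ∀ p → Prime p → p ∣ part good? (suc i) → Good p
      isGood p pp d = proj₂ (∈-filter⁻ good? {xs = primes (suc i)} (factorisationHasAllPrimeFactors pp d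
        (All.tabulate λ x∈ → All.lookup (primes-Prime (suc i)) (proj₁ (∈-filter⁻ good? {xs = primes (suc i)} x∈)))))

  -- `suc i` is the product of its good and its bad part, hence determined by a good number up to
  -- `Y` and a bad part up to `B`.
  smallBad-count : ∀ B Y → count (smallBad? B) Y ≤ suc B * σ Y
  smallBad-count B Y = begin
    count (smallBad? B) Y                        ≡⟨ length-filter-downFrom (smallBad? B) Y ⟨
    length xs                                    ≤⟨ length-≤ Rel (Unique.filter⁺ (smallBad? B) (Unique.downFrom⁺ Y))
        witness (λ {x} {x′} {y} → inj {x} {x′} {y}) ⟩
    length (cartesianProduct (upTo (suc B)) gs)  ≡⟨ length-cartesianProduct (upTo (suc B)) gs ⟩
    length (upTo (suc B)) * length gs            ≡⟨ cong₂ _*_ (length-upTo (suc B))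
        (length-filter-downFrom goodNumber? (suc Y)) ⟩
    suc B * σ Y                                  ∎
    where
      open ≤-Reasoning
      xs = filter (smallBad? B) (downFrom Y)
      gs = filter goodNumber? (downFrom (suc Y))
      Rel : ℕ → ℕ × ℕ → Set
      Rel i (b , s) = suc i ≡ s * b
      inj : ∀ {x x′ y} → Rel x y → Rel x′ y → x ≡ x′
      inj e e′ = suc-injective (trans e (sym e′))
      witness : ∀ {i} → i ∈ xs → ∃ λ y → y ∈ cartesianProduct (upTo (suc B)) gs × Rel i y
      witness {i} i∈ = (badPart (suc i) , part good? (suc i))
          , ∈-cartesianProduct⁺ (∈-upTo⁺ (s≤s (proj₁ sb))) (∈-filter⁺ goodNumber? (∈-downFrom⁺ s<) (good-part sb))
          , sym (part-compl good? {suc i} (s≤s z≤n))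
        where
          m = ∈-filter⁻ (smallBad? B) {xs = downFrom Y} i∈
          sb : SmallBad B i
          sb = proj₂ m
          s< : part good? (suc i) < suc Y
          s< = s≤s (≤-trans (∣⇒≤ (divides (badPart (suc i))
              (trans (sym (part-compl good? {suc i} (s≤s z≤n))) (*-comm (part good? (suc i)) _))))
              (∈-downFrom⁻ (proj₁ m)))

  -- At most 3/4 of the integers up to Y are squareful and at most 1/8 have bad part above `B`: with
  -- B = 2^(16 C), Markov's inequality for their number b reads 16 C b ≤ 2 C Y. The remaining eighth
  -- is counted by `smallBad-count`.
  good-dense : ∀ {C Y} → 1 ≤ C → badPart (Y !) ≤ 2 ^ (2 * C * Y) → Y ≤ 8 * suc (2 ^ (16 * C)) * σ Y
  good-dense {C} {Y} hC h = +-cancelˡ-≤ (7 * Y) _ _ (begin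
    7 * Y + Y                       ≡⟨ l₁ Y ⟩
    8 * Y                           ≤⟨ *-monoʳ-≤ 8 total ⟩
    8 * (a + (b + c))               ≡⟨ l₂ a b c ⟩
    2 * (4 * a) + 8 * b + 8 * c     ≤⟨ +-mono-≤ (+-mono-≤ (*-monoʳ-≤ 2 (squareful-count Y)) 8b≤)
        (*-monoʳ-≤ 8 (smallBad-count B Y)) ⟩
    2 * (3 * Y) + Y + 8 * (suc B * σ Y) ≡⟨ l₃ Y (suc B) (σ Y) ⟩
    7 * Y + 8 * suc B * σ Y         ∎)
    where
      open ≤-Reasoning
      B = 2 ^ (16 * C)
      a = count squareful? Y
      b = count (large? B) Y
      c = count (smallBad? B) Y
      l₁ : ∀ Y → 7 * Y + Y ≡ 8 * Y
      l₁ = solve-∀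
      l₂ : ∀ a b c → 8 * (a + (b + c)) ≡ 2 * (4 * a) + 8 * b + 8 * c
      l₂ = solve-∀
      l₃ : ∀ Y B s → 2 * (3 * Y) + Y + 8 * (B * s) ≡ 7 * Y + 8 * B * s
      l₃ = solve-∀
      8b≤ : 8 * b ≤ Y
      8b≤ = *-cancelˡ-≤ (2 * C) {{≥1⇒≢0 (*-≥1 {2} (s≤s z≤n) hC)}} (^-cancelʳ-≤ 2 ≤-refl (begin
        2 ^ (2 * C * (8 * b))  ≡⟨ cong (2 ^_) (l C b) ⟩
        2 ^ (16 * C * b)       ≡⟨ ^-*-assoc 2 (16 * C) b ⟨
        B ^ b                  ≤⟨ markov B Y ⟩
        badPart (Y !)          ≤⟨ h ⟩
        2 ^ (2 * C * Y)        ∎))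
        where l : ∀ C b → 2 * C * (8 * b) ≡ 16 * C * b
              l = solve-∀
      total : Y ≤ a + (b + c)
      total = begin
        Y                                               ≡⟨ trans (sumTo-const Y 1) (*-identityʳ Y) ⟨
        sumTo Y (λ _ → 1)                               ≤⟨ sumTo-mono Y
            (λ i _ → one i (squareful? i) (large? B i) (smallBad? B i)) ⟩
        sumTo Y (λ i → ind (squareful? i) + (ind (large? B i) + ind (smallBad? B i))) ≡⟨ trans (sumTo-+ Y _ _)
            (cong (a +_) (sumTo-+ Y _ _)) ⟩
        a + (b + c)                                     ∎
        where
          one : ∀ i (p : Dec (∃ λ e → e < i × (2 + e) * (2 + e) ∣ suc i)) (q : Dec (B < badPart (suc i)))
              (r : Dec (SmallBad B i)) → 1 ≤ ind p + (ind q + ind r)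
          one i (yes _) q r = s≤s z≤n
          one i (no _) (yes _) r = s≤s z≤n
          one i (no _) (no _) (yes _) = s≤s z≤n
          one i (no ¬p) (no ¬q) (no ¬r) = ⊥-elim (¬r (≮⇒≥ ¬q , ¬p))

  -- A bound at some L ≥ X₀ would make the good numbers dense at every scale up to `X₀`, which
  -- `not-dense` refutes. `X₀` depends on `C` and `D` only.
  badPart-large : ∀ C → 1 ≤ C → ∃ λ L₀ → ∀ L → L₀ ≤ L → ¬ badPart (L !) ≤ 2 ^ (C * L)
  badPart-large C hC = Blocks.X₀ B hB , λ L le h → Blocks.not-dense B hB λ Y hY Y≤ →
      good-dense {C} {Y} hC (badPart-!-≤ {C} {L} {Y} h hY (≤-trans Y≤ le))
    where
      B = 8 * suc (2 ^ (16 * C))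
      hB : 1 ≤ B
      hB = *-≥1 {8} (s≤s z≤n) (s≤s z≤n)

-- Size of a monic quadratic at natural arguments.

module QuadBounds (b c : ℤ) where

  open Factor using (≥1⇒≢0)
  open import Data.Nat
  open import Data.Nat.Properties
  open import Data.Nat.Tactic.RingSolver using (solve-∀)
  import Data.Integer.Tactic.RingSolver as ℤ

  q : ℤ → ℤ
  q k = k ℤ.* k ℤ.+ b ℤ.* k ℤ.+ c

  ∣q∣-upper : ∀ n → ℤ.∣ q (ℤ.+ n) ∣ ≤ n * n + ℤ.∣ b ∣ * n + ℤ.∣ c ∣
  ∣q∣-upper n = ≤-trans (ℤ.∣i+j∣≤∣i∣+∣j∣ (ℤ.+ n ℤ.* ℤ.+ n ℤ.+ b ℤ.* ℤ.+ n) c) (+-monoˡ-≤ ℤ.∣ c ∣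
    (≤-trans (ℤ.∣i+j∣≤∣i∣+∣j∣ (ℤ.+ n ℤ.* ℤ.+ n) (b ℤ.* ℤ.+ n))
        (≤-reflexive (cong₂ _+_ (ℤ.abs-* (ℤ.+ n) (ℤ.+ n)) (ℤ.abs-* b (ℤ.+ n))))))

  ∣q∣-lower : ∀ n → n * n ≤ ℤ.∣ q (ℤ.+ n) ∣ + (ℤ.∣ b ∣ * n + ℤ.∣ c ∣)
  ∣q∣-lower n = begin
    n * n                                              ≡⟨ ℤ.abs-* (ℤ.+ n) (ℤ.+ n) ⟨
    ℤ.∣ ℤ.+ n ℤ.* ℤ.+ n ∣                              ≡⟨ cong ℤ.∣_∣ (lem (ℤ.+ n) b c) ⟩
    ℤ.∣ q (ℤ.+ n) ℤ.- (b ℤ.* ℤ.+ n ℤ.+ c) ∣            ≤⟨ ℤ.∣i-j∣≤∣i∣+∣j∣ (q (ℤ.+ n)) (b ℤ.* ℤ.+ n ℤ.+ c) ⟩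
    ℤ.∣ q (ℤ.+ n) ∣ + ℤ.∣ b ℤ.* ℤ.+ n ℤ.+ c ∣          ≤⟨ +-monoʳ-≤ ℤ.∣ q (ℤ.+ n) ∣
        (≤-trans (ℤ.∣i+j∣≤∣i∣+∣j∣ (b ℤ.* ℤ.+ n) c) (≤-reflexive (cong (_+ ℤ.∣ c ∣) (ℤ.abs-* b (ℤ.+ n))))) ⟩
    ℤ.∣ q (ℤ.+ n) ∣ + (ℤ.∣ b ∣ * n + ℤ.∣ c ∣)          ∎
    where
      open ≤-Reasoning
      lem : ∀ n b c → n ℤ.* n ≡ (n ℤ.* n ℤ.+ b ℤ.* n ℤ.+ c) ℤ.- (b ℤ.* n ℤ.+ c)
      lem = ℤ.solve-∀

  β : ℕ
  β = ℤ.∣ b ∣ + ℤ.∣ c ∣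

  linear≤ : ∀ k → 1 ≤ k → ℤ.∣ b ∣ * k + ℤ.∣ c ∣ ≤ β * k
  linear≤ k h = ≤-trans (+-monoʳ-≤ (ℤ.∣ b ∣ * k) (m≤m*n ℤ.∣ c ∣ k {{≥1⇒≢0 h}}))
      (≤-reflexive (sym (*-distribʳ-+ k ℤ.∣ b ∣ ℤ.∣ c ∣)))

  -- The bound is `L * L` because the product of `L` such values has to cancel the square of `L !`,
  -- itself at most L^(2L).
  ∣q∣-≥ : ∀ {k L} → 1 ≤ L → 2 * L ≤ k → 2 * β ≤ k → L * L ≤ ℤ.∣ q (ℤ.+ k) ∣
  ∣q∣-≥ {k} {L} hL hLk hβk = +-cancelʳ-≤ (ℤ.∣ b ∣ * k + ℤ.∣ c ∣) _ _ (≤-trans (*-cancelˡ-≤ 2 (begin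
    2 * (L * L + (ℤ.∣ b ∣ * k + ℤ.∣ c ∣))   ≤⟨ *-monoʳ-≤ 2 (+-monoʳ-≤ (L * L) (linear≤ k k≥1)) ⟩
    2 * (L * L + β * k)                     ≡⟨ l L β k ⟩
    2 * L * L + 2 * β * k                   ≤⟨ +-mono-≤ (*-mono-≤ hLk (≤-trans (m≤n*m L 2) hLk)) (*-monoˡ-≤ k hβk) ⟩
    k * k + k * k                           ≡⟨ cong (k * k +_) (sym (+-identityʳ (k * k))) ⟩
    2 * (k * k)                             ∎)) (∣q∣-lower k))
    where
      open ≤-Reasoning
      k≥1 : 1 ≤ k
      k≥1 = ≤-trans (≤-trans hL (m≤n*m L 2)) hLk
      l : ∀ L β k → 2 * (L * L + β * k) ≡ 2 * L * L + 2 * β * k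
      l = solve-∀

  ∣q∣-≤ : ∀ {k n} → k ≤ n → suc β ≤ n → ℤ.∣ q (ℤ.+ k) ∣ ≤ n ^ 3
  ∣q∣-≤ {k} {n} k≤n hβ = begin
    ℤ.∣ q (ℤ.+ k) ∣                    ≤⟨ ∣q∣-upper k ⟩
    k * k + ℤ.∣ b ∣ * k + ℤ.∣ c ∣      ≤⟨ +-monoˡ-≤ ℤ.∣ c ∣ (+-mono-≤ (*-mono-≤ k≤n k≤n) (*-monoʳ-≤ ℤ.∣ b ∣ k≤n)) ⟩
    n * n + ℤ.∣ b ∣ * n + ℤ.∣ c ∣      ≡⟨ +-assoc (n * n) _ _ ⟩
    n * n + (ℤ.∣ b ∣ * n + ℤ.∣ c ∣)    ≤⟨ +-monoʳ-≤ (n * n)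
        (≤-trans (linear≤ n n≥1) (*-monoʳ-≤ β (m≤m*n n n {{≥1⇒≢0 n≥1}}))) ⟩
    n * n + β * (n * n)                ≤⟨ *-monoˡ-≤ (n * n) hβ ⟩
    n * (n * n)                        ≡⟨ cong (λ z → n * (n * z)) (sym (*-identityʳ n)) ⟩
    n ^ 3                              ∎
    where
      open ≤-Reasoning
      n≥1 : 1 ≤ n
      n≥1 = ≤-trans (s≤s z≤n) hβ

  ∣q∣-pos : ∀ {k} → suc β ≤ k → 1 ≤ ℤ.∣ q (ℤ.+ k) ∣
  ∣q∣-pos {k} h = ≤-trans k≥1 (+-cancelʳ-≤ (β * k) _ _ (begin
    k + β * k                                    ≤⟨ *-monoˡ-≤ k h ⟩
    k * k                                        ≤⟨ ∣q∣-lower k ⟩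
    ℤ.∣ q (ℤ.+ k) ∣ + (ℤ.∣ b ∣ * k + ℤ.∣ c ∣)    ≤⟨ +-monoʳ-≤ ℤ.∣ q (ℤ.+ k) ∣ (linear≤ k k≥1) ⟩
    ℤ.∣ q (ℤ.+ k) ∣ + β * k                      ∎))
    where
      open ≤-Reasoning
      k≥1 : 1 ≤ k
      k≥1 = ≤-trans (s≤s z≤n) h

-- The contribution of each prime to a product of consecutive values of `q`.

module SmoothCore (b c D : ℤ) (D≡ : D ≡ b ℤ.* b ℤ.- ℤ.+_ 4 ℤ.* c) (nsq : ∀ e → e ℤ.* e ≢ D) where

  open Range
  open Factor
  open IntDiv
  open QuadBounds b c using (q)
  open Multiples
  open Chebyshev using (π; !≥1; ^v≥1; prime∣!⇒≤)
  open GoodPairs D nsq using (good?; Split)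
  open BadPart D nsq using (badPart)
  open import Data.Nat.Primality using (prime?; euclidsLemma)
  open import Data.Integer hiding (suc; pred; _<_; _≤_; _<?_; _≤?_)
  open import Data.Integer.Properties hiding (_≤?_; _<?_)
  open import Data.Integer.DivMod using (a≡a%ℕn+[a/ℕn]*n; n%ℕd<d) renaming (_/ℕ_ to _div_; _%ℕ_ to _mod_)
  open import Data.Integer.Divisibility.Signed renaming (_∣_ to _∥_; _∣?_ to _∥?_)
  open import Data.Integer.Tactic.RingSolver using (solve-∀)
  open import Data.Nat.Tactic.RingSolver using () renaming (solve-∀ to solve-∀ₙ)

  private
    H : ℕ
    H = 2 ℕ.+ ∣ D ∣

    D≢0 : D ≢ 0ℤ
    D≢0 e = nsq 0ℤ (sym e)

    D≥1 : 1 ℕ.≤ ∣ D ∣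
    D≥1 = ≢0⇒abs≥1 D≢0

  -- Whichever of `x` and `y` has the larger valuation carries at least half of the exponent `j`.
  ^∥*⇒^∥sq : ∀ {p} j x y → Prime p → + (p ℕ.^ j) ∥ x * y → + (p ℕ.^ j) ∥ x * x ⊎ + (p ℕ.^ j) ∥ y * y
  ^∥*⇒^∥sq {p} j x y pp d with x ≟ 0ℤ | y ≟ 0ℤ
  ... | yes refl | _        = inj₁ (divides 0ℤ refl)
  ... | no _     | yes refl = inj₂ (divides 0ℤ refl)
  ... | no hx    | no hy    = go (ℕ.≤-total (v p ∣ y ∣) (v p ∣ x ∣))
    where
      ax = ≢0⇒abs≥1 hx
      ay = ≢0⇒abs≥1 hy
      j≤ : j ℕ.≤ v p ∣ x ∣ ℕ.+ v p ∣ y ∣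
      j≤ = ℕ.≤-trans (^∣⇒≤v j pp (*-≥1 ax ay) (subst (p ℕ.^ j ℕ.∣_) (abs-* x y) (∣⇒∣ᵤ d)))
          (ℕ.≤-reflexive (v-* p ax ay))
      square : ∀ z → 1 ℕ.≤ ∣ z ∣ → j ℕ.≤ v p ∣ z ∣ ℕ.+ v p ∣ z ∣ → + (p ℕ.^ j) ∥ z * z
      square z az h = ∣ᵤ⇒∣ (subst (p ℕ.^ j ℕ.∣_) (sym (abs-* z z))
          (≤v⇒^∣ {p} j (*-≥1 az az) (ℕ.≤-trans h (ℕ.≤-reflexive (sym (v-* p az az))))))
      go : v p ∣ y ∣ ℕ.≤ v p ∣ x ∣ ⊎ v p ∣ x ∣ ℕ.≤ v p ∣ y ∣ → + (p ℕ.^ j) ∥ x * x ⊎ + (p ℕ.^ j) ∥ y * y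
      go (inj₁ h) = inj₁ (square x ax (ℕ.≤-trans j≤ (ℕ.+-monoʳ-≤ (v p ∣ x ∣) h)))
      go (inj₂ h) = inj₂ (square y ay (ℕ.≤-trans j≤ (ℕ.+-monoˡ-≤ (v p ∣ y ∣) h)))

  cancel-D : ∀ {p} e x → Prime p → + (p ℕ.^ (v p ∣ D ∣ ℕ.+ e)) ∥ D * x → + (p ℕ.^ e) ∥ x
  cancel-D {p} e x pp d with x ≟ 0ℤ
  ... | yes refl = divides 0ℤ refl
  ... | no hx = ∣ᵤ⇒∣ (≤v⇒^∣ {p} e ax (ℕ.+-cancelˡ-≤ (v p ∣ D ∣) _ _ (ℕ.≤-trans
        (^∣⇒≤v _ pp (*-≥1 D≥1 ax) (subst (p ℕ.^ (v p ∣ D ∣ ℕ.+ e) ℕ.∣_) (abs-* D x) (∣⇒∣ᵤ d)))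
            (ℕ.≤-reflexive (v-* p D≥1 ax)))))
    where ax = ≢0⇒abs≥1 hx

  -- D x = x³ + (2x + y) x y - 4 q(k) x for x = k - l and y = k + l + b, and likewise for y.
  two-classes : ∀ {p} e k l → Prime p → + (p ℕ.^ (v p ∣ D ∣ ℕ.+ e)) ∥ q k → + (p ℕ.^ (v p ∣ D ∣ ℕ.+ e)) ∥ q l →
    + (p ℕ.^ e) ∥ k - l ⊎ + (p ℕ.^ e) ∥ k + l + b
  two-classes {p} e k l pp dk dl = go (^∥*⇒^∥sq (v p ∣ D ∣ ℕ.+ e) (k - l) (k + l + b) pp dxy)
    where
      P = + (p ℕ.^ (v p ∣ D ∣ ℕ.+ e))
      lxy : ∀ k l b c → (k * k + b * k + c) - (l * l + b * l + c) ≡ (k - l) * (k + l + b)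
      lxy = solve-∀
      dxy : P ∥ (k - l) * (k + l + b)
      dxy = subst (P ∥_) (lxy k l b c) (∣m∣n⇒∣m-n dk dl)
      lx : ∀ k l b c → (k - l) * (k - l) * (k - l) + (k - l) * (k + l + b) * (+ 2 * (k - l) + (k + l + b)) -
          (k * k + b * k + c) * (+ 4 * (k - l))
           ≡ (b * b - + 4 * c) * (k - l)
      lx = solve-∀
      ly : ∀ k l b c → (k + l + b) * (k + l + b) * (k + l + b) + (k - l) * (k + l + b) * (+ 2 * (k + l + b) + (k - l))
          - (k * k + b * k + c) * (+ 4 * (k + l + b))
           ≡ (b * b - + 4 * c) * (k + l + b)
      ly = solve-∀
      go : P ∥ (k - l) * (k - l) ⊎ P ∥ (k + l + b) * (k + l + b) → + (p ℕ.^ e) ∥ k - l ⊎ + (p ℕ.^ e) ∥ k + l + b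
      go (inj₁ d) = inj₁ (cancel-D e (k - l) pp (subst (P ∥_) (trans (lx k l b c) (cong (_* (k - l)) (sym D≡)))
        (∣m∣n⇒∣m-n (∣m∣n⇒∣m+n (∣m⇒∣m*n (k - l) d) (∣m⇒∣m*n (+ 2 * (k - l) + (k + l + b)) dxy))
            (∣m⇒∣m*n (+ 4 * (k - l)) dk))))
      go (inj₂ d) = inj₂ (cancel-D e (k + l + b) pp
          (subst (P ∥_) (trans (ly k l b c) (cong (_* (k + l + b)) (sym D≡)))
        (∣m∣n⇒∣m-n (∣m∣n⇒∣m+n (∣m⇒∣m*n (k + l + b) d) (∣m⇒∣m*n (+ 2 * (k + l + b) + (k - l)) dxy))
            (∣m⇒∣m*n (+ 4 * (k + l + b)) dk))))

  -- 4 q(k) = (2k + b)² - D, so the residue of 2k + b is a root of `D` modulo `p`.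
  ∥q⇒Split : ∀ {p} k → Prime p → + p ∥ q k → Split p
  ∥q⇒Split {zero} k pp d with () ← prime≥2 pp
  ∥q⇒Split {p@(suc _)} k pp d = z mod p , n%ℕd<d z p , subst (+ p ∥_)
      (lem₁ z (+ (z mod p)) (z div p) (+ p) D (a≡a%ℕn+[a/ℕn]*n z p))
      (∣m∣n⇒∣m-n dz (∣n⇒∣m*n (z + + (z mod p)) {z div p * + p} (∣n⇒∣m*n (z div p) ∣-refl)))
    where
      z = + 2 * k + b
      lem : ∀ k b c → + 4 * (k * k + b * k + c) ≡ (+ 2 * k + b) * (+ 2 * k + b) - (b * b - + 4 * c)
      lem = solve-∀
      dz : + p ∥ z * z - D
      dz = subst (+ p ∥_) (trans (lem k b c) (cong (λ d → z * z - d) (sym D≡))) (∣n⇒∣m*n (+ 4) d)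
      lem₁ : ∀ z r x p D → z ≡ r + x * p → z * z - D - (z + r) * (x * p) ≡ r * r - D
      lem₁ z r x p D refl = lem₂ r (x * p) D
        where lem₂ : ∀ r y D → (r + y) * (r + y) - D - (r + y + r) * y ≡ r * r - D
              lem₂ = solve-∀

  module Window (s L : ℕ) (1≤L : 1 ℕ.≤ L) where

    k : ℕ → ℤ
    k i = + (s ℕ.+ i)

    a : ℕ → ℕ
    a i = ∣ q (k i) ∣

    private
      k-diff : ∀ {i j} → i ℕ.< j → k j - k i ≡ + (j ℕ.∸ i)
      k-diff {i} {j} i<j = trans (lem (+ s) (+ i) (+ j)) (trans (m-n≡m⊖n j i) (⊖-≥ (ℕ.<⇒≤ i<j)))
        where lem : ∀ s i j → s + j - (s + i) ≡ j - i
              lem = solve-∀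

    hits? : ∀ m i → Dec (m ℕ.∣ a i)
    hits? m i = m ℕ.∣? a i

    -- By `two-classes` every hit is congruent modulo `p ^ e` to one fixed hit or to its mirror
    -- image under k ↦ -b - k. The extra exponent, the valuation of `D`, accounts for primes at
    -- which the two roots of `q` come together.
    hit-count : ∀ {p} e → Prime p → count (hits? (p ℕ.^ (v p ∣ D ∣ ℕ.+ e))) L ℕ.≤ 2 ℕ.* suc (multiples L (p ℕ.^ e))
    hit-count {p} e pp = go (ℕ.anyUpTo? (hits? P) L)
      where
        P = p ℕ.^ (v p ∣ D ∣ ℕ.+ e)
        m = p ℕ.^ e
        go : Dec (∃ λ i → i ℕ.< L × P ℕ.∣ a i) → count (hits? P) L ℕ.≤ 2 ℕ.* suc (multiples L m)
        go (no ¬h) = ℕ.≤-trans (ℕ.≤-reflexive (count-zero (hits? P) L (λ i i<L d → ¬h (i , i<L , d)))) z≤n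
        go (yes (i₀ , _ , d₀)) = ℕ.≤-trans
            (count-⊎ (hits? P) minus? plus? L (λ i _ d → two-classes e (k i) (k i₀) pp (∣ᵤ⇒∣ d) (∣ᵤ⇒∣ d₀)))
            (ℕ.≤-trans (ℕ.+-mono-≤ (class minus? (λ i j → diff-minus (k i) (k j)))
                (class plus? (λ i j → diff-plus (k i) (k j))))
              (ℕ.≤-reflexive (cong (suc (multiples L m) ℕ.+_) (sym (ℕ.+-identityʳ _)))))
          where
            minus? : ∀ i → Dec (+ m ∥ k i - k i₀)
            minus? i = + m ∥? k i - k i₀
            plus? : ∀ i → Dec (+ m ∥ k i + k i₀ + b)
            plus? i = + m ∥? k i + k i₀ + b
            diff-minus : ∀ x y → + m ∥ x - k i₀ → + m ∥ y - k i₀ → + m ∥ y - x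
            diff-minus x y dx dy = subst (+ m ∥_) (lem x y (k i₀)) (∣m∣n⇒∣m-n dy dx)
              where lem : ∀ x y z → y - z - (x - z) ≡ y - x
                    lem = solve-∀
            diff-plus : ∀ x y → + m ∥ x + k i₀ + b → + m ∥ y + k i₀ + b → + m ∥ y - x
            diff-plus x y dx dy = subst (+ m ∥_) (lem x y (k i₀) b) (∣m∣n⇒∣m-n dy dx)
              where lem : ∀ x y z b → y + z + b - (x + z + b) ≡ y - x
                    lem = solve-∀
            class : ∀ {R : ℕ → Set} (R? : ∀ i → Dec (R i)) → (∀ i j → R i → R j → + m ∥ k j - k i) → count R? L ℕ.≤
                suc (multiples L m)
            class R? h = count-congruent R? L m (^-≥1 e (prime≥1 pp))
                (λ i j i<j _ ri rj → ∣⇒∣ᵤ (subst (+ m ∥_) (k-diff i<j) (h i j ri rj)))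

    module _ (a≥1 : ∀ i → i ℕ.< L → 1 ℕ.≤ a i) where

      -- Valuations are counted level by level, one level for each power of `p`. The first v(D)
      -- levels cost at most `L` each; every later level costs two classes, whose multiples sum to
      -- Legendre's expression, while the additional one per class gives `2 * J`.
      v-window : ∀ {p} J → Prime p → (∀ i → i ℕ.< L → v p (a i) ℕ.≤ J) →
        v p (prodTo L a) ℕ.≤ L ℕ.* v p ∣ D ∣ ℕ.+ (2 ℕ.* legendre p L J ℕ.+ 2 ℕ.* J)
      v-window {p} J pp hJ = begin
        v p (prodTo L a)                                          ≡⟨ v-prodTo p L a a≥1 ⟩
        sumTo L (λ i → v p (a i))                                 ≤⟨ sumTo-mono L
            (λ i i<L → v≤count {p} J pp (a≥1 i i<L) (hJ i i<L)) ⟩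
        sumTo L (λ i → sumTo J (λ j → ind (hits? (p ℕ.^ suc j) i))) ≡⟨ sumTo-swap L J _ ⟩
        sumTo J C                                                 ≤⟨ sumTo-≤-range C (ℕ.m≤n+m J w) ⟩
        sumTo (w ℕ.+ J) C                                         ≡⟨ sumTo-split w J C ⟩
        sumTo w C ℕ.+ sumTo J (λ j → C (w ℕ.+ j))                 ≤⟨ ℕ.+-mono-≤ low high ⟩
        L ℕ.* w ℕ.+ (2 ℕ.* legendre p L J ℕ.+ 2 ℕ.* J)            ∎
        where
          open ℕ.≤-Reasoning
          w = v p ∣ D ∣
          C : ℕ → ℕ
          C j = count (hits? (p ℕ.^ suc j)) L
          low : sumTo w C ℕ.≤ L ℕ.* w
          low = ℕ.≤-trans (sumTo-mono w (λ j _ → count≤ (hits? (p ℕ.^ suc j)) L))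
              (ℕ.≤-reflexive (trans (sumTo-const w L) (ℕ.*-comm w L)))
          high : sumTo J (λ j → C (w ℕ.+ j)) ℕ.≤ 2 ℕ.* legendre p L J ℕ.+ 2 ℕ.* J
          high = ℕ.≤-trans (sumTo-mono J
              (λ j _ → subst (λ z → count (hits? (p ℕ.^ z)) L ℕ.≤ 2 ℕ.* suc (multiples L (p ℕ.^ suc j))) (ℕ.+-suc w j)
              (hit-count (suc j) pp)))
            (ℕ.≤-reflexive (trans (sumTo-*ˡ J 2 _)
                (trans (cong (2 ℕ.*_) (trans (sumTo-+ J (λ _ → 1) _)
                (cong (ℕ._+ legendre p L J) (trans (sumTo-const J 1) (ℕ.*-identityʳ J)))))
              (lem J (legendre p L J)))))
            where lem : ∀ x y → 2 ℕ.* (x ℕ.+ y) ≡ 2 ℕ.* y ℕ.+ 2 ℕ.* x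
                  lem = solve-∀ₙ

      module _ (Z : ℕ) (a≤Z : ∀ i → i ℕ.< L → a i ℕ.≤ Z) where

        private
          choose≥1 : ∀ {P : Set} (P? : Dec P) {x} → 1 ℕ.≤ x → 1 ℕ.≤ choose P? x
          choose≥1 (yes _) h = h
          choose≥1 (no _)  h = ℕ.≤-refl

          Z≥1 : 1 ℕ.≤ Z
          Z≥1 = ℕ.≤-trans (a≥1 0 1≤L) (a≤Z 0 1≤L)

        -- The p-part of the product of the values comes from D, from (L !)² or the small primes, and
        -- from the highest power of p dividing a single value.
        f₁ f₂ f₃ f₄ F : ℕ → ℕ
        f₁ p = p ℕ.^ v p ∣ D ∣
        f₂ p = choose (good? p) (p ℕ.^ v p (L !))
        f₃ p = choose (p ℕ.<? suc H) (H ℕ.^ (2 ℕ.* L))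
        f₄ p = choose (prime? p) (Z ℕ.^ 2)
        F p = f₁ p ℕ.^ L ℕ.* (f₂ p ℕ.^ 2 ℕ.* (f₃ p ℕ.* f₄ p))

        private
          f₁≥1 : ∀ p → 1 ℕ.≤ f₁ p ℕ.^ L
          f₁≥1 p = ^-≥1 L (^v≥1 p ∣ D ∣)
          f₂≥1 : ∀ p → 1 ℕ.≤ f₂ p ℕ.^ 2
          f₂≥1 p = ^-≥1 2 (choose≥1 (good? p) (^v≥1 p (L !)))
          f₃≥1 : ∀ p → 1 ℕ.≤ f₃ p
          f₃≥1 p = choose≥1 (p ℕ.<? suc H) (^-≥1 (2 ℕ.* L) (s≤s z≤n))
          f₄≥1 : ∀ p → 1 ℕ.≤ f₄ p
          f₄≥1 p = choose≥1 (prime? p) (^-≥1 2 Z≥1)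
          F≥1 : ∀ p → 1 ℕ.≤ F p
          F≥1 p = *-≥1 (f₁≥1 p) (*-≥1 (f₂≥1 p) (*-≥1 (f₃≥1 p) (f₄≥1 p)))

        -- Take `J` to be the largest valuation of a single value: pᴶ divides that value, so it is
        -- at most `Z`, which turns the term `2 * J` of `v-window` into `f₄`.
        local-bound-prime : ∀ p → Prime p → p ℕ.^ v p (prodTo L a) ℕ.≤ F p
        local-bound-prime p pp = go (argmax L (λ i → v p (a i)) 1≤L)
          where
            open ℕ.≤-Reasoning
            instance _ = ≥1⇒≢0 (prime≥1 pp)
            go : (∃ λ i → i ℕ.< L × (∀ j → j ℕ.< L → v p (a j) ℕ.≤ v p (a i))) → p ℕ.^ v p (prodTo L a) ℕ.≤ F p
            go (i , i<L , h) with v p (a i) in eq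
            ... | zero = ℕ.≤-trans (ℕ.≤-reflexive (cong (p ℕ.^_) (trans (v-prodTo p L a a≥1)
                    (trans (sumTo-cong L (λ j j<L → ℕ.n≤0⇒n≡0 (h j j<L))) (trans (sumTo-const L 0) (ℕ.*-zeroʳ L))))))
                        (F≥1 p)
            ... | J@(suc _) = begin
                p ℕ.^ v p (prodTo L a) ≤⟨ ℕ.^-monoʳ-≤ p (v-window J pp h) ⟩
                p ℕ.^ (L ℕ.* w ℕ.+ (2 ℕ.* S ℕ.+ 2 ℕ.* J)) ≡⟨ trans (ℕ.^-distribˡ-+-* p (L ℕ.* w) _)
                    (cong₂ ℕ._*_ (e₁ L w) (trans (ℕ.^-distribˡ-+-* p (2 ℕ.* S) (2 ℕ.* J))
                    (cong₂ ℕ._*_ (e₁ 2 S) (e₁ 2 J)))) ⟩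
                f₁ p ℕ.^ L ℕ.* ((p ℕ.^ S) ℕ.^ 2 ℕ.* (p ℕ.^ J) ℕ.^ 2) ≤⟨ ℕ.*-monoʳ-≤ (f₁ p ℕ.^ L)
                    (ℕ.*-mono-≤ S-bound (ℕ.≤-trans (ℕ.^-monoˡ-≤ 2 (ℕ.≤-trans pJ≤ (a≤Z i i<L)))
                    (ℕ.≤-reflexive (sym (choose-yes (prime? p) pp))))) ⟩
                f₁ p ℕ.^ L ℕ.* (f₂ p ℕ.^ 2 ℕ.* f₃ p ℕ.* f₄ p) ≡⟨ cong (f₁ p ℕ.^ L ℕ.*_)
                    (ℕ.*-assoc (f₂ p ℕ.^ 2) (f₃ p) (f₄ p)) ⟩
                F p ∎
              where
                w = v p ∣ D ∣
                S = legendre p L J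
                e₁ : ∀ m n → p ℕ.^ (m ℕ.* n) ≡ (p ℕ.^ n) ℕ.^ m
                e₁ m n = trans (cong (p ℕ.^_) (ℕ.*-comm m n)) (sym (ℕ.^-*-assoc p n m))
                pJ∣ : p ℕ.^ J ℕ.∣ a i
                pJ∣ = ≤v⇒^∣ {p} {a i} J (a≥1 i i<L) (ℕ.≤-reflexive (sym eq))
                pJ≤ : p ℕ.^ J ℕ.≤ a i
                pJ≤ = ∣⇒≤′ (a≥1 i i<L) pJ∣
                split : Split p
                split = ∥q⇒Split (k i) pp (∣ᵤ⇒∣ (v≥1⇒∣ {p} {a i} (subst (1 ℕ.≤_) (sym eq) (s≤s z≤n))))
                -- Up to `H` the crude bound of Legendre's sum by `L` suffices. Above `H` the prime
                -- is good, as it divides a value of `q`, and `f₂` contains its full power in `L !`.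
                S-bound : (p ℕ.^ S) ℕ.^ 2 ℕ.≤ f₂ p ℕ.^ 2 ℕ.* f₃ p
                S-bound with p ℕ.<? suc H
                ... | yes p≤H = ℕ.≤-trans (ℕ.≤-trans
                    (ℕ.^-monoˡ-≤ 2 (ℕ.≤-trans (ℕ.^-monoʳ-≤ p (legendre≤ L J (prime≥2 pp)))
                    (ℕ.^-monoˡ-≤ L (ℕ.s≤s⁻¹ p≤H))))
                        (ℕ.≤-reflexive (trans (ℕ.^-*-assoc H L 2) (cong (H ℕ.^_) (ℕ.*-comm L 2)))))
                            (ℕ.m≤n*m (H ℕ.^ (2 ℕ.* L)) (f₂ p ℕ.^ 2) {{≥1⇒≢0 (f₂≥1 p)}})
                ... | no ¬p≤H = ℕ.≤-trans (ℕ.^-monoˡ-≤ 2 (ℕ.≤-trans (ℕ.^-monoʳ-≤ p (legendre≤v L J pp))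
                        (ℕ.≤-reflexive (sym (choose-yes (good? p) (pp , ℕ.≮⇒≥ ¬p≤H , split))))))
                            (ℕ.≤-reflexive (sym (ℕ.*-identityʳ _)))

        local-bound : ∀ p → p ℕ.^ v p (prodTo L a) ℕ.≤ F p
        local-bound p = go (prime? p)
          where
            go : Dec (Prime p) → p ℕ.^ v p (prodTo L a) ℕ.≤ F p
            go (yes pp) = local-bound-prime p pp
            go (no ¬pp) = ℕ.≤-trans (ℕ.≤-reflexive (cong (p ℕ.^_) (¬Prime⇒v≡0 (prodTo L a) ¬pp))) (F≥1 p)

        -- The product of the local bounds over `p < X` contains the square of the good part of
        -- `L !`; the square of the bad part on the left completes it to the square of `L !`.
        smooth-bound : ∀ X → L ℕ.< X → ∣ D ∣ ℕ.< X → (∀ i → i ℕ.< L → ∀ p → Prime p → p ℕ.∣ a i → p ℕ.< X) →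
          prodTo L a ℕ.* badPart (L !) ℕ.^ 2 ℕ.≤ ∣ D ∣ ℕ.^ L ℕ.*
              ((L !) ℕ.^ 2 ℕ.* ((H ℕ.^ (2 ℕ.* L)) ℕ.^ suc H ℕ.* (Z ℕ.^ 2) ℕ.^ π X))
        smooth-bound X L<X D<X smooth = begin
          prodTo L a ℕ.* B ℕ.^ 2                                             ≡⟨ cong (ℕ._* B ℕ.^ 2)
              (≡prodTo X P≥1 (λ p pp d → below p pp (prime∣prodTo L p pp d))) ⟩
          prodTo X (λ p → p ℕ.^ v p (prodTo L a)) ℕ.* B ℕ.^ 2                ≤⟨ ℕ.*-monoˡ-≤ (B ℕ.^ 2)
              (prodTo-mono X (λ p _ → local-bound p)) ⟩
          prodTo X F ℕ.* B ℕ.^ 2                                             ≡⟨ cong (ℕ._* B ℕ.^ 2) global ⟩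
          ∣ D ∣ ℕ.^ L ℕ.* (G ℕ.^ 2 ℕ.* (prodTo X f₃ ℕ.* (Z ℕ.^ 2) ℕ.^ π X)) ℕ.* B ℕ.^ 2 ≡⟨ rearrange (∣ D ∣ ℕ.^ L) G
              (prodTo X f₃) ((Z ℕ.^ 2) ℕ.^ π X) B ⟩
          ∣ D ∣ ℕ.^ L ℕ.* ((G ℕ.* B) ℕ.^ 2 ℕ.* (prodTo X f₃ ℕ.* (Z ℕ.^ 2) ℕ.^ π X)) ≡⟨ cong
              (λ z → ∣ D ∣ ℕ.^ L ℕ.* (z ℕ.^ 2 ℕ.* (prodTo X f₃ ℕ.* (Z ℕ.^ 2) ℕ.^ π X))) (part-compl good? (!≥1 L)) ⟩
          ∣ D ∣ ℕ.^ L ℕ.* ((L !) ℕ.^ 2 ℕ.* (prodTo X f₃ ℕ.* (Z ℕ.^ 2) ℕ.^ π X)) ≤⟨ ℕ.*-monoʳ-≤ (∣ D ∣ ℕ.^ L)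
              (ℕ.*-monoʳ-≤ ((L !) ℕ.^ 2) (ℕ.*-monoˡ-≤ ((Z ℕ.^ 2) ℕ.^ π X) f₃-bound)) ⟩
          ∣ D ∣ ℕ.^ L ℕ.* ((L !) ℕ.^ 2 ℕ.* ((H ℕ.^ (2 ℕ.* L)) ℕ.^ suc H ℕ.* (Z ℕ.^ 2) ℕ.^ π X)) ∎
          where
            open ℕ.≤-Reasoning
            B = badPart (L !)
            G = part good? (L !)
            P≥1 = prodTo-pos L a a≥1
            prime∣prodTo : ∀ m p → Prime p → p ℕ.∣ prodTo m a → ∃ λ i → i ℕ.< m × p ℕ.∣ a i
            prime∣prodTo zero p pp d with () ← ℕ.<⇒≱ (prime≥2 pp) (ℕ.∣⇒≤ d)
            prime∣prodTo (suc m) p pp d with euclidsLemma (prodTo m a) (a m) pp d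
            ... | inj₂ e = m , ℕ.≤-refl , e
            ... | inj₁ e with prime∣prodTo m p pp e
            ...   | i , i<m , h = i , ℕ.m<n⇒m<1+n i<m , h
            below : ∀ p → Prime p → (∃ λ i → i ℕ.< L × p ℕ.∣ a i) → p ℕ.< X
            below p pp (i , i<L , d) = smooth i i<L p pp d
            global : prodTo X F ≡ ∣ D ∣ ℕ.^ L ℕ.* (G ℕ.^ 2 ℕ.* (prodTo X f₃ ℕ.* (Z ℕ.^ 2) ℕ.^ π X))
            global = trans (prodTo-* X _ _) (cong₂ ℕ._*_
              (trans (prodTo-^ X L f₁) (cong (ℕ._^ L) (sym (≡prodTo X D≥1 (λ p _ d → ℕ.≤-<-trans (∣⇒≤′ D≥1 d) D<X)))))
              (trans (prodTo-* X _ _) (cong₂ ℕ._*_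
                (trans (prodTo-^ X 2 f₂) (cong (ℕ._^ 2)
                    (sym (part-prodTo good? (L !) X (λ p pp d → ℕ.≤-<-trans (prime∣!⇒≤ L pp d) L<X)))))
                (trans (prodTo-* X f₃ f₄) (cong (prodTo X f₃ ℕ.*_) (prodTo-choose prime? X (Z ℕ.^ 2)))))))
            f₃-bound : prodTo X f₃ ℕ.≤ (H ℕ.^ (2 ℕ.* L)) ℕ.^ suc H
            f₃-bound = ℕ.≤-trans (ℕ.≤-reflexive (prodTo-choose (ℕ._<? suc H) X (H ℕ.^ (2 ℕ.* L))))
              (ℕ.^-monoʳ-≤ (H ℕ.^ (2 ℕ.* L)) {{≥1⇒≢0 (^-≥1 (2 ℕ.* L) (s≤s z≤n))}} (count-below≤ X (suc H)))
            rearrange : ∀ d g x y b → d ℕ.* (g ℕ.^ 2 ℕ.* (x ℕ.* y)) ℕ.* b ℕ.^ 2 ≡ d ℕ.*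
                ((g ℕ.* b) ℕ.^ 2 ℕ.* (x ℕ.* y))
            rearrange = lem
              where lem : ∀ d g x y b → d ℕ.* (g ℕ.* (g ℕ.* 1) ℕ.* (x ℕ.* y)) ℕ.* (b ℕ.* (b ℕ.* 1)) ≡ d ℕ.*
                        ((g ℕ.* b) ℕ.* ((g ℕ.* b) ℕ.* 1) ℕ.* (x ℕ.* y))
                    lem = solve-∀ₙ

-- A prime much larger than n divides some value of `q` slightly below n.

module LargePrime (b c D : ℤ) (D≡ : D ≡ b ℤ.* b ℤ.- ℤ.+_ 4 ℤ.* c) (nsq : ∀ e → e ℤ.* e ≢ D) where

  open Range
  open Factor
  open Chebyshev using (π; chebyshev)
  open BadPart D nsq using (badPart; bad?; badPart-large)
  open SmoothCore b c D D≡ nsq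
  open QuadBounds b c
  open import Data.Nat
  open import Data.Nat.Properties
  open import Data.Nat.DivMod
  open import Data.Nat.Divisibility using (_∣_)
  open import Data.Nat.Tactic.RingSolver using (solve-∀)

  -- `chebyshev` speaks of powers of 2 only; rounding `M * n` up to one costs a factor 2.
  power-of-2-bracket : ∀ m → 1 ≤ m → ∃ λ i → m ≤ 2 ^ i × 2 ^ i ≤ 2 * m
  power-of-2-bracket (suc zero) _ = 0 , ≤-refl , s≤s z≤n
  power-of-2-bracket (suc m@(suc _)) _ with power-of-2-bracket m (s≤s z≤n)
  ... | i , lo , hi with suc m ≤? 2 ^ i
  ...   | yes h = i , h , ≤-trans hi (*-monoʳ-≤ 2 (n≤1+n m))
  ...   | no ¬h = suc i , ≤-trans (+-mono-≤ {1} {m} {m} {m} (s≤s z≤n) ≤-refl)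
      (≤-trans (≤-reflexive (cong (m +_) (sym (+-identityʳ m)))) (*-monoʳ-≤ 2 lo))
                    , *-monoʳ-≤ 2 (≤-trans (≤-pred (≰⇒> ¬h)) (n≤1+n m))

  !≤^ : ∀ L → L ! ≤ L ^ L
  !≤^ L = go L L ≤-refl
    where
      go : ∀ m n → m ≤ n → m ! ≤ n ^ m
      go zero    n h = ≤-refl
      go (suc m) n h = *-mono-≤ h (go m n (≤-trans (n≤1+n m) h))

  private
    H : ℕ
    H = 2 + ℤ.∣ D ∣

  -- The exponents of ∣ D ∣ ^ L, of (H ^ 2L) ^ (1 + H) and of Z ^ (2 π X), the latter by Chebyshev's bound.
  rate : ℕ → ℕ → ℕ
  rate w M = ℤ.∣ D ∣ + H * 2 * suc H + 144 * (M * w) + 1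

  -- The values in the window multiply to at least L^(2L). If they have no prime factor above
  -- `M * n`, then `smooth-bound` bounds their product times the squared bad part by (L !)² ≤ L^(2L)
  -- times factors exponential in `L`; cancelling L^(2L) isolates the bad part.
  badPart-≤ : ∀ {w M n L j} → 1 ≤ M → n ≤ 2 * (w * L) → 1 ≤ L → 3 * L ≤ n → suc (2 * β) ≤ L → ℤ.∣ D ∣ ≤ L →
    M * n ≤ 2 ^ (2 + j) → 2 ^ (2 + j) ≤ 2 * (M * n) →
    (∀ i → i < L → ∀ p → Prime p → p ∣ ℤ.∣ q (ℤ.+ (n ∸ L + i)) ∣ → p ≤ M * n) →
    badPart (L !) ≤ 2 ^ (rate w M * L)
  badPart-≤ {w} {M} {n} {L} {j} hM n≤ hL 3L≤n hβ hD lo hi smooth = begin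
    B                                    ≤⟨ m≤m*n B (B * 1) {{≥1⇒≢0 (*-≥1 B≥1 (s≤s z≤n))}} ⟩
    B ^ 2                                ≤⟨ *-cancelˡ-≤ ((L ^ L) ^ 2) {{≥1⇒≢0 (^-≥1 2 (^-≥1 L hL))}} main ⟩
    ℤ.∣ D ∣ ^ L * ((H ^ (2 * L)) ^ suc H * (Z ^ 2) ^ π X)   ≤⟨ *-mono-≤ (^-monoˡ-≤ L (n≤2^n ℤ.∣ D ∣))
        (*-mono-≤ (^-monoˡ-≤ (suc H) (^-monoˡ-≤ (2 * L) (n≤2^n H))) ≤-refl) ⟩
    (2 ^ ℤ.∣ D ∣) ^ L * (((2 ^ H) ^ (2 * L)) ^ suc H * (Z ^ 2) ^ π X) ≡⟨ exponents ⟩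
    2 ^ (ℤ.∣ D ∣ * L + (H * (2 * L) * suc H + 6 * (i * π X))) ≤⟨ ^-monoʳ-≤ 2 expo-≤ ⟩
    2 ^ (rate w M * L)                   ∎
    where
      open ≤-Reasoning
      open Window (n ∸ L) L hL
      i X Z B : ℕ
      i = 2 + j
      X = suc (2 ^ i)
      Z = (2 ^ i) ^ 3
      B = badPart (L !)
      B≥1 : 1 ≤ B
      B≥1 = part≥1 bad? (L !)
      L≤n : L ≤ n
      L≤n = ≤-trans (m≤n*m L 3) 3L≤n
      n≤2^i : n ≤ 2 ^ i
      n≤2^i = ≤-trans (m≤n*m n M {{≥1⇒≢0 hM}}) lo
      k≤n : ∀ t → t < L → n ∸ L + t ≤ n
      k≤n t t<L = ≤-trans (+-monoʳ-≤ (n ∸ L) (<⇒≤ t<L)) (≤-reflexive (m∸n+n≡m L≤n))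
      2L≤ : 2 * L ≤ n ∸ L
      2L≤ = m+n≤o⇒m≤o∸n (2 * L) (≤-trans (≤-reflexive (l L)) 3L≤n)
        where l : ∀ L → 2 * L + L ≡ 3 * L
              l = solve-∀
      k≥ : ∀ t → 2 * L ≤ n ∸ L + t
      k≥ t = ≤-trans 2L≤ (m≤m+n (n ∸ L) t)
      a≥ : ∀ t → t < L → L * L ≤ a t
      a≥ t t<L = ∣q∣-≥ hL (k≥ t) (≤-trans (≤-trans (n≤1+n _) hβ) (≤-trans (m≤n*m L 2) (k≥ t)))
      a≥1 : ∀ t → t < L → 1 ≤ a t
      a≥1 t t<L = ≤-trans (*-≥1 hL hL) (a≥ t t<L)
      a≤ : ∀ t → t < L → a t ≤ Z
      a≤ t t<L = ≤-trans (∣q∣-≤ (k≤n t t<L) (≤-trans (s≤s (m≤n*m β 2)) (≤-trans hβ L≤n))) (^-monoˡ-≤ 3 n≤2^i)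
      bound = smooth-bound a≥1 Z a≤ X (s≤s (≤-trans L≤n n≤2^i)) (s≤s (≤-trans hD (≤-trans L≤n n≤2^i)))
                (λ t t<L p pp d → s≤s (≤-trans (smooth t t<L p pp d) lo))
      main : (L ^ L) ^ 2 * B ^ 2 ≤ (L ^ L) ^ 2 * (ℤ.∣ D ∣ ^ L * ((H ^ (2 * L)) ^ suc H * (Z ^ 2) ^ π X))
      main = begin
        (L ^ L) ^ 2 * B ^ 2     ≡⟨ cong (_* B ^ 2)
            (trans (cong (L ^ L *_) (*-identityʳ (L ^ L))) (sym (^-distribʳ-* L L L))) ⟩
        (L * L) ^ L * B ^ 2     ≡⟨ cong (_* B ^ 2) (sym (prodTo-const L (L * L))) ⟩
        prodTo L (λ _ → L * L) * B ^ 2 ≤⟨ *-monoˡ-≤ (B ^ 2) (prodTo-mono L a≥) ⟩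
        prodTo L a * B ^ 2      ≤⟨ bound ⟩
        ℤ.∣ D ∣ ^ L * ((L !) ^ 2 * ((H ^ (2 * L)) ^ suc H * (Z ^ 2) ^ π X)) ≤⟨ *-monoʳ-≤ (ℤ.∣ D ∣ ^ L)
            (*-monoˡ-≤ ((H ^ (2 * L)) ^ suc H * (Z ^ 2) ^ π X) (^-monoˡ-≤ 2 (!≤^ L))) ⟩
        ℤ.∣ D ∣ ^ L * ((L ^ L) ^ 2 * ((H ^ (2 * L)) ^ suc H * (Z ^ 2) ^ π X)) ≡⟨ l (ℤ.∣ D ∣ ^ L) ((L ^ L) ^ 2) _ ⟩
        (L ^ L) ^ 2 * (ℤ.∣ D ∣ ^ L * ((H ^ (2 * L)) ^ suc H * (Z ^ 2) ^ π X)) ∎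
        where l : ∀ x y z → x * (y * z) ≡ y * (x * z)
              l = solve-∀
      exponents : (2 ^ ℤ.∣ D ∣) ^ L * (((2 ^ H) ^ (2 * L)) ^ suc H * (Z ^ 2) ^ π X) ≡ 2 ^
          (ℤ.∣ D ∣ * L + (H * (2 * L) * suc H + 6 * (i * π X)))
      exponents = trans (cong₂ _*_ (^-*-assoc 2 ℤ.∣ D ∣ L) (trans (cong₂ _*_
          (trans (cong (_^ suc H) (^-*-assoc 2 H (2 * L))) (^-*-assoc 2 (H * (2 * L)) (suc H)))
          (trans (cong (_^ π X) (trans (cong (_^ 2) (^-*-assoc 2 i 3)) (^-*-assoc 2 (i * 3) 2)))
              (trans (^-*-assoc 2 (i * 3 * 2) (π X)) (cong (2 ^_) (l i (π X))))))
          (sym (^-distribˡ-+-* 2 (H * (2 * L) * suc H) (6 * (i * π X))))))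
        (sym (^-distribˡ-+-* 2 (ℤ.∣ D ∣ * L) _))
        where l : ∀ i p → i * 3 * 2 * p ≡ 6 * (i * p)
              l = solve-∀
      -- 144 is 6 · 6 · 2 · 2: Z² is the sixth power of 2ⁱ, Chebyshev's constant is 6, and 2ⁱ ≤ 2 M
      -- n and n ≤ 2 w L lose a factor 2 each. The added `L` matches the summand 1 that makes `rate`
      -- positive.
      expo-≤ : ℤ.∣ D ∣ * L + (H * (2 * L) * suc H + 6 * (i * π X)) ≤ rate w M * L
      expo-≤ = begin
        ℤ.∣ D ∣ * L + (H * (2 * L) * suc H + 6 * (i * π X)) ≤⟨ +-monoʳ-≤ (ℤ.∣ D ∣ * L)
            (+-monoʳ-≤ (H * (2 * L) * suc H) (*-monoʳ-≤ 6 π≤)) ⟩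
        ℤ.∣ D ∣ * L + (H * (2 * L) * suc H + 6 * (6 * (2 * (M * (2 * (w * L)))))) ≤⟨ m≤m+n _ L ⟩
        ℤ.∣ D ∣ * L + (H * (2 * L) * suc H + 6 * (6 * (2 * (M * (2 * (w * L)))))) + L ≡⟨ l ℤ.∣ D ∣ L H M w ⟩
        rate w M * L ∎
        where
          π≤ : i * π X ≤ 6 * (2 * (M * (2 * (w * L))))
          π≤ = ≤-trans (chebyshev j) (*-monoʳ-≤ 6 (≤-trans hi (*-monoʳ-≤ 2 (*-monoʳ-≤ M n≤))))
          l : ∀ d L h M w → d * L + (h * (2 * L) * (1 + h) + 6 * (6 * (2 * (M * (2 * (w * L)))))) + L ≡
              (d + h * 2 * (1 + h) + 144 * (M * w) + 1) * L
          l = solve-∀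

  -- For long windows `badPart-≤` contradicts `badPart-large`. The statement refutes smoothness
  -- instead of exhibiting a prime; its application proves smoothness by contradicting every larger
  -- prime divisor.
  large-prime : ∀ w M .{{_ : NonZero w}} → 3 ≤ w → 1 ≤ M → ∃ λ N → ∀ n → N ≤ n →
    ¬ (∀ i → i < n / w → ∀ p → Prime p → p ∣ ℤ.∣ q (ℤ.+ (n ∸ n / w + i)) ∣ → p ≤ M * n)
  large-prime w M hw hM = from (badPart-large (rate w M) (m≤n+m 1 _))
    where
      from : (∃ λ L₀ → ∀ L → L₀ ≤ L → ¬ badPart (L !) ≤ 2 ^ (rate w M * L)) → ∃ λ N → ∀ n → N ≤ n →
        ¬ (∀ i → i < n / w → ∀ p → Prime p → p ∣ ℤ.∣ q (ℤ.+ (n ∸ n / w + i)) ∣ → p ≤ M * n)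
      from (L₀ , large) = N , λ n N≤n smooth → contra n N≤n smooth
        where
          L₁ N : ℕ
          L₁ = L₀ + (suc (2 * β) + (ℤ.∣ D ∣ + 3))
          N = L₁ * w
          contra : ∀ n → N ≤ n → ¬ (∀ i → i < n / w → ∀ p → Prime p → p ∣ ℤ.∣ q (ℤ.+ (n ∸ n / w + i)) ∣ → p ≤ M * n)
          contra n N≤n smooth = go (power-of-2-bracket (M * n) (*-≥1 hM (≤-trans 1≤L L≤n)))
            where
              L = n / w
              L₁≤ : L₁ ≤ L
              L₁≤ = ≤-trans (≤-reflexive (sym (m*n/n≡m L₁ w))) (/-monoˡ-≤ w N≤n)
              rest : suc (2 * β) + (ℤ.∣ D ∣ + 3) ≤ L
              rest = ≤-trans (m≤n+m _ L₀) L₁≤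
              hβ : suc (2 * β) ≤ L
              hβ = ≤-trans (m≤m+n (suc (2 * β)) _) rest
              hD : ℤ.∣ D ∣ ≤ L
              hD = ≤-trans (≤-trans (m≤m+n ℤ.∣ D ∣ 3) (m≤n+m _ (suc (2 * β)))) rest
              3≤L : 3 ≤ L
              3≤L = ≤-trans (≤-trans (m≤n+m 3 ℤ.∣ D ∣) (m≤n+m _ (suc (2 * β)))) rest
              1≤L : 1 ≤ L
              1≤L = ≤-trans (s≤s z≤n) hβ
              wL≤n : w * L ≤ n
              wL≤n = ≤-trans (≤-reflexive (*-comm w L)) (m/n*n≤m n w)
              3L≤n : 3 * L ≤ n
              3L≤n = ≤-trans (*-monoˡ-≤ L hw) wL≤n
              L≤n : L ≤ n
              L≤n = m/n≤m n w
              n≤ : n ≤ 2 * (w * L)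
              n≤ = begin
                n                  ≡⟨ m≡m%n+[m/n]*n n w ⟩
                n % w + L * w      ≤⟨ +-mono-≤ (<⇒≤ (m%n<n n w)) (≤-reflexive (*-comm L w)) ⟩
                w + w * L          ≤⟨ +-monoˡ-≤ (w * L) (m≤m*n w L {{≥1⇒≢0 1≤L}}) ⟩
                w * L + w * L      ≡⟨ cong (w * L +_) (+-identityʳ (w * L)) ⟨
                2 * (w * L)        ∎
                where open ≤-Reasoning
              big : ∀ {i} → M * n ≤ 2 ^ i → 3 ≤ 2 ^ i
              big lo = ≤-trans (≤-trans 3≤L L≤n) (≤-trans (m≤n*m n M {{≥1⇒≢0 hM}}) lo)
              go : (∃ λ i → M * n ≤ 2 ^ i × 2 ^ i ≤ 2 * (M * n)) → _
              -- Chebyshev's bound starts at the exponent 2; `M * n ≥ 3` rules out the two smaller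
              -- ones.
              go (zero , lo , hi) with s≤s () ← big {0} lo
              go (suc zero , lo , hi) with s≤s (s≤s ()) ← big {1} lo
              go (suc (suc j) , lo , hi) = large L (≤-trans (m≤m+n L₀ _) L₁≤)
                (badPart-≤ {w} {M} {n} {L} {j} hM n≤ 1≤L 3L≤n hβ hD lo hi smooth)

-- Monic integer quadratics, their products over 1, ..., n, and telescoping.

module Quad where

  open Factor using (prime≥2)
  open IntDiv
  open QuadBounds using (∣q∣-pos; β)
  open import Data.Nat.Primality using (prime[2])
  open import Data.Integer hiding (suc; pred; _<_; _≤_; _<?_; _≤?_)
  open import Data.Integer.Properties hiding (_≤?_; _<?_)
  open import Data.Integer.Divisibility.Signed renaming (_∣_ to _∥_; _∣?_ to _∥?_)
  open import Data.Integer.Tactic.RingSolver using (solve-∀)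
  open import Data.List using (map; _++_)
  open import Data.List.Relation.Unary.All.Properties using () renaming (++⁺ to All++⁺)
  open import Data.List.Membership.Propositional.Properties using (∈-∃++; ∈-++⁺ˡ; ∈-++⁺ʳ; ∈-++⁻)
  open import Data.List.Relation.Binary.Permutation.Propositional using (_↭_; ↭-trans; ↭-sym; ↭-reflexive; prep)
      renaming (refl to ↭refl; swap to ↭swap; trans to ↭trans)
  open import Data.List.Relation.Binary.Permutation.Propositional.Properties using (shift; ++⁺ˡ)

  -- (b , c) stands for x² + b x + c.
  Quad : Set
  Quad = ℤ × ℤ

  _at_ : Quad → ℤ → ℤ
  (b , c) at x = x * x + b * x + c

  disc : Quad → ℤ
  disc (b , c) = b * b - + 4 * c

  size : Quad → ℕ
  size (b , c) = β b c

  infix 7.5 _at_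

  at≢0 : ∀ q {n} → size q ℕ.< n → q at + n ≢ 0ℤ
  at≢0 (b , c) {n} h e = ℕ.<⇒≱ (∣q∣-pos b c {n} h) (ℕ.≤-reflexive (cong ∣_∣ e))

  4*at : ∀ q x → + 4 * q at x ≡ (+ 2 * x + proj₁ q) * (+ 2 * x + proj₁ q) - disc q
  4*at (b , c) x = lem b c x
    where lem : ∀ b c x → + 4 * (x * x + b * x + c) ≡ (+ 2 * x + b) * (+ 2 * x + b) - (b * b - + 4 * c)
          lem = solve-∀

  values : List Quad → ℤ → ℤ
  values []      x = 1ℤ
  values (q ∷ F) x = q at x * values F x

  rising : Quad → ℕ → ℤ
  rising q zero    = 1ℤ
  rising q (suc n) = rising q n * q at + suc n

  risings : List Quad → ℕ → ℤ
  risings []      n = 1ℤ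
  risings (q ∷ F) n = rising q n * risings F n

  risings-suc : ∀ F n → risings F (suc n) ≡ risings F n * values F (+ suc n)
  risings-suc []      n = refl
  risings-suc (q ∷ F) n = trans (cong (rising q n * q at + suc n *_) (risings-suc F n))
      (lem (rising q n) (q at + suc n) (risings F n) (values F (+ suc n)))
    where lem : ∀ a b c d → a * b * (c * d) ≡ (a * c) * (b * d)
          lem = solve-∀

  values-++ : ∀ F G x → values (F ++ G) x ≡ values F x * values G x
  values-++ []      G x = sym (*-identityˡ _)
  values-++ (q ∷ F) G x = trans (cong (q at x *_) (values-++ F G x)) (sym (*-assoc (q at x) _ _))

  risings-++ : ∀ F G n → risings (F ++ G) n ≡ risings F n * risings G n
  risings-++ []      G n = sym (*-identityˡ _)
  risings-++ (q ∷ F) G n = trans (cong (rising q n *_) (risings-++ F G n)) (sym (*-assoc (rising q n) _ _))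

  risings-↭ : ∀ {F G} n → F ↭ G → risings F n ≡ risings G n
  risings-↭ n ↭refl         = refl
  risings-↭ n (prep q r)    = cong (rising q n *_) (risings-↭ n r)
  risings-↭ n (↭swap {xs} {ys} p q r) = trans (lem (rising p n) (rising q n) (risings xs n))
      (cong (λ z → rising q n * (rising p n * z)) (risings-↭ n r))
    where lem : ∀ a b c → a * (b * c) ≡ b * (a * c)
          lem = solve-∀
  risings-↭ n (↭trans r s)  = trans (risings-↭ n r) (risings-↭ n s)

  values≢0 : ∀ F {x} → All (λ q → q at x ≢ 0ℤ) F → values F x ≢ 0ℤ
  values≢0 []      []       ()
  values≢0 (q ∷ F) (h ∷ hs) = *-≢0 h (values≢0 F hs)

  values≢0⁻ : ∀ F {x} → values F x ≢ 0ℤ → All (λ q → q at x ≢ 0ℤ) F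
  values≢0⁻ []      h = []
  values≢0⁻ (q ∷ F) {x} h = (λ e → h (cong (_* values F x) e)) ∷ values≢0⁻ F
      (λ e → h (trans (cong (q at x *_) e) (*-zeroʳ (q at x))))

  rising≢0 : ∀ q n → (∀ k → 1 ℕ.≤ k → k ℕ.≤ n → q at + k ≢ 0ℤ) → rising q n ≢ 0ℤ
  rising≢0 q zero    h ()
  rising≢0 q (suc n) h = *-≢0 (rising≢0 q n (λ k a b → h k a (ℕ.m≤n⇒m≤1+n b))) (h (suc n) (s≤s z≤n) ℕ.≤-refl)

  NonVanishing : ℕ → Quad → Set
  NonVanishing n q = ∀ k → 1 ℕ.≤ k → k ℕ.≤ n → q at + k ≢ 0ℤ

  risings≢0 : ∀ F n → All (NonVanishing n) F → risings F n ≢ 0ℤ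
  risings≢0 []      n []       ()
  risings≢0 (q ∷ F) n (h ∷ hs) = *-≢0 (rising≢0 q n h) (risings≢0 F n hs)

  prime-∣values : ∀ {p} F x → Prime p → + p ∥ values F x → ∃ λ q → q ∈ F × + p ∥ q at x
  prime-∣values []      x pp d with () ← ∣-small⇒0 1ℤ d (prime≥2 pp)
  prime-∣values (q ∷ F) x pp d with prime-∣* (q at x) (values F x) pp d
  ... | inj₁ e = q , here refl , e
  ... | inj₂ e with prime-∣values F x pp e
  ...   | q′ , q∈ , e′ = q′ , there q∈ , e′

  prime-∣rising : ∀ {p} q n → Prime p → + p ∥ rising q n → ∃ λ k → 1 ℕ.≤ k × k ℕ.≤ n × + p ∥ q at + k
  prime-∣rising q zero pp d with () ← ∣-small⇒0 1ℤ d (prime≥2 pp)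
  prime-∣rising q (suc n) pp d with prime-∣* (rising q n) (q at + suc n) pp d
  ... | inj₂ e = suc n , s≤s z≤n , ℕ.≤-refl , e
  ... | inj₁ e with prime-∣rising q n pp e
  ...   | k , a , b , e′ = k , a , ℕ.m≤n⇒m≤1+n b , e′

  prime-∣risings : ∀ {p} F n → Prime p → + p ∥ risings F n → ∃₂ λ q k → q ∈ F × 1 ℕ.≤ k × k ℕ.≤ n × + p ∥ q at + k
  prime-∣risings []      n pp d with () ← ∣-small⇒0 1ℤ d (prime≥2 pp)
  prime-∣risings (q ∷ F) n pp d with prime-∣* (rising q n) (risings F n) pp d
  ... | inj₁ e with prime-∣rising q n pp e
  ...   | k , a , b , e′ = q , k , here refl , a , b , e′
  prime-∣risings (q ∷ F) n pp d | inj₂ e with prime-∣risings F n pp e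
  ... | q′ , k , q∈ , a , b , e′ = q′ , k , there q∈ , a , b , e′

  at∣rising : ∀ q {k} n → 1 ℕ.≤ k → k ℕ.≤ n → q at + k ∥ rising q n
  at∣rising q zero    hk h with () ← ℕ.≤-trans hk h
  at∣rising q {k} (suc n) hk h with ℕ.m≤n⇒m<n∨m≡n h
  ... | inj₁ lt   = ∣m⇒∣m*n (q at + suc n) (at∣rising q n hk (ℕ.s≤s⁻¹ lt))
  ... | inj₂ refl = ∣n⇒∣m*n (rising q n) ∣-refl

  at∣risings : ∀ {q F k} n → q ∈ F → 1 ℕ.≤ k → k ℕ.≤ n → q at + k ∥ risings F n
  at∣risings {F = q ∷ F} n (here refl) hk h = ∣m⇒∣m*n (risings F n) (at∣rising q n hk h)
  at∣risings {F = q ∷ F} n (there q∈)  hk h = ∣n⇒∣m*n (rising q n) (at∣risings n q∈ hk h)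

  translate : Quad → ℤ → Quad
  translate (b , c) s = b + + 2 * s , c + b * s + s * s

  translate-at : ∀ q s x → translate q s at x ≡ q at (s + x)
  translate-at (b , c) s x = lem b c s x
    where lem : ∀ b c s x → x * x + (b + + 2 * s) * x + (c + b * s + s * s) ≡ (s + x) * (s + x) + b * (s + x) + c
          lem = solve-∀

  translate-disc : ∀ q s → disc (translate q s) ≡ disc q
  translate-disc (b , c) s = lem b c s
    where lem : ∀ b c s → (b + + 2 * s) * (b + + 2 * s) - + 4 * (c + b * s + s * s) ≡ b * b - + 4 * c
          lem = solve-∀

  -- (b′ - b)(b′ + b) = 4 (c′ - c) makes b′ - b even. Half of it is the shift, and equality of the
  -- discriminants then fixes c′.
  same-disc⇒translate : ∀ q q′ → disc q ≡ disc q′ → ∃ λ s → q′ ≡ translate q s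
  same-disc⇒translate (b , c) (b′ , c′) e = go even
    where
      l₁ : ∀ b c b′ c′ → (b′ - b) * (b′ + b) ≡ (b′ * b′ - + 4 * c′ - (b * b - + 4 * c)) + (c′ - c) * + 2 * + 2
      l₁ = solve-∀
      prod : (b′ - b) * (b′ + b) ≡ (c′ - c) * + 2 * + 2
      prod = trans (l₁ b c b′ c′) (trans (cong (λ z → z + (c′ - c) * + 2 * + 2) (i≡j⇒i-j≡0 (sym e))) (+-identityˡ _))
      even : + 2 ∥ b′ - b
      even with prime-∣* (b′ - b) (b′ + b) prime[2] (divides ((c′ - c) * + 2) prod)
      ... | inj₁ d = d
      ... | inj₂ d = subst (+ 2 ∥_) (l₂ b b′) (∣m∣n⇒∣m-n d (divides b refl))
        where l₂ : ∀ b b′ → b′ + b - b * + 2 ≡ b′ - b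
              l₂ = solve-∀
      go : + 2 ∥ b′ - b → ∃ λ s → (b′ , c′) ≡ translate (b , c) s
      go (divides s eq) = s , cong₂ _,_ eb ec
        where
          eb : b′ ≡ b + + 2 * s
          eb = trans (l₃ b b′) (trans (cong (λ z → b + z) eq) (cong (λ z → b + z) (*-comm s (+ 2))))
            where l₃ : ∀ b b′ → b′ ≡ b + (b′ - b)
                  l₃ = solve-∀
          ec : c′ ≡ c + b * s + s * s
          ec = *-cancelˡ-≡ (+ 4) c′ (c + b * s + s * s)
              (trans (l₄ b′ c′) (trans (cong₂ (λ x y → x * x - y) eb (sym e)) (l₅ b c s)))
            where l₄ : ∀ b′ c′ → + 4 * c′ ≡ b′ * b′ - (b′ * b′ - + 4 * c′)
                  l₄ = solve-∀
                  l₅ : ∀ b c s → (b + + 2 * s) * (b + + 2 * s) - (b * b - + 4 * c) ≡ + 4 * (c + b * s + s * s)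
                  l₅ = solve-∀

  translates : Quad → ℕ → List Quad
  translates q zero    = []
  translates q (suc s) = translate q (+ suc s) ∷ translates q s

  translates-disc : ∀ {P : ℤ → Set} q s → P (disc q) → All (λ h → P (disc h)) (translates q s)
  translates-disc {P} q zero    h = []
  translates-disc {P} q (suc s) h = subst P (sym (translate-disc q (+ suc s))) h ∷ translates-disc {P} q s h

  -- Both sides are `rising q (s + n)`, split after `s` and after `n` factors. Up to the constant
  -- `rising q s`, the two rising products thus differ by a polynomial in n.
  telescope : ∀ q s n → rising (translate q (+ s)) n * rising q s ≡ rising q n * values (translates q s) (+ n)
  telescope q s n = trans (trans (*-comm (rising (translate q (+ s)) n) (rising q s)) (sym (left n)))
      (trans (cong (rising q) (ℕ.+-comm s n)) (right s))
    where
      left : ∀ n → rising q (s ℕ.+ n) ≡ rising q s * rising (translate q (+ s)) n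
      left zero    = trans (cong (rising q) (ℕ.+-identityʳ s)) (sym (*-identityʳ _))
      left (suc n) = trans (cong (rising q) (ℕ.+-suc s n))
          (trans (cong₂ _*_ (left n) (trans (cong (λ z → q at + z) (sym (ℕ.+-suc s n)))
          (sym (translate-at q (+ s) (+ suc n)))))
        (*-assoc (rising q s) _ _))
      right : ∀ s → rising q (n ℕ.+ s) ≡ rising q n * values (translates q s) (+ n)
      right zero    = trans (cong (rising q) (ℕ.+-identityʳ n)) (sym (*-identityʳ _))
      right (suc s) = trans (cong (rising q) (ℕ.+-suc n s))
          (trans (cong₂ _*_ (right s) (trans (cong (λ z → q at + z) (trans (sym (ℕ.+-suc n s)) (ℕ.+-comm n (suc s))))
          (sym (translate-at q (+ suc s) (+ n)))))
        (lem (rising q n) _ _))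
        where lem : ∀ a b c → a * b * c ≡ a * (c * b)
              lem = solve-∀

  -- `κ` may be a rising product from `F`, so it is nonzero only when `F` has no positive integer
  -- zeros; `λ′` may be one from `G` and can be 0, a case treated separately at the end. `P` carries
  -- the square class of the discriminants over to `A` and `B`.
  record Ratio (P : ℤ → Set) (F G : List Quad) : Set where
    field
      κ λ′   : ℤ
      A B    : List Quad
      A-disc : All (λ h → P (disc h)) A
      B-disc : All (λ h → P (disc h)) B
      κ≢0    : (∀ n → All (NonVanishing n) F) → κ ≢ 0ℤ
      ratio  : ∀ n → risings G n * (κ * values A (+ n)) ≡ risings F n * (λ′ * values B (+ n))

  -- The sign of the shift decides on which side the extra factors stand: for a negative shift `q`
  -- is a translate of `q′`, and the two exchange roles.
  pair-ratio : ∀ {P : ℤ → Set} q q′ → disc q ≡ disc q′ → P (disc q) → P (disc q′) → Ratio P (q ∷ []) (q′ ∷ [])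
  pair-ratio {P} q q′ e pq pq′ = go (same-disc⇒translate q q′ e)
    where
      lem : ∀ r κ → r * 1ℤ * (κ * 1ℤ) ≡ r * κ
      lem = solve-∀
      lem′ : ∀ h v → h * v ≡ h * 1ℤ * (1ℤ * v)
      lem′ = solve-∀
      go : (∃ λ s → q′ ≡ translate q s) → Ratio P (q ∷ []) (q′ ∷ [])
      go (+ s , refl) = record
        { κ = rising q s ; λ′ = 1ℤ ; A = [] ; B = translates q s ; A-disc = [] ; B-disc = translates-disc {P} q s pq
        ; κ≢0 = λ h → rising≢0 q s (All.head (h s))
        ; ratio = λ n → trans (lem (rising (translate q (+ s)) n) (rising q s))
            (trans (telescope q s n) (lem′ (rising q n) _)) }
      go (-[1+ s ] , eq) = record
        { κ = 1ℤ ; λ′ = rising q′ (suc s) ; A = translates q′ (suc s) ; B = [] ; A-disc = translates-disc {P} q′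
            (suc s) pq′ ; B-disc = []
        ; κ≢0 = λ h ()
        ; ratio = λ n → trans (sym (lem′ (rising q′ n) _)) (trans (sym (telescope q′ (suc s) n))
            (trans (cong (λ z → rising z n * rising q′ (suc s)) back) (sym (lem (rising q n) (rising q′ (suc s)))))) }
        where
          back : translate q′ (+ suc s) ≡ q
          back = trans (cong (λ z → translate z (+ suc s)) eq)
              (cong₂ _,_ (l₁ (proj₁ q) (+ suc s)) (l₂ (proj₁ q) (proj₂ q) (+ suc s)))
            where
              l₁ : ∀ b s → b + + 2 * (- s) + + 2 * s ≡ b
              l₁ = solve-∀
              l₂ : ∀ b c s → c + b * (- s) + (- s) * (- s) + (b + + 2 * (- s)) * s + s * s ≡ c
              l₂ = solve-∀

  ratio-∷ : ∀ {P q q′ F G} → Ratio P (q ∷ []) (q′ ∷ []) → Ratio P F G → Ratio P (q ∷ F) (q′ ∷ G)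
  ratio-∷ {P} {q} {q′} {F} {G} R S = record
    { κ = R.κ * S.κ ; λ′ = R.λ′ * S.λ′ ; A = R.A ++ S.A ; B = R.B ++ S.B
    ; A-disc = All++⁺ R.A-disc S.A-disc ; B-disc = All++⁺ R.B-disc S.B-disc
    ; κ≢0 = λ h → *-≢0 (R.κ≢0 (λ n → All.head (h n) ∷ [])) (S.κ≢0 (λ n → All.tail (h n)))
    ; ratio = λ n → trans (cong (λ z → rising q′ n * risings G n * (R.κ * S.κ * z)) (values-++ R.A S.A (+ n)))
        (trans (l₁ (rising q′ n) (risings G n) R.κ S.κ (values R.A (+ n)) (values S.A (+ n)))
        (trans (cong₂ _*_ (R.ratio n) (S.ratio n))
        (trans (l₂ (rising q n) (risings F n) R.λ′ S.λ′ (values R.B (+ n)) (values S.B (+ n)))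
          (cong (λ z → rising q n * risings F n * (R.λ′ * S.λ′ * z)) (sym (values-++ R.B S.B (+ n))))))) }
    where
      module R = Ratio R
      module S = Ratio S
      l₁ : ∀ r g k k′ a a′ → r * g * (k * k′ * (a * a′)) ≡ (r * 1ℤ * (k * a)) * (g * (k′ * a′))
      l₁ = solve-∀
      l₂ : ∀ r g k k′ a a′ → (r * 1ℤ * (k * a)) * (g * (k′ * a′)) ≡ r * g * (k * k′ * (a * a′))
      l₂ = solve-∀

  list-ratio : ∀ {P : ℤ → Set} (ps : List (Quad × Quad)) → All
      (λ (q , q′) → disc q ≡ disc q′ × P (disc q) × P (disc q′)) ps → Ratio P (map proj₁ ps) (map proj₂ ps)
  list-ratio []               []                  = record
      { κ = 1ℤ ; λ′ = 1ℤ ; A = [] ; B = [] ; A-disc = [] ; B-disc = [] ; κ≢0 = λ _ () ; ratio = λ n → refl }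
  list-ratio ((q , q′) ∷ ps) ((e , pq , pq′) ∷ a) = ratio-∷ (pair-ratio q q′ e pq pq′) (list-ratio ps a)

  record Matching (F G : List Quad) : Set where
    field
      pairs    : List (Quad × Quad)
      F′ G′    : List Quad
      F↭       : F ↭ map proj₁ pairs ++ F′
      G↭       : G ↭ map proj₂ pairs ++ G′
      matched  : All (λ (q , q′) → disc q ≡ disc q′) pairs
      disjoint : ∀ {q q′} → q ∈ F′ → q′ ∈ G′ → disc q ≢ disc q′

  matching : ∀ F G → Matching F G
  matching []      G = record { pairs = [] ; F′ = [] ; G′ = G ; F↭ = ↭refl ; G↭ = ↭refl ; matched = [] ; disjoint =
      λ () }
  matching (q ∷ F) G = extend (matching F G)
    where
      open import Data.List.Relation.Unary.Any using (any?; Any)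
      open import Data.List.Membership.Propositional using (find; lose)
      extend : Matching F G → Matching (q ∷ F) G
      extend M = go (any? (λ q′ → disc q ≟ disc q′) M.G′)
        where
          module M = Matching M
          use : (∃ λ q′ → q′ ∈ M.G′ × disc q ≡ disc q′) → Matching (q ∷ F) G
          use (q′ , q′∈ , e) = split (∈-∃++ q′∈)
            where
              split : (∃₂ λ ys zs → M.G′ ≡ ys ++ q′ ∷ zs) → Matching (q ∷ F) G
              split (ys , zs , eq) = record
                { pairs = (q , q′) ∷ M.pairs ; F′ = M.F′ ; G′ = ys ++ zs
                ; F↭ = prep q M.F↭
                ; G↭ = ↭-trans M.G↭ (↭-trans (++⁺ˡ (map proj₂ M.pairs) (↭-trans (↭-reflexive eq) (shift q′ ys zs)))
                    (shift q′ (map proj₂ M.pairs) (ys ++ zs)))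
                ; matched = e ∷ M.matched
                ; disjoint = λ p r → M.disjoint p (subst (_ ∈_) (sym eq) (weaken r)) }
                where
                  weaken : ∀ {x} → x ∈ ys ++ zs → x ∈ ys ++ q′ ∷ zs
                  weaken r with ∈-++⁻ ys r
                  ... | inj₁ a = ∈-++⁺ˡ a
                  ... | inj₂ a = ∈-++⁺ʳ ys (there a)
          go : Dec (Any (λ q′ → disc q ≡ disc q′) M.G′) → Matching (q ∷ F) G
          go (yes a) = use (find a)
          go (no ¬a) = record
            { pairs = M.pairs ; F′ = q ∷ M.F′ ; G′ = M.G′
            ; F↭ = ↭-trans (prep q M.F↭) (↭-sym (shift q (map proj₁ M.pairs) M.F′))
            ; G↭ = M.G↭ ; matched = M.matched
            ; disjoint = λ { (here refl) r e → ¬a (lose r e) ; (there p) r → M.disjoint p r } }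

-- Excluding large hits by a large prime that divides one side only.

module PrimeCase where

  open Factor
  open IntDiv
  open Quad
  open import Data.Integer hiding (suc; pred; _<_; _≤_; _<?_; _≤?_)
  open import Data.Integer.Properties hiding (_≤?_; _<?_)
  open import Data.Integer.Divisibility.Signed renaming (_∣_ to _∥_; _∣?_ to _∥?_)
  open import Data.Integer.Tactic.RingSolver using (solve-∀)
  open import Data.Nat.Tactic.RingSolver using () renaming (solve-∀ to solve-∀ₙ)

  IsSquare : ℤ → Set
  IsSquare z = ∃ λ e → e * e ≡ z

  abs-cong-sq : ∀ {D D′ x y} → D * (y * y) ≡ D′ * (x * x) → ∣ D ∣ ℕ.* (∣ y ∣ ℕ.* ∣ y ∣) ≡ ∣ D′ ∣ ℕ.* (∣ x ∣ ℕ.* ∣ x ∣)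
  abs-cong-sq {D} {D′} {x} {y} e = trans (sym (ab D y)) (trans (cong ∣_∣ e) (ab D′ x))
    where ab : ∀ D y → ∣ D * (y * y) ∣ ≡ ∣ D ∣ ℕ.* (∣ y ∣ ℕ.* ∣ y ∣)
          ab D y = trans (abs-* D (y * y)) (cong (∣ D ∣ ℕ.*_) (abs-* y y))

  slope : Quad → ℤ → ℤ
  slope (b , _) x = + 2 * x + b

  -- Square roots of D and D′ modulo p have ratio e / D with e² = D D′, so
  -- D y ≡ ± e x (mod p); when p is large, this congruence is an equality.
  rigidity : ∀ {p} q q′ k l → Prime p → disc q ≢ 0ℤ → (s : IsSquare (disc q * disc q′)) → + p ∥ q at k → + p ∥ q′ at l
      →
    ∣ disc q ∣ ℕ.* ∣ slope q′ l ∣ ℕ.+ ∣ proj₁ s ∣ ℕ.* ∣ slope q k ∣ ℕ.< p →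
    disc q * (slope q′ l * slope q′ l) ≡ disc q′ * (slope q k * slope q k)
  rigidity {p} q q′ k l pp D≢0 (e , ee) dk dl lt = *-cancelˡ-≡ D _ _ {{≢-nonZero D≢0}}
      (finish (prime-∣* (D * y - e * x) (D * y + e * x) pp dprod))
    where
      D = disc q
      D′ = disc q′
      x = slope q k
      y = slope q′ l
      l₁ : ∀ D D′ x y e A B → e * e ≡ D * D′ → A ≡ x * x - D → B ≡ y * y - D′ → D * D * B - D * D′ * A ≡
          (D * y - e * x) * (D * y + e * x)
      l₁ D D′ x y e A B ee refl refl = trans (l₂ D D′ x y)
          (trans (cong (λ z → D * y * (D * y) - z * (x * x)) (sym ee)) (l₃ D x y e))
        where
          l₂ : ∀ D D′ x y → D * D * (y * y - D′) - D * D′ * (x * x - D) ≡ D * y * (D * y) - D * D′ * (x * x)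
          l₂ = solve-∀
          l₃ : ∀ D x y e → D * y * (D * y) - e * e * (x * x) ≡ (D * y - e * x) * (D * y + e * x)
          l₃ = solve-∀
      dprod : + p ∥ (D * y - e * x) * (D * y + e * x)
      dprod = subst (+ p ∥_) (l₁ D D′ x y e _ _ ee (4*at q k) (4*at q′ l))
          (∣m∣n⇒∣m-n (∣n⇒∣m*n (D * D) (∣n⇒∣m*n (+ 4) dl)) (∣n⇒∣m*n (D * D′) (∣n⇒∣m*n (+ 4) dk)))
      small : ∣ D * y ∣ ℕ.+ ∣ e * x ∣ ℕ.< p
      small = subst₂ (λ u w → u ℕ.+ w ℕ.< p) (sym (abs-* D y)) (sym (abs-* e x)) lt
      fin : D * y * (D * y) ≡ e * x * (e * x) → D * (D * (y * y)) ≡ D * (D′ * (x * x))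
      fin h = trans (l₄ D y) (trans h (trans (l₅ e x) (trans (cong (_* (x * x)) ee) (*-assoc D D′ (x * x)))))
        where
          l₄ : ∀ D y → D * (D * (y * y)) ≡ D * y * (D * y)
          l₄ = solve-∀
          l₅ : ∀ D y → D * y * (D * y) ≡ D * D * (y * y)
          l₅ = solve-∀
      opposite : ∀ u w → u + w ≡ 0ℤ → u * u ≡ w * w
      opposite u w h = trans (l₆ u w) (trans (cong (λ z → z * (u - w) + w * w) h) (+-identityˡ _))
        where l₆ : ∀ u w → u * u ≡ (u + w) * (u - w) + w * w
              l₆ = solve-∀
      finish : + p ∥ D * y - e * x ⊎ + p ∥ D * y + e * x → D * (D * (y * y)) ≡ D * (D′ * (x * x))
      finish (inj₁ d) = fin (cong (λ z → z * z)
          (i-j≡0⇒i≡j (D * y) (e * x) (∣-small⇒0 (D * y - e * x) d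
          (ℕ.≤-<-trans (∣i-j∣≤∣i∣+∣j∣ (D * y) (e * x)) small))))
      finish (inj₂ d) = fin (opposite (D * y) (e * x)
          (∣-small⇒0 (D * y + e * x) d (ℕ.≤-<-trans (∣i+j∣≤∣i∣+∣j∣ (D * y) (e * x)) small)))

  -- Y / X is at most (2m + u) / (2m - u), too close to 1 for √(d′ / d). With r = 2m - u the
  -- equation gives r² ≤ 4 d u (r + u), hence m ≤ (2d + 1) u. Since 9d + 4 exceeds 3 (2d + 1), the
  -- bound (9d + 4) u ≤ 3m leaves only u = 0, and then m = 0.
  gap : ∀ {d d′ X Y m u} → 1 ℕ.≤ m → suc d ℕ.≤ d′ → 2 ℕ.* m ℕ.≤ X ℕ.+ u → Y ℕ.≤ 2 ℕ.* m ℕ.+ u → (9 ℕ.* d ℕ.+ 4) ℕ.* u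
      ℕ.≤ 3 ℕ.* m →
    d ℕ.* (Y ℕ.* Y) ≡ d′ ℕ.* (X ℕ.* X) → ⊥
  gap {d} {d′} {X} {Y} {m} {u} hm hd hX hY hu eq = ℕ.<⇒≱ hm
      (ℕ.≤-trans m≤ (ℕ.≤-reflexive (trans (cong ((2 ℕ.* d ℕ.+ 1) ℕ.*_) u≡0) (ℕ.*-zeroʳ (2 ℕ.* d ℕ.+ 1)))))
    where
      open ℕ.≤-Reasoning
      r = 2 ℕ.* m ℕ.∸ u
      u≤2m : u ℕ.≤ 2 ℕ.* m
      u≤2m = ℕ.*-cancelˡ-≤ 2 (ℕ.≤-trans (ℕ.*-monoˡ-≤ u (ℕ.≤-trans (s≤s (s≤s z≤n)) (ℕ.m≤n+m 4 (9 ℕ.* d))))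
          (ℕ.≤-trans hu (ℕ.≤-trans (ℕ.*-monoˡ-≤ m (ℕ.n≤1+n 3)) (ℕ.≤-reflexive (ℕ.*-assoc 2 2 m)))))
      r+u : r ℕ.+ u ≡ 2 ℕ.* m
      r+u = ℕ.m∸n+n≡m u≤2m
      r≤X : r ℕ.≤ X
      r≤X = ℕ.+-cancelʳ-≤ u r X (ℕ.≤-trans (ℕ.≤-reflexive r+u) hX)
      Y≤ : Y ℕ.≤ r ℕ.+ 2 ℕ.* u
      Y≤ = ℕ.≤-trans hY (ℕ.≤-reflexive (trans (cong (ℕ._+ u) (sym r+u)) (l r u)))
        where l : ∀ r u → r ℕ.+ u ℕ.+ u ≡ r ℕ.+ 2 ℕ.* u
              l = solve-∀ₙ
      rr : r ℕ.* r ℕ.≤ 4 ℕ.* d ℕ.* u ℕ.* (r ℕ.+ u)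
      rr = ℕ.+-cancelˡ-≤ (d ℕ.* (r ℕ.* r)) _ _ (begin
        d ℕ.* (r ℕ.* r) ℕ.+ r ℕ.* r ≡⟨ ℕ.+-comm (d ℕ.* (r ℕ.* r)) (r ℕ.* r) ⟩
        suc d ℕ.* (r ℕ.* r)         ≤⟨ ℕ.*-mono-≤ hd (ℕ.*-mono-≤ r≤X r≤X) ⟩
        d′ ℕ.* (X ℕ.* X)            ≡⟨ eq ⟨
        d ℕ.* (Y ℕ.* Y)             ≤⟨ ℕ.*-monoʳ-≤ d (ℕ.*-mono-≤ Y≤ Y≤) ⟩
        d ℕ.* ((r ℕ.+ 2 ℕ.* u) ℕ.* (r ℕ.+ 2 ℕ.* u)) ≡⟨ l d r u ⟩
        d ℕ.* (r ℕ.* r) ℕ.+ 4 ℕ.* d ℕ.* u ℕ.* (r ℕ.+ u) ∎)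
        where l : ∀ d r u → d ℕ.* ((r ℕ.+ 2 ℕ.* u) ℕ.* (r ℕ.+ 2 ℕ.* u)) ≡ d ℕ.* (r ℕ.* r) ℕ.+ 4 ℕ.* d ℕ.* u ℕ.*
                  (r ℕ.+ u)
              l = solve-∀ₙ
      m≤ : m ℕ.≤ (2 ℕ.* d ℕ.+ 1) ℕ.* u
      m≤ = ℕ.*-cancelˡ-≤ (4 ℕ.* m) {{≥1⇒≢0 (*-≥1 {4} (s≤s z≤n) hm)}} (begin
        4 ℕ.* m ℕ.* m                         ≡⟨ l₁ m ⟩
        (2 ℕ.* m) ℕ.* (2 ℕ.* m)               ≡⟨ cong (λ z → z ℕ.* z) r+u ⟨
        (r ℕ.+ u) ℕ.* (r ℕ.+ u)               ≤⟨ ℕ.m≤m+n _ (u ℕ.* u) ⟩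
        (r ℕ.+ u) ℕ.* (r ℕ.+ u) ℕ.+ u ℕ.* u   ≡⟨ l₂ r u ⟩
        r ℕ.* r ℕ.+ 2 ℕ.* u ℕ.* (r ℕ.+ u)     ≤⟨ ℕ.+-monoˡ-≤ _ rr ⟩
        4 ℕ.* d ℕ.* u ℕ.* (r ℕ.+ u) ℕ.+ 2 ℕ.* u ℕ.* (r ℕ.+ u) ≡⟨ cong (λ z → 4 ℕ.* d ℕ.* u ℕ.* z ℕ.+ 2 ℕ.* u ℕ.* z)
            r+u ⟩
        4 ℕ.* d ℕ.* u ℕ.* (2 ℕ.* m) ℕ.+ 2 ℕ.* u ℕ.* (2 ℕ.* m) ≡⟨ l₃ d u m ⟩
        4 ℕ.* m ℕ.* ((2 ℕ.* d ℕ.+ 1) ℕ.* u)   ∎)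
        where
          l₁ : ∀ m → 4 ℕ.* m ℕ.* m ≡ (2 ℕ.* m) ℕ.* (2 ℕ.* m)
          l₁ = solve-∀ₙ
          l₂ : ∀ r u → (r ℕ.+ u) ℕ.* (r ℕ.+ u) ℕ.+ u ℕ.* u ≡ r ℕ.* r ℕ.+ 2 ℕ.* u ℕ.* (r ℕ.+ u)
          l₂ = solve-∀ₙ
          l₃ : ∀ d u m → 4 ℕ.* d ℕ.* u ℕ.* (2 ℕ.* m) ℕ.+ 2 ℕ.* u ℕ.* (2 ℕ.* m) ≡ 4 ℕ.* m ℕ.* ((2 ℕ.* d ℕ.+ 1) ℕ.* u)
          l₃ = solve-∀ₙ
      u≡0 : u ≡ 0
      u≡0 = ℕ.n≤0⇒n≡0 (ℕ.+-cancelˡ-≤ ((6 ℕ.* d ℕ.+ 3) ℕ.* u) _ _ (begin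
        (6 ℕ.* d ℕ.+ 3) ℕ.* u ℕ.+ u           ≤⟨ ℕ.m≤m+n _ (3 ℕ.* d ℕ.* u) ⟩
        (6 ℕ.* d ℕ.+ 3) ℕ.* u ℕ.+ u ℕ.+ 3 ℕ.* d ℕ.* u ≡⟨ l₁ d u ⟩
        (9 ℕ.* d ℕ.+ 4) ℕ.* u                 ≤⟨ hu ⟩
        3 ℕ.* m                               ≤⟨ ℕ.*-monoʳ-≤ 3 m≤ ⟩
        3 ℕ.* ((2 ℕ.* d ℕ.+ 1) ℕ.* u)         ≡⟨ l₂ d u ⟩
        (6 ℕ.* d ℕ.+ 3) ℕ.* u ℕ.+ 0           ∎))
        where
          l₁ : ∀ d u → (6 ℕ.* d ℕ.+ 3) ℕ.* u ℕ.+ u ℕ.+ 3 ℕ.* d ℕ.* u ≡ (9 ℕ.* d ℕ.+ 4) ℕ.* u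
          l₁ = solve-∀ₙ
          l₂ : ∀ d u → 3 ℕ.* ((2 ℕ.* d ℕ.+ 1) ℕ.* u) ≡ (6 ℕ.* d ℕ.+ 3) ℕ.* u ℕ.+ 0
          l₂ = solve-∀ₙ

  weight : Quad → ℕ
  weight q = size q ℕ.+ ∣ disc q ∣

  weights : List Quad → ℕ
  weights []      = 0
  weights (q ∷ F) = weight q ℕ.+ weights F

  weight≤weights : ∀ {q F} → q ∈ F → weight q ℕ.≤ weights F
  weight≤weights {q} {_ ∷ F} (here refl) = ℕ.m≤m+n (weight q) (weights F)
  weight≤weights {q} {r ∷ F} (there q∈)  = ℕ.≤-trans (weight≤weights q∈) (ℕ.m≤n+m (weights F) (weight r))

  ∣slope∣≤ : ∀ q n → ∣ slope q (+ n) ∣ ℕ.≤ 2 ℕ.* n ℕ.+ weight q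
  ∣slope∣≤ q@(b , c) n = ℕ.≤-trans (∣i+j∣≤∣i∣+∣j∣ (+ 2 * + n) b)
      (ℕ.+-mono-≤ (ℕ.≤-reflexive (abs-* (+ 2) (+ n))) (ℕ.≤-trans (ℕ.m≤m+n ∣ b ∣ ∣ c ∣) (ℕ.m≤m+n (size q) _)))

  ∣slope∣≥ : ∀ q n → 2 ℕ.* n ℕ.≤ ∣ slope q (+ n) ∣ ℕ.+ weight q
  ∣slope∣≥ q@(b , c) n = ℕ.≤-trans (ℕ.≤-reflexive (trans (sym (abs-* (+ 2) (+ n))) (cong ∣_∣ (l (+ 2 * + n) b))))
    (ℕ.≤-trans (∣i-j∣≤∣i∣+∣j∣ (slope q (+ n)) b)
        (ℕ.+-monoʳ-≤ _ (ℕ.≤-trans (ℕ.m≤m+n ∣ b ∣ ∣ c ∣) (ℕ.m≤m+n (size q) _))))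
    where l : ∀ a b → a ≡ a + b - b
          l = solve-∀

  double-root : ∀ q x → disc q ≡ 0ℤ → slope q x ≡ 0ℤ → q at x ≡ 0ℤ
  double-root q x z s = *-cancelˡ-≡ (+ 4) (q at x) 0ℤ (trans (4*at q x) (cong₂ (λ a b → a * a - b) s z))

  sqrt-bound : ∀ {e a b} → e ℕ.* e ≡ a ℕ.* b → e ℕ.≤ a ℕ.+ b
  sqrt-bound {e} {a} {b} eq with e ℕ.≤? a ℕ.+ b
  ... | yes h = h
  ... | no ¬h = ⊥-elim (ℕ.<⇒≱ (ℕ.*-mono-< (ℕ.≰⇒> ¬h) (ℕ.≰⇒> ¬h))
      (ℕ.≤-trans (ℕ.≤-reflexive eq) (ℕ.*-mono-≤ (ℕ.m≤m+n a b) (ℕ.m≤n+m b a))))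

  -- By rigidity a second value divisible by p satisfies (y / x)² = D′ / D; since k lies slightly
  -- below n, the quotient y / x is too small for this when ∣ D′ ∣ > ∣ D ∣.
  module _ (q₀ : Quad) (B G : List Quad) (W : ℕ) (hq₀ : weight q₀ ℕ.≤ W) (hB : weights B ℕ.≤ W) (hG : weights G ℕ.≤ W)
    (D≢0 : disc q₀ ≢ 0ℤ) (sqB : All (λ q → IsSquare (disc q₀ * disc q)) B)
        (sqG : All (λ q → IsSquare (disc q₀ * disc q)) G)
    (bigG : All (λ q → disc q ≡ 0ℤ ⊎ ∣ disc q₀ ∣ ℕ.< ∣ disc q ∣) G) where

    private
      d = ∣ disc q₀ ∣
      d≥1 : 1 ℕ.≤ d
      d≥1 = ≢0⇒abs≥1 D≢0
      d≤W : d ℕ.≤ W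
      d≤W = ℕ.≤-trans (ℕ.m≤n+m d (size q₀)) hq₀
      W≥1 : 1 ℕ.≤ W
      W≥1 = ℕ.≤-trans d≥1 d≤W

      d*yy≡0⇒ : ∀ y → d ℕ.* (∣ y ∣ ℕ.* ∣ y ∣) ≡ 0 → y ≡ 0ℤ
      d*yy≡0⇒ y h with ℕ.m*n≡0⇒m≡0∨n≡0 d h
      ... | inj₁ e = ⊥-elim (D≢0 (∣i∣≡0⇒i≡0 e))
      ... | inj₂ e with ℕ.m*n≡0⇒m≡0∨n≡0 ∣ y ∣ e
      ...   | inj₁ e′ = ∣i∣≡0⇒i≡0 e′
      ...   | inj₂ e′ = ∣i∣≡0⇒i≡0 e′

    -- `C`: the equation is evaluated at n = m + C while the window ends at m, so slopes at n exceed
    -- those in the window. `M`: slopes are at most 4m and |e| at most 2W, so the quantity that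
    -- `rigidity` wants below `p` is at most 12 W m. `w`: a window of length m / w keeps the error
    -- within the reach of `gap`.
    C M w : ℕ
    C = suc W
    M = 12 ℕ.* W
    w = 9 ℕ.* suc d

    module _ {p k m t : ℕ} (pp : Prime p) (p∣ : + p ∥ q₀ at + k) (k< : k ℕ.< m) (k+t≥ : m ℕ.≤ k ℕ.+ t)
        (wt≤ : w ℕ.* t ℕ.≤ m)
      (big : (9 ℕ.* d ℕ.+ 4) ℕ.* (3 ℕ.* suc W) ℕ.≤ m) (Mm<p : M ℕ.* m ℕ.< p) where

      private
        n = m ℕ.+ C
        x = ∣ slope q₀ (+ k) ∣
        C≤m : 3 ℕ.* C ℕ.≤ m
        C≤m = ℕ.≤-trans (ℕ.m≤n*m (3 ℕ.* suc W) (9 ℕ.* d ℕ.+ 4) {{≥1⇒≢0 (ℕ.≤-trans (s≤s z≤n) (ℕ.m≤n+m 4 (9 ℕ.* d)))}})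
            big
        m≥1 : 1 ℕ.≤ m
        m≥1 = ℕ.≤-trans (s≤s z≤n) k<

        rigid : ∀ q l → weight q ℕ.≤ W → l ℕ.≤ n → IsSquare (disc q₀ * disc q) → + p ∥ q at + l →
          d ℕ.* (∣ slope q (+ l) ∣ ℕ.* ∣ slope q (+ l) ∣) ≡ ∣ disc q ∣ ℕ.* (x ℕ.* x)
        rigid q l hq l≤n s@(e , ee) pd = abs-cong-sq {disc q₀} {disc q} {slope q₀ (+ k)} {slope q (+ l)}
            (rigidity q₀ q (+ k) (+ l) pp D≢0 s p∣ pd (ℕ.≤-<-trans bound Mm<p))
          where
            open ℕ.≤-Reasoning
            linear : ∀ q′ l → weight q′ ℕ.≤ W → l ℕ.≤ n → ∣ slope q′ (+ l) ∣ ℕ.≤ 4 ℕ.* m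
            linear q′ l h l≤n = begin
              ∣ slope q′ (+ l) ∣         ≤⟨ ∣slope∣≤ q′ l ⟩
              2 ℕ.* l ℕ.+ weight q′      ≤⟨ ℕ.+-mono-≤ (ℕ.*-monoʳ-≤ 2 l≤n) (ℕ.≤-trans h (ℕ.n≤1+n W)) ⟩
              2 ℕ.* (m ℕ.+ C) ℕ.+ C      ≡⟨ l₁ m C ⟩
              2 ℕ.* m ℕ.+ 3 ℕ.* C        ≤⟨ ℕ.+-monoʳ-≤ (2 ℕ.* m) (ℕ.≤-trans C≤m (ℕ.m≤n*m m 2)) ⟩
              2 ℕ.* m ℕ.+ 2 ℕ.* m        ≡⟨ l₂ m ⟩
              4 ℕ.* m                    ∎
              where
                l₁ : ∀ m C → 2 ℕ.* (m ℕ.+ C) ℕ.+ C ≡ 2 ℕ.* m ℕ.+ 3 ℕ.* C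
                l₁ = solve-∀ₙ
                l₂ : ∀ m → 2 ℕ.* m ℕ.+ 2 ℕ.* m ≡ 4 ℕ.* m
                l₂ = solve-∀ₙ
            e≤ : ∣ e ∣ ℕ.≤ W ℕ.+ W
            e≤ = ℕ.≤-trans (sqrt-bound {∣ e ∣} {d} {∣ disc q ∣}
                (trans (sym (abs-* e e)) (trans (cong ∣_∣ ee) (abs-* (disc q₀) (disc q)))))
              (ℕ.+-mono-≤ d≤W (ℕ.≤-trans (ℕ.m≤n+m _ (size q)) hq))
            bound : d ℕ.* ∣ slope q (+ l) ∣ ℕ.+ ∣ e ∣ ℕ.* x ℕ.≤ M ℕ.* m
            bound = begin
              d ℕ.* ∣ slope q (+ l) ∣ ℕ.+ ∣ e ∣ ℕ.* x ≤⟨ ℕ.+-mono-≤ (ℕ.*-mono-≤ d≤W (linear q l hq l≤n))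
                  (ℕ.*-mono-≤ e≤ (linear q₀ k hq₀ (ℕ.≤-trans (ℕ.<⇒≤ k<) (ℕ.m≤m+n m C)))) ⟩
              W ℕ.* (4 ℕ.* m) ℕ.+ (W ℕ.+ W) ℕ.* (4 ℕ.* m) ≡⟨ l₁ W m ⟩
              M ℕ.* m ∎
              where l₁ : ∀ W m → W ℕ.* (4 ℕ.* m) ℕ.+ (W ℕ.+ W) ℕ.* (4 ℕ.* m) ≡ 12 ℕ.* W ℕ.* m
                    l₁ = solve-∀ₙ

        larger-disc : ∀ q l → weight q ℕ.≤ W → l ℕ.≤ n → IsSquare (disc q₀ * disc q) → + p ∥ q at + l → d ℕ.< ∣ disc q
            ∣ → ⊥
        larger-disc q l hq l≤n s pd lt = gap {d} {∣ disc q ∣} {x} {∣ slope q (+ l) ∣} {m} {u} m≥1 lt hX hY hu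
            (rigid q l hq l≤n s pd)
          where
            open ℕ.≤-Reasoning
            -- `k` is at most `t` below `m`, costing `2 * t` in the slope; `3 * C` covers twice the
            -- excess of n over m and the weight.
            u = 2 ℕ.* t ℕ.+ 3 ℕ.* C
            hX : 2 ℕ.* m ℕ.≤ x ℕ.+ u
            hX = begin
              2 ℕ.* m                     ≤⟨ ℕ.*-monoʳ-≤ 2 k+t≥ ⟩
              2 ℕ.* (k ℕ.+ t)             ≡⟨ ℕ.*-distribˡ-+ 2 k t ⟩
              2 ℕ.* k ℕ.+ 2 ℕ.* t         ≤⟨ ℕ.+-monoˡ-≤ (2 ℕ.* t) (∣slope∣≥ q₀ k) ⟩
              x ℕ.+ weight q₀ ℕ.+ 2 ℕ.* t ≡⟨ l₁ x (weight q₀) (2 ℕ.* t) ⟩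
              x ℕ.+ (2 ℕ.* t ℕ.+ weight q₀) ≤⟨ ℕ.+-monoʳ-≤ x
                  (ℕ.+-monoʳ-≤ (2 ℕ.* t) (ℕ.≤-trans hq₀ (ℕ.≤-trans (ℕ.n≤1+n W) (ℕ.m≤n*m C 3)))) ⟩
              x ℕ.+ u                     ∎
              where l₁ : ∀ x a b → x ℕ.+ a ℕ.+ b ≡ x ℕ.+ (b ℕ.+ a)
                    l₁ = solve-∀ₙ
            hY : ∣ slope q (+ l) ∣ ℕ.≤ 2 ℕ.* m ℕ.+ u
            hY = begin
              ∣ slope q (+ l) ∣           ≤⟨ ∣slope∣≤ q l ⟩
              2 ℕ.* l ℕ.+ weight q        ≤⟨ ℕ.+-mono-≤ (ℕ.*-monoʳ-≤ 2 l≤n) (ℕ.≤-trans hq (ℕ.n≤1+n W)) ⟩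
              2 ℕ.* (m ℕ.+ C) ℕ.+ C       ≤⟨ ℕ.m≤m+n _ (2 ℕ.* t) ⟩
              2 ℕ.* (m ℕ.+ C) ℕ.+ C ℕ.+ 2 ℕ.* t ≡⟨ l₁ m C t ⟩
              2 ℕ.* m ℕ.+ u               ∎
              where l₁ : ∀ m C t → 2 ℕ.* (m ℕ.+ C) ℕ.+ C ℕ.+ 2 ℕ.* t ≡ 2 ℕ.* m ℕ.+ (2 ℕ.* t ℕ.+ 3 ℕ.* C)
                    l₁ = solve-∀ₙ
            hu : (9 ℕ.* d ℕ.+ 4) ℕ.* u ℕ.≤ 3 ℕ.* m
            hu = begin
              (9 ℕ.* d ℕ.+ 4) ℕ.* u       ≡⟨ ℕ.*-distribˡ-+ (9 ℕ.* d ℕ.+ 4) (2 ℕ.* t) (3 ℕ.* C) ⟩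
              (9 ℕ.* d ℕ.+ 4) ℕ.* (2 ℕ.* t) ℕ.+ (9 ℕ.* d ℕ.+ 4) ℕ.* (3 ℕ.* C) ≤⟨ ℕ.+-mono-≤ (ℕ.m≤m+n _ (10 ℕ.* t)) big
                  ⟩
              (9 ℕ.* d ℕ.+ 4) ℕ.* (2 ℕ.* t) ℕ.+ 10 ℕ.* t ℕ.+ m ≡⟨ cong (ℕ._+ m) (l₁ d t) ⟩
              2 ℕ.* (w ℕ.* t) ℕ.+ m       ≤⟨ ℕ.+-monoˡ-≤ m (ℕ.*-monoʳ-≤ 2 wt≤) ⟩
              2 ℕ.* m ℕ.+ m               ≡⟨ ℕ.+-comm (2 ℕ.* m) m ⟩
              3 ℕ.* m                     ∎
              where l₁ : ∀ d t → (9 ℕ.* d ℕ.+ 4) ℕ.* (2 ℕ.* t) ℕ.+ 10 ℕ.* t ≡ 2 ℕ.* (9 ℕ.* (1 ℕ.+ d) ℕ.* t)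
                    l₁ = solve-∀ₙ

      -- Here y > x at n, so D y² = D′ x² is impossible for ∣ D′ ∣ ≤ ∣ D ∣.
      p∤values : ¬ + p ∥ values B (+ (m ℕ.+ C))
      p∤values pd = go (prime-∣values B (+ n) pp pd)
        where
          go : ¬ (∃ λ q → q ∈ B × + p ∥ q at + n)
          go (q , q∈ , pq) with d ℕ.<? ∣ disc q ∣
          ... | yes lt = larger-disc q n hq ℕ.≤-refl (All.lookup sqB q∈) pq lt
            where hq = ℕ.≤-trans (weight≤weights q∈) hB
          ... | no ¬lt = ℕ.<⇒≱ (ℕ.*-monoʳ-< d {{≥1⇒≢0 d≥1}} (ℕ.*-mono-< x<y x<y))
                (ℕ.≤-trans (ℕ.≤-reflexive (rigid q n hq ℕ.≤-refl (All.lookup sqB q∈) pq))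
                    (ℕ.*-monoˡ-≤ (x ℕ.* x) (ℕ.≮⇒≥ ¬lt)))
            where
              hq = ℕ.≤-trans (weight≤weights q∈) hB
              open ℕ.≤-Reasoning
              x<y : x ℕ.< ∣ slope q (+ n) ∣
              x<y = ℕ.+-cancelʳ-≤ W _ _ (begin
                suc x ℕ.+ W               ≤⟨ ℕ.+-monoˡ-≤ W (s≤s (∣slope∣≤ q₀ k)) ⟩
                suc (2 ℕ.* k ℕ.+ weight q₀) ℕ.+ W ≤⟨ ℕ.+-monoˡ-≤ W (s≤s (ℕ.+-mono-≤ (ℕ.*-monoʳ-≤ 2 (ℕ.<⇒≤ k<)) hq₀)) ⟩
                suc (2 ℕ.* m ℕ.+ W) ℕ.+ W ≤⟨ ℕ.n≤1+n _ ⟩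
                suc (suc (2 ℕ.* m ℕ.+ W) ℕ.+ W) ≡⟨ l₁ m W ⟩
                2 ℕ.* n                   ≤⟨ ∣slope∣≥ q n ⟩
                ∣ slope q (+ n) ∣ ℕ.+ weight q ≤⟨ ℕ.+-monoʳ-≤ _ hq ⟩
                ∣ slope q (+ n) ∣ ℕ.+ W ∎)
                where l₁ : ∀ m W → 1 ℕ.+ (1 ℕ.+ (2 ℕ.* m ℕ.+ W) ℕ.+ W) ≡ 2 ℕ.* (m ℕ.+ (1 ℕ.+ W))
                      l₁ = solve-∀ₙ

      -- A divisible factor of larger discriminant is excluded by `gap`. One of discriminant 0 would
      -- by rigidity have slope 0 and thus be evaluated at its double root, where it vanishes.
      p∤risings : All (NonVanishing (m ℕ.+ C)) G → ¬ + p ∥ risings G (m ℕ.+ C)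
      p∤risings nv pd = go (prime-∣risings G n pp pd)
        where
          go : ¬ (∃₂ λ q l → q ∈ G × 1 ℕ.≤ l × l ℕ.≤ n × + p ∥ q at + l)
          go (q , l , q∈ , l≥1 , l≤n , pq) = split (All.lookup bigG q∈)
            where
              hq = ℕ.≤-trans (weight≤weights q∈) hG
              y = slope q (+ l)
              split : disc q ≡ 0ℤ ⊎ d ℕ.< ∣ disc q ∣ → ⊥
              split (inj₂ lt) = larger-disc q l hq l≤n (All.lookup sqG q∈) pq lt
              split (inj₁ z)  = All.lookup nv q∈ l l≥1 l≤n (double-root q (+ l) z (d*yy≡0⇒ y
                (trans (rigid q l hq l≤n (All.lookup sqG q∈) pq) (cong (λ z → ∣ z ∣ ℕ.* (x ℕ.* x)) z))))

    -- Any prime above `M * m` dividing a value of `q₀` in the window divides the left-hand side,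
    -- but neither `c₂` nor the other factors on the right. So the window would be smooth, against
    -- `large-prime`.
    prime-case : ∀ A F c₁ c₂ → q₀ ∈ F → ¬ IsSquare (disc q₀) → c₂ ≢ 0ℤ → ∃ λ N → ∀ n → N ℕ.≤ n → All (NonVanishing n)
        G →
      ¬ c₁ * values A (+ n) * risings F n ≡ c₂ * values B (+ n) * risings G n
    prime-case A F c₁ c₂ q₀∈ nsq c₂≢0 = from
        (LargePrime.large-prime (proj₁ q₀) (proj₂ q₀) (disc q₀) refl (λ e h → nsq (e , h)) w M w≥3 M≥1)
      where
        w≥3 : 3 ℕ.≤ w
        w≥3 = ℕ.≤-trans (s≤s (s≤s (s≤s z≤n))) (ℕ.m≤m*n 9 (suc d))
        M≥1 : 1 ℕ.≤ M
        M≥1 = *-≥1 {12} (s≤s z≤n) W≥1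
        LP = ∃ λ N → ∀ n → N ℕ.≤ n → ¬
            (∀ i → i ℕ.< n ℕ./ w → ∀ p → Prime p → p ℕ.∣ ∣ q₀ at + (n ℕ.∸ n ℕ./ w ℕ.+ i) ∣ → p ℕ.≤ M ℕ.* n)
        from : LP → ∃ λ N → ∀ n → N ℕ.≤ n → All (NonVanishing n) G → ¬ c₁ * values A (+ n) * risings F n ≡ c₂ * values
            B (+ n) * risings G n
        from (N₀ , lp) = N₁ ℕ.+ C , λ n h → subst
            (λ n → All (NonVanishing n) G → ¬ c₁ * values A (+ n) * risings F n ≡ c₂ * values B (+ n) * risings G n)
            (ℕ.m∸n+n≡m (ℕ.≤-trans (ℕ.m≤n+m C N₁) h)) (main (n ℕ.∸ C) (ℕ.m+n≤o⇒m≤o∸n N₁ h))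
          where
            -- The summands make `large-prime` applicable at `m`, make the constant part of the
            -- error in `gap` small, and put every prime above `M * m` beyond |c₂|.
            N₁ = N₀ ℕ.+ ((9 ℕ.* d ℕ.+ 4) ℕ.* (3 ℕ.* suc W) ℕ.+ suc ∣ c₂ ∣)
            main : ∀ m → N₁ ℕ.≤ m → All (NonVanishing (m ℕ.+ C)) G →
              ¬ c₁ * values A (+ (m ℕ.+ C)) * risings F (m ℕ.+ C) ≡ c₂ * values B (+ (m ℕ.+ C)) * risings G (m ℕ.+ C)
            main m hm nv eq = lp m (ℕ.≤-trans (ℕ.m≤m+n N₀ _) hm) smooth
              where
                t = m ℕ./ w
                wt≤ : w ℕ.* t ℕ.≤ m
                wt≤ = ℕ.≤-trans (ℕ.≤-reflexive (ℕ.*-comm w t)) (ℕ.m/n*n≤m m w)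
                rest = ℕ.≤-trans (ℕ.m≤n+m _ N₀) hm
                big = ℕ.≤-trans (ℕ.m≤m+n ((9 ℕ.* d ℕ.+ 4) ℕ.* (3 ℕ.* suc W)) _) rest
                c₂<m : ∣ c₂ ∣ ℕ.< m
                c₂<m = ℕ.≤-trans (ℕ.m≤n+m _ ((9 ℕ.* d ℕ.+ 4) ℕ.* (3 ℕ.* suc W))) rest
                smooth : ∀ i → i ℕ.< t → ∀ p → Prime p → p ℕ.∣ ∣ q₀ at + (m ℕ.∸ t ℕ.+ i) ∣ → p ℕ.≤ M ℕ.* m
                smooth i i<t p pp pd with p ℕ.≤? M ℕ.* m
                ... | yes h = h
                ... | no ¬h = ⊥-elim (contra (prime-∣* (c₂ * values B (+ (m ℕ.+ C))) (risings G (m ℕ.+ C)) pp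
                    (subst (+ p ∥_) eq pLHS)))
                  where
                    k = m ℕ.∸ t ℕ.+ i
                    p∣ : + p ∥ q₀ at + k
                    p∣ = ∣ᵤ⇒∣ pd
                    t≤m : t ℕ.≤ m
                    t≤m = ℕ.m/n≤m m w
                    k< : k ℕ.< m
                    k< = ℕ.≤-trans (ℕ.+-monoʳ-< (m ℕ.∸ t) i<t) (ℕ.≤-reflexive (ℕ.m∸n+n≡m t≤m))
                    k+t≥ : m ℕ.≤ k ℕ.+ t
                    k+t≥ = ℕ.≤-trans (ℕ.≤-reflexive (sym (ℕ.m∸n+n≡m t≤m))) (ℕ.+-monoˡ-≤ t (ℕ.m≤m+n (m ℕ.∸ t) i))
                    t<m : t ℕ.< m
                    t<m = ℕ.≤-trans (ℕ.≤-trans (ℕ.+-monoˡ-≤ t 1≤t)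
                        (ℕ.≤-trans (ℕ.+-monoʳ-≤ t (ℕ.m≤m+n t 0)) (ℕ.*-monoˡ-≤ t {2} {w} (ℕ.≤-trans (ℕ.n≤1+n 2) w≥3))))
                        wt≤
                      where 1≤t : 1 ℕ.≤ t
                            1≤t = ℕ.≤-trans (s≤s z≤n) i<t
                    k≥1 : 1 ℕ.≤ k
                    k≥1 = ℕ.≤-trans (ℕ.m<n⇒0<n∸m t<m) (ℕ.m≤m+n (m ℕ.∸ t) i)
                    Mm<p = ℕ.≰⇒> ¬h
                    contra : + p ∥ c₂ * values B (+ (m ℕ.+ C)) ⊎ + p ∥ risings G (m ℕ.+ C) → ⊥
                    contra (inj₂ e) = p∤risings pp p∣ k< k+t≥ wt≤ big Mm<p nv e
                    contra (inj₁ e) with prime-∣* c₂ (values B (+ (m ℕ.+ C))) pp e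
                    ... | inj₁ e′ = c₂≢0 (∣-small⇒0 c₂ e′
                        (ℕ.<-trans c₂<m (ℕ.≤-<-trans (ℕ.m≤n*m m M {{≥1⇒≢0 M≥1}}) Mm<p)))
                    ... | inj₂ e′ = p∤values pp p∣ k< k+t≥ wt≤ big Mm<p e′
                    pLHS : + p ∥ c₁ * values A (+ (m ℕ.+ C)) * risings F (m ℕ.+ C)
                    pLHS = ∣n⇒∣m*n (c₁ * values A (+ (m ℕ.+ C)))
                        (∣-trans p∣ (at∣risings (m ℕ.+ C) q₀∈ k≥1 (ℕ.≤-trans (ℕ.<⇒≤ k<) (ℕ.m≤m+n m C))))

-- Eventual signs of integer polynomials, and polynomial functions.

module PolyZ where

  open Quad
  open import Data.Integer hiding (suc; pred; _≤?_; _<?_)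
  open import Data.Integer.Properties hiding (_≤?_; _<?_)
  open import Data.Integer.Tactic.RingSolver using (solve-∀)
  open import Data.List using (_∷ʳ_; map)

  -- The threshold is data: the one obtained for the final statement is the search bound of the
  -- algorithm.
  Eventually : (ℕ → Set) → Set
  Eventually P = ∃ λ K → ∀ k → K ℕ.≤ k → P k

  _∧ᵉ_ : ∀ {P Q : ℕ → Set} → Eventually P → Eventually Q → Eventually (λ k → P k × Q k)
  (K , p) ∧ᵉ (L , q) = K ℕ.+ L , λ k h → p k (ℕ.≤-trans (ℕ.m≤m+n K L) h) , q k (ℕ.≤-trans (ℕ.m≤n+m L K) h)

  mapᵉ : ∀ {P Q : ℕ → Set} → (∀ {k} → P k → Q k) → Eventually P → Eventually Q
  mapᵉ f (K , p) = K , λ k h → f (p k h)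

  EventuallyPositive : (ℤ → ℤ) → Set
  EventuallyPositive φ = Eventually (λ k → 0ℤ < φ (+ k))

  dominate : ∀ a k v → ∣ a ∣ ℕ.< k → 0ℤ < v → 0ℤ < a + + k * v
  dominate a k (+ suc m) h _ = subst (λ z → 0ℤ < a + z) (pos-* k (suc m)) (go a (ℕ.≤-trans h (ℕ.m≤m*n k (suc m))))
    where
      go : ∀ a {n} → ∣ a ∣ ℕ.< n → 0ℤ < a + + n
      go (+ a)      {n} h = +<+ (ℕ.≤-trans (ℕ.≤-trans (s≤s z≤n) h) (ℕ.m≤n+m n a))
      go (-[1+ a ]) {n} h = subst (0ℤ <_) (sym (⊖-≥ (ℕ.<⇒≤ h))) (+<+ (ℕ.m<n⇒0<n∸m h))
  dominate a k (+ zero) h (+<+ ())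

  dominate-eventually : ∀ a φ → EventuallyPositive φ → EventuallyPositive (λ x → a + x * φ x)
  dominate-eventually a φ e = mapᵉ {λ k → suc ∣ a ∣ ℕ.≤ k × 0ℤ < φ (+ k)} (λ {k} (h , p) → dominate a k (φ (+ k)) h p)
      ((suc ∣ a ∣ , λ k h → h) ∧ᵉ e)

  monic-positive : ∀ {p} → Monic p → EventuallyPositive (evalℤ p)
  monic-positive (cs , refl) = go cs
    where
      go : ∀ cs → EventuallyPositive (evalℤ (cs ∷ʳ + 1))
      go []       = 0 , λ k _ → subst (0ℤ <_) (sym (cong (λ z → 1ℤ + z) (*-zeroʳ (+ k)))) (+<+ (s≤s z≤n))
      go (a ∷ cs) = dominate-eventually a (evalℤ (cs ∷ʳ + 1)) (go cs)

  Trichotomy : (ℤ → ℤ) → Set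
  Trichotomy φ = (∀ x → φ x ≡ 0ℤ) ⊎ EventuallyPositive φ ⊎ EventuallyPositive (λ x → - φ x)

  -- Horner's scheme: a tail of eventual sign, multiplied by x, outgrows the constant term; if the
  -- tail vanishes, the constant term decides. The case is computed, which makes polynomial
  -- identities decidable.
  poly-trichotomy : ∀ p → Trichotomy (evalℤ p)
  poly-trichotomy []      = inj₁ λ x → refl
  poly-trichotomy (a ∷ p) = go (poly-trichotomy p)
    where
      φ = evalℤ p
      const : ∀ a → (∀ x → a + x * φ x ≡ a) → Trichotomy (λ x → a + x * φ x)
      const (+ zero)  h = inj₁ h
      const (+ suc n) h = inj₂ (inj₁ (0 , λ k _ → subst (0ℤ <_) (sym (h (+ k))) (+<+ (s≤s z≤n))))
      const -[1+ n ]  h = inj₂ (inj₂ (0 , λ k _ → subst (λ z → 0ℤ < - z) (sym (h (+ k))) (+<+ (s≤s z≤n))))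
      go : Trichotomy φ → Trichotomy (λ x → a + x * φ x)
      go (inj₁ z) = const a (λ x → trans (cong (λ y → a + x * y) (z x))
          (trans (cong (λ z → a + z) (*-zeroʳ x)) (+-identityʳ a)))
      go (inj₂ (inj₁ e)) = inj₂ (inj₁ (dominate-eventually a φ e))
      go (inj₂ (inj₂ e)) = inj₂ (inj₂
          (mapᵉ (λ {k} h → subst (0ℤ <_) (lem a (+ k) (φ (+ k))) h) (dominate-eventually (- a) (λ x → - φ x) e)))
        where lem : ∀ a k v → - a + k * - v ≡ - (a + k * v)
              lem = solve-∀

  IsPoly : (ℤ → ℤ) → Set
  IsPoly φ = ∃ λ p → ∀ x → evalℤ p x ≡ φ x

  add : Polyℤ → Polyℤ → Polyℤ
  add []      q       = q
  add (a ∷ p) []      = a ∷ p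
  add (a ∷ p) (b ∷ q) = a + b ∷ add p q

  scale : ℤ → Polyℤ → Polyℤ
  scale c = map (c *_)

  mul : Polyℤ → Polyℤ → Polyℤ
  mul []      q = []
  mul (a ∷ p) q = add (scale a q) (0ℤ ∷ mul p q)

  eval-add : ∀ p q x → evalℤ (add p q) x ≡ evalℤ p x + evalℤ q x
  eval-add []      q       x = sym (+-identityˡ _)
  eval-add (a ∷ p) []      x = sym (+-identityʳ _)
  eval-add (a ∷ p) (b ∷ q) x = trans (cong (λ z → a + b + x * z) (eval-add p q x)) (lem a b x (evalℤ p x) (evalℤ q x))
    where lem : ∀ a b x u v → a + b + x * (u + v) ≡ a + x * u + (b + x * v)
          lem = solve-∀

  eval-scale : ∀ c p x → evalℤ (scale c p) x ≡ c * evalℤ p x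
  eval-scale c []      x = sym (*-zeroʳ c)
  eval-scale c (a ∷ p) x = trans (cong (λ z → c * a + x * z) (eval-scale c p x)) (lem c a x (evalℤ p x))
    where lem : ∀ c a x u → c * a + x * (c * u) ≡ c * (a + x * u)
          lem = solve-∀

  eval-mul : ∀ p q x → evalℤ (mul p q) x ≡ evalℤ p x * evalℤ q x
  eval-mul []      q x = refl
  eval-mul (a ∷ p) q x = trans (eval-add (scale a q) (0ℤ ∷ mul p q) x)
      (trans (cong₂ (λ u v → u + (0ℤ + x * v)) (eval-scale a q x) (eval-mul p q x)) (lem a x (evalℤ p x) (evalℤ q x)))
    where lem : ∀ a x u v → a * v + (0ℤ + x * (u * v)) ≡ (a + x * u) * v
          lem = solve-∀

  quad-poly : ∀ q → IsPoly (q at_)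
  quad-poly (b , c) = c ∷ b ∷ 1ℤ ∷ [] , lem b c
    where lem : ∀ b c x → c + x * (b + x * (+ 1 + x * + 0)) ≡ x * x + b * x + c
          lem = solve-∀

  infixr 5 _*ᵖ_
  _*ᵖ_ : ∀ {φ ψ} → IsPoly φ → IsPoly ψ → IsPoly (λ x → φ x * ψ x)
  (p , e) *ᵖ (q , e′) = mul p q , λ x → trans (eval-mul p q x) (cong₂ _*_ (e x) (e′ x))

  _-ᵖ_ : ∀ {φ ψ} → IsPoly φ → IsPoly ψ → IsPoly (λ x → φ x - ψ x)
  (p , e) -ᵖ (q , e′) = add p (scale (- 1ℤ) q) , λ x → trans (eval-add p (scale (- 1ℤ) q) x)
      (cong₂ _+_ (e x) (trans (eval-scale (- 1ℤ) q x) (trans (-1*i≡-i (evalℤ q x)) (cong -_ (e′ x)))))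

  const-poly : ∀ c → IsPoly (λ _ → c)
  const-poly c = c ∷ [] , λ x → trans (cong (λ z → c + z) (*-zeroʳ x)) (+-identityʳ c)

  values-poly : ∀ F → IsPoly (values F)
  values-poly []      = const-poly 1ℤ
  values-poly (q ∷ F) = quad-poly q *ᵖ values-poly F

  poly-zero-or-eventually≢0 : ∀ {φ} → IsPoly φ → (∀ x → φ x ≡ 0ℤ) ⊎ Eventually (λ k → φ (+ k) ≢ 0ℤ)
  poly-zero-or-eventually≢0 {φ} (p , e) = go (poly-trichotomy p)
    where
      go : Trichotomy (evalℤ p) → (∀ x → φ x ≡ 0ℤ) ⊎ Eventually (λ k → φ (+ k) ≢ 0ℤ)
      go (inj₁ z)        = inj₁ λ x → trans (sym (e x)) (z x)
      go (inj₂ (inj₁ s)) = inj₂ (mapᵉ (λ {k} h eq → <-irrefl (sym (trans (e (+ k)) eq)) h) s)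
      go (inj₂ (inj₂ s)) = inj₂ (mapᵉ (λ {k} h eq → <-irrefl (sym (cong -_ (trans (e (+ k)) eq))) h) s)

-- Rising products outgrow polynomials.

module Growth where

  open Range using (^-distribʳ-*)
  open Factor using (≥1⇒≢0; ^-≥1)
  open IntDiv
  open Quad
  open QuadBounds using (∣q∣-≥; ∣q∣-≤)
  open PrimeCase using (weight; weights)
  open PolyZ using (Eventually)
  open import Data.Integer hiding (suc; pred; _<_; _≤_; _<?_; _≤?_)
  open import Data.Integer.Properties hiding (_≤?_; _<?_)
  open import Data.Nat.Tactic.RingSolver using () renaming (solve-∀ to solve-∀ₙ)
  open import Data.List using (length)

  -- The last `J` factors have arguments beyond 2m and are at least m² each; the earlier ones
  -- multiply to a nonzero integer.
  rising-≥ : ∀ q m s J → 1 ℕ.≤ m → size q ℕ.≤ m → 2 ℕ.* m ℕ.≤ s → NonVanishing (s ℕ.+ J) q → (m ℕ.* m) ℕ.^ J ℕ.≤ ∣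
      rising q (s ℕ.+ J) ∣
  rising-≥ q m s zero    hm hq hs nv = ≢0⇒abs≥1 (rising≢0 q (s ℕ.+ 0) nv)
  rising-≥ q@(b , c) m s (suc J) hm hq hs nv = subst (λ z → (m ℕ.* m) ℕ.^ suc J ℕ.≤ ∣ rising q z ∣)
      (sym (ℕ.+-suc s J))
    (ℕ.≤-trans (ℕ.*-mono-≤ (∣q∣-≥ b c {suc (s ℕ.+ J)} {m} hm k≥ (ℕ.≤-trans (ℕ.*-monoʳ-≤ 2 hq) k≥))
        (rising-≥ q m s J hm hq hs (λ k a h → nv k a (ℕ.≤-trans h (ℕ.+-monoʳ-≤ s (ℕ.n≤1+n J))))))
      (ℕ.≤-reflexive (trans (ℕ.*-comm ∣ q at + suc (s ℕ.+ J) ∣ _)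
          (sym (abs-* (rising q (s ℕ.+ J)) (q at + suc (s ℕ.+ J)))))))
    where k≥ : 2 ℕ.* m ℕ.≤ suc (s ℕ.+ J)
          k≥ = ℕ.≤-trans hs (ℕ.≤-trans (ℕ.m≤m+n s J) (ℕ.n≤1+n _))

  values-≤ : ∀ B n → suc (weights B) ℕ.≤ n → ∣ values B (+ n) ∣ ℕ.≤ (n ℕ.^ 3) ℕ.^ length B
  values-≤ []              n h = ℕ.≤-refl
  values-≤ (q@(b , c) ∷ B) n h = ℕ.≤-trans (ℕ.≤-reflexive (abs-* (q at + n) (values B (+ n))))
    (ℕ.*-mono-≤ (∣q∣-≤ b c ℕ.≤-refl
        (ℕ.≤-trans (s≤s (ℕ.≤-trans (ℕ.m≤m+n (size q) ∣ disc q ∣) (ℕ.m≤m+n (weight q) (weights B)))) h))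
      (values-≤ B n (ℕ.≤-trans (s≤s (ℕ.m≤n+m (weights B) (weight q))) h)))

  values-eventually≢0 : ∀ A n → suc (weights A) ℕ.≤ n → values A (+ n) ≢ 0ℤ
  values-eventually≢0 []      n h ()
  values-eventually≢0 (q ∷ A) n h = *-≢0
      (at≢0 q (ℕ.≤-trans (s≤s (ℕ.≤-trans (ℕ.m≤m+n (size q) ∣ disc q ∣) (ℕ.m≤m+n (weight q) (weights A)))) h))
    (values-eventually≢0 A n (ℕ.≤-trans (s≤s (ℕ.m≤n+m (weights A) (weight q))) h))

  growth-case : ∀ q F A B c₁ c₂ → c₁ ≢ 0ℤ → Eventually
      (λ n → All (NonVanishing n) (q ∷ F) → ¬ c₁ * values A (+ n) * risings (q ∷ F) n ≡ c₂ * values B (+ n))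
  growth-case q F A B c₁ c₂ hc = N , λ n h nv eq → ℕ.<⇒≱ (upper n h)
      (ℕ.≤-trans (lower n h nv) (ℕ.≤-reflexive (trans (cong ∣_∣ eq) (abs-* c₂ (values B (+ n))))))
    where
      open ℕ.≤-Reasoning
      -- A fixed number `J` of factors suffices. On the right each of the `r` quadratics is at most
      -- n³ ≤ 64 m³, on the left stands m^(2J); 2 J ≥ 3 r + 1 leaves a spare power of `m` to absorb
      -- |c₂| 64ʳ.
      r J m₀ N : ℕ
      r = length B
      J = suc (2 ℕ.* r)
      m₀ = suc J ℕ.+ (weights (q ∷ A) ℕ.+ (weights B ℕ.+ suc (∣ c₂ ∣ ℕ.* 64 ℕ.^ r)))
      N = 2 ℕ.* m₀ ℕ.+ J
      m s : ℕ → ℕ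
      s n = n ℕ.∸ J
      m n = s n ℕ./ 2
      s+J : ∀ n → N ℕ.≤ n → s n ℕ.+ J ≡ n
      s+J n h = ℕ.m∸n+n≡m (ℕ.≤-trans (ℕ.m≤n+m J (2 ℕ.* m₀)) h)
      m≥ : ∀ n → N ℕ.≤ n → m₀ ℕ.≤ m n
      m≥ n h = ℕ.≤-trans (ℕ.≤-reflexive (sym (trans (cong (ℕ._/ 2) (ℕ.*-comm 2 m₀)) (ℕ.m*n/n≡m m₀ 2))))
          (ℕ./-monoˡ-≤ 2 (ℕ.m+n≤o⇒m≤o∸n (2 ℕ.* m₀) h))
      2m≤ : ∀ n → 2 ℕ.* m n ℕ.≤ s n
      2m≤ n = ℕ.≤-trans (ℕ.≤-reflexive (ℕ.*-comm 2 (m n))) (ℕ.m/n*n≤m (s n) 2)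
      m₀≥1 : 1 ℕ.≤ m₀
      m₀≥1 = s≤s z≤n
      n≤4m : ∀ n → N ℕ.≤ n → n ℕ.≤ 4 ℕ.* m n
      n≤4m n h = begin
        n                                ≡⟨ s+J n h ⟨
        s n ℕ.+ J                        ≡⟨ cong (ℕ._+ J) (ℕ.m≡m%n+[m/n]*n (s n) 2) ⟩
        s n ℕ.% 2 ℕ.+ m n ℕ.* 2 ℕ.+ J    ≤⟨ ℕ.+-monoˡ-≤ J (ℕ.+-monoˡ-≤ (m n ℕ.* 2) (ℕ.s≤s⁻¹ (ℕ.m%n<n (s n) 2))) ⟩
        1 ℕ.+ m n ℕ.* 2 ℕ.+ J            ≡⟨ l (m n) J ⟩
        m n ℕ.* 2 ℕ.+ suc J              ≤⟨ ℕ.+-monoʳ-≤ (m n ℕ.* 2)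
            (ℕ.≤-trans (ℕ.m≤m+n (suc J) _) (ℕ.≤-trans (m≥ n h) (ℕ.m≤n*m (m n) 2))) ⟩
        m n ℕ.* 2 ℕ.+ 2 ℕ.* m n          ≡⟨ l′ (m n) ⟩
        4 ℕ.* m n                        ∎
        where
          l : ∀ m J → 1 ℕ.+ m ℕ.* 2 ℕ.+ J ≡ m ℕ.* 2 ℕ.+ (1 ℕ.+ J)
          l = solve-∀ₙ
          l′ : ∀ m → m ℕ.* 2 ℕ.+ 2 ℕ.* m ≡ 4 ℕ.* m
          l′ = solve-∀ₙ
      w≤m₀ : weights (q ∷ A) ℕ.+ (weights B ℕ.+ suc (∣ c₂ ∣ ℕ.* 64 ℕ.^ r)) ℕ.≤ m₀
      w≤m₀ = ℕ.m≤n+m _ (suc J)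
      m≤n : ∀ n → N ℕ.≤ n → m n ℕ.≤ n
      m≤n n h = ℕ.≤-trans (ℕ.m≤n*m (m n) 2) (ℕ.≤-trans (2m≤ n) (ℕ.m∸n≤m n J))
      lower : ∀ n → N ℕ.≤ n → All (NonVanishing n) (q ∷ F) → (m n ℕ.* m n) ℕ.^ J ℕ.≤ ∣ c₁ * values A (+ n) * risings
          (q ∷ F) n ∣
      lower n h (nvq ∷ nvF) = begin
        (m n ℕ.* m n) ℕ.^ J          ≤⟨ rising-≥ q (m n) (s n) J (ℕ.≤-trans m₀≥1 (m≥ n h)) size≤ (2m≤ n)
            (subst (λ z → NonVanishing z q) (sym (s+J n h)) nvq) ⟩
        ∣ rising q (s n ℕ.+ J) ∣     ≡⟨ cong (λ z → ∣ rising q z ∣) (s+J n h) ⟩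
        ∣ rising q n ∣               ≤⟨ ℕ.m≤m*n ∣ rising q n ∣ ∣ risings F n ∣
            {{≥1⇒≢0 (≢0⇒abs≥1 (risings≢0 F n nvF))}} ⟩
        ∣ rising q n ∣ ℕ.* ∣ risings F n ∣ ≡⟨ abs-* (rising q n) (risings F n) ⟨
        ∣ risings (q ∷ F) n ∣        ≤⟨ ℕ.m≤n*m _ ∣ c₁ * values A (+ n) ∣
            {{≥1⇒≢0 (≢0⇒abs≥1 (*-≢0 hc (values-eventually≢0 A n A≤)))}} ⟩
        ∣ c₁ * values A (+ n) ∣ ℕ.* ∣ risings (q ∷ F) n ∣ ≡⟨ abs-* (c₁ * values A (+ n)) (risings (q ∷ F) n) ⟨
        ∣ c₁ * values A (+ n) * risings (q ∷ F) n ∣ ∎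
        where
          wA≤ : weights (q ∷ A) ℕ.≤ m n
          wA≤ = ℕ.≤-trans (ℕ.m≤m+n (weights (q ∷ A)) _) (ℕ.≤-trans w≤m₀ (m≥ n h))
          size≤ : size q ℕ.≤ m n
          size≤ = ℕ.≤-trans (ℕ.≤-trans (ℕ.m≤m+n (size q) ∣ disc q ∣) (ℕ.m≤m+n (weight q) (weights A))) wA≤
          A≤ : suc (weights A) ℕ.≤ n
          A≤ = ℕ.≤-trans (s≤s (ℕ.≤-trans (ℕ.m≤n+m (weights A) (weight q)) (ℕ.m≤m+n (weights (q ∷ A)) _)))
            (ℕ.≤-trans (ℕ.+-monoˡ-≤ (weights (q ∷ A) ℕ.+ (weights B ℕ.+ suc (∣ c₂ ∣ ℕ.* 64 ℕ.^ r))) {1} {suc J}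
                (s≤s z≤n)) (ℕ.≤-trans (m≥ n h) (m≤n n h)))
      upper : ∀ n → N ℕ.≤ n → ∣ c₂ ∣ ℕ.* ∣ values B (+ n) ∣ ℕ.< (m n ℕ.* m n) ℕ.^ J
      upper n h = begin-strict
        ∣ c₂ ∣ ℕ.* ∣ values B (+ n) ∣           ≤⟨ ℕ.*-monoʳ-≤ ∣ c₂ ∣ (values-≤ B n B≤) ⟩
        ∣ c₂ ∣ ℕ.* (n ℕ.^ 3) ℕ.^ r              ≤⟨ ℕ.*-monoʳ-≤ ∣ c₂ ∣ (ℕ.^-monoˡ-≤ r (ℕ.^-monoˡ-≤ 3 (n≤4m n h))) ⟩
        ∣ c₂ ∣ ℕ.* ((4 ℕ.* x) ℕ.^ 3) ℕ.^ r      ≡⟨ cong (λ z → ∣ c₂ ∣ ℕ.* z ℕ.^ r) (l₁ x) ⟩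
        ∣ c₂ ∣ ℕ.* (64 ℕ.* x ℕ.^ 3) ℕ.^ r       ≡⟨ cong (∣ c₂ ∣ ℕ.*_) (^-distribʳ-* r 64 (x ℕ.^ 3)) ⟩
        ∣ c₂ ∣ ℕ.* (64 ℕ.^ r ℕ.* (x ℕ.^ 3) ℕ.^ r) ≡⟨ ℕ.*-assoc ∣ c₂ ∣ (64 ℕ.^ r) _ ⟨
        ∣ c₂ ∣ ℕ.* 64 ℕ.^ r ℕ.* (x ℕ.^ 3) ℕ.^ r <⟨ ℕ.*-monoˡ-< ((x ℕ.^ 3) ℕ.^ r) {{≥1⇒≢0 (^-≥1 r (^-≥1 3 x≥1))}} c₂< ⟩
        x ℕ.* (x ℕ.^ 3) ℕ.^ r                   ≡⟨ cong (x ℕ.*_) (ℕ.^-*-assoc x 3 r) ⟩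
        x ℕ.^ suc (3 ℕ.* r)                     ≤⟨ ℕ.^-monoʳ-≤ x {{≥1⇒≢0 x≥1}}
            (s≤s (ℕ.≤-trans (ℕ.m≤m+n (3 ℕ.* r) (suc r)) (ℕ.≤-reflexive (l₂ r)))) ⟩
        x ℕ.^ (2 ℕ.* J)                         ≡⟨ ℕ.^-*-assoc x 2 J ⟨
        (x ℕ.^ 2) ℕ.^ J                         ≡⟨ cong (λ z → (x ℕ.* z) ℕ.^ J) (ℕ.*-identityʳ x) ⟩
        (x ℕ.* x) ℕ.^ J                         ∎
        where
          x = m n
          x≥1 = ℕ.≤-trans m₀≥1 (m≥ n h)
          l₁ : ∀ x → (4 ℕ.* x) ℕ.* ((4 ℕ.* x) ℕ.* ((4 ℕ.* x) ℕ.* 1)) ≡ 64 ℕ.* (x ℕ.* (x ℕ.* (x ℕ.* 1)))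
          l₁ = solve-∀ₙ
          l₂ : ∀ r → 3 ℕ.* r ℕ.+ (1 ℕ.+ r) ≡ 2 ℕ.* r ℕ.+ (1 ℕ.+ (2 ℕ.* r ℕ.+ 0))
          l₂ = solve-∀ₙ
          wB≤ : weights B ℕ.+ suc (∣ c₂ ∣ ℕ.* 64 ℕ.^ r) ℕ.≤ x
          wB≤ = ℕ.≤-trans (ℕ.m≤n+m _ (weights (q ∷ A))) (ℕ.≤-trans w≤m₀ (m≥ n h))
          c₂< : ∣ c₂ ∣ ℕ.* 64 ℕ.^ r ℕ.< x
          c₂< = ℕ.≤-trans (ℕ.m≤n+m _ (weights B)) wB≤
          B≤ : suc (weights B) ℕ.≤ n
          B≤ = ℕ.≤-trans (ℕ.≤-trans (ℕ.≤-reflexive (ℕ.+-comm 1 (weights B))) (ℕ.+-monoʳ-≤ (weights B) (s≤s z≤n)))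
              (ℕ.≤-trans wB≤ (m≤n n h))

-- From some point on, a hit forces a hit at the preceding index.

module Hereditary where

  open IntDiv
  open Quad
  open PrimeCase
  open PolyZ
  open Growth
  open import Data.Integer hiding (suc; pred; _≤?_; _<?_)
  open import Data.Integer.Properties hiding (_≤?_; _<?_)
  open import Data.Integer.Tactic.RingSolver using (solve-∀)
  open import Data.List using (map; _++_)
  open import Data.List.Relation.Unary.All.Properties using () renaming
      (++⁺ to All++⁺; ++⁻ˡ to All++⁻ˡ; ++⁻ʳ to All++⁻ʳ)
  open import Data.List.Membership.Propositional.Properties using (∈-++⁺ˡ; ∈-++⁺ʳ; ∈-++⁻; ∈-map⁺)
  open import Data.List.Relation.Binary.Permutation.Propositional using (_↭_; ↭-sym)
  open import Data.List.Relation.Binary.Permutation.Propositional.Properties using (∈-resp-↭)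

  partialProduct : Polyℤ → ℕ → ℤ
  partialProduct f zero    = 1ℤ
  partialProduct f (suc n) = partialProduct f n * evalℤ f (+ suc n)

  SquareFactors : Polyℤ → List Quad → Set
  SquareFactors f F = ∀ k → evalℤ f (+ k) * evalℤ f (+ k) ≡ values F (+ k)

  partialProduct-sq : ∀ {f F} → SquareFactors f F → ∀ n → partialProduct f n * partialProduct f n ≡ risings F n
  partialProduct-sq {f} {F} h zero    = sym (risings-0 F)
    where risings-0 : ∀ F → risings F 0 ≡ 1ℤ
          risings-0 []      = refl
          risings-0 (q ∷ F) = trans (*-identityˡ _) (risings-0 F)
  partialProduct-sq {f} {F} h (suc n) = trans (lem (partialProduct f n) (evalℤ f (+ suc n)))
    (trans (cong₂ _*_ (partialProduct-sq {f} {F} h n) (h (suc n))) (sym (risings-suc F n)))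
    where lem : ∀ a b → (a * b) * (a * b) ≡ (a * a) * (b * b)
          lem = solve-∀

  partialProduct≢0 : ∀ f n → (∀ k → 1 ℕ.≤ k → k ℕ.≤ n → evalℤ f (+ k) ≢ 0ℤ) → partialProduct f n ≢ 0ℤ
  partialProduct≢0 f zero    h ()
  partialProduct≢0 f (suc n) h = *-≢0 (partialProduct≢0 f n (λ k a b → h k a (ℕ.m≤n⇒m≤1+n b)))
      (h (suc n) (s≤s z≤n) ℕ.≤-refl)

  partialProduct≢0⁻ : ∀ f n → partialProduct f n ≢ 0ℤ → ∀ k → 1 ℕ.≤ k → k ℕ.≤ n → evalℤ f (+ k) ≢ 0ℤ
  partialProduct≢0⁻ f zero    h k hk le e = ℕ.<⇒≱ hk le
  partialProduct≢0⁻ f (suc n) h k hk le with ℕ.m≤n⇒m<n∨m≡n le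
  ... | inj₁ lt   = partialProduct≢0⁻ f n (λ e → h (cong (_* evalℤ f (+ suc n)) e)) k hk (ℕ.s≤s⁻¹ lt)
  ... | inj₂ refl = λ e → h (trans (cong (partialProduct f n *_) e) (*-zeroʳ (partialProduct f n)))

  nonVanishing : ∀ {f F} → SquareFactors f F → ∀ n → (∀ k → 1 ℕ.≤ k → k ℕ.≤ n → evalℤ f (+ k) ≢ 0ℤ) → All
      (NonVanishing n) F
  nonVanishing {f} {F} sf n h = All.tabulate λ {q} q∈ k a b → All.lookup
      (values≢0⁻ F (subst (_≢ 0ℤ) (sf k) (*-≢0 (h k a b) (h k a b)))) q∈

  Compatible : List Quad → List Quad → Set
  Compatible F G = ∀ {q q′} → q ∈ F ++ G → q′ ∈ F ++ G → IsSquare (disc q * disc q′)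

  Irreducible⊎Zero : Quad → Set
  Irreducible⊎Zero q = disc q ≡ 0ℤ ⊎ ¬ IsSquare (disc q)

  i²≥0 : ∀ i → 0ℤ ≤ i * i
  i²≥0 i = subst (0ℤ ≤_) (∣i∣²≡i² i) (+≤+ z≤n)

  -- A product that is a square is nonnegative, so the two discriminants cannot have opposite signs.
  same-abs : ∀ {D D′} → IsSquare (D * D′) → D ≢ 0ℤ → ∣ D ∣ ≡ ∣ D′ ∣ → D ≡ D′
  same-abs {+ a}      {+ b}      s h e = cong +_ e
  same-abs { -[1+ a ]} { -[1+ b ]} s h e = cong -[1+_] (ℕ.suc-injective e)
  same-abs {+ suc a}  { -[1+ b ]} (e , ee) h _ with () ← ≤-trans (i²≥0 e) (≤-reflexive ee)
  same-abs {+ zero}   { -[1+ b ]} s h ()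
  same-abs { -[1+ a ]} {+ suc b}  (e , ee) h _ with () ← ≤-trans (i²≥0 e) (≤-reflexive ee)
  same-abs { -[1+ a ]} {+ zero}   s h ()

  MinimalDisc : List Quad → Quad → Set
  MinimalDisc F q₀ = q₀ ∈ F × disc q₀ ≢ 0ℤ × (∀ {q} → q ∈ F → disc q ≡ 0ℤ ⊎ ∣ disc q₀ ∣ ℕ.≤ ∣ disc q ∣)

  minimal-disc : ∀ F → (∀ {q} → q ∈ F → disc q ≡ 0ℤ) ⊎ ∃ (MinimalDisc F)
  minimal-disc [] = inj₁ λ ()
  minimal-disc (r ∷ F) = go (minimal-disc F) (disc r ≟ 0ℤ)
    where
      go : (∀ {q} → q ∈ F → disc q ≡ 0ℤ) ⊎ ∃ (MinimalDisc F) → Dec (disc r ≡ 0ℤ) → (∀ {q} → q ∈ r ∷ F → disc q ≡ 0ℤ) ⊎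
          ∃ (MinimalDisc (r ∷ F))
      go (inj₁ z) (yes e) = inj₁ λ { (here refl) → e ; (there q∈) → z q∈ }
      go (inj₁ z) (no ¬e) = inj₂ (r , here refl , ¬e , λ { (here refl) → inj₂ ℕ.≤-refl ; (there q∈) → inj₁ (z q∈) })
      go (inj₂ (q₀ , q₀∈ , h , m)) (yes e) = inj₂
          (q₀ , there q₀∈ , h , λ { (here refl) → inj₁ e ; (there q∈) → m q∈ })
      go (inj₂ (q₀ , q₀∈ , h , m)) (no ¬e) with ℕ.≤-total ∣ disc q₀ ∣ ∣ disc r ∣
      ... | inj₁ le = inj₂ (q₀ , there q₀∈ , h , λ { (here refl) → inj₂ le ; (there q∈) → m q∈ })
      ... | inj₂ ge = inj₂ (r , here refl , ¬e , λ { (here refl) → inj₂ ℕ.≤-refl ; {q} (there q∈) → weaken q (m q∈) })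
        where weaken : ∀ q → disc q ≡ 0ℤ ⊎ ∣ disc q₀ ∣ ℕ.≤ ∣ disc q ∣ → disc q ≡ 0ℤ ⊎ ∣ disc r ∣ ℕ.≤ ∣ disc q ∣
              weaken q (inj₁ e) = inj₁ e
              weaken q (inj₂ l) = inj₂ (ℕ.≤-trans ge l)

  module _ {f g : Polyℤ} {F G : List Quad} (sf : SquareFactors f F) (sg : SquareFactors g G) (nz : NoNatZeros f)
    (f>0 : EventuallyPositive (evalℤ f)) (g>0 : EventuallyPositive (evalℤ g))
    (compat : Compatible F G) (irr : ∀ {q} → q ∈ F ++ G → Irreducible⊎Zero q) {T U : ℤ} where

    -- The equation uₙ = t with denominators cleared; `T` and `U` will be the cross products of
    -- numerators and denominators of `t` and `u₀`.
    Hit : ℕ → Set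
    Hit n = partialProduct f n * T ≡ partialProduct g n * U

    private
      X≢0 : ∀ n → partialProduct f n ≢ 0ℤ
      X≢0 n = partialProduct≢0 f n (λ k _ _ → nz k)

      nvF : ∀ n → All (NonVanishing n) F
      nvF n = nonVanishing {f} {F} sf n (λ k _ _ → nz k)

    module _ (T≢0 : T ≢ 0ℤ) (U≢0 : U ≢ 0ℤ) where
      private
        module M = Matching (matching F G)

        F₁ = map proj₁ M.pairs
        G₁ = map proj₂ M.pairs

        P : ℤ → Set
        P D = ∀ {q} → q ∈ F ++ G → IsSquare (disc q * D)

        F₁∈ : ∀ {q} → q ∈ F₁ → q ∈ F ++ G
        F₁∈ q∈ = ∈-++⁺ˡ (∈-resp-↭ (↭-sym M.F↭) (∈-++⁺ˡ q∈))
        G₁∈ : ∀ {q} → q ∈ G₁ → q ∈ F ++ G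
        G₁∈ q∈ = ∈-++⁺ʳ F (∈-resp-↭ (↭-sym M.G↭) (∈-++⁺ˡ q∈))
        F′∈ : ∀ {q} → q ∈ M.F′ → q ∈ F ++ G
        F′∈ q∈ = ∈-++⁺ˡ (∈-resp-↭ (↭-sym M.F↭) (∈-++⁺ʳ F₁ q∈))
        G′∈ : ∀ {q} → q ∈ M.G′ → q ∈ F ++ G
        G′∈ q∈ = ∈-++⁺ʳ F (∈-resp-↭ (↭-sym M.G↭) (∈-++⁺ʳ G₁ q∈))

        R : Ratio P F₁ G₁
        R = list-ratio {P} M.pairs (All.tabulate λ p∈ → All.lookup M.matched p∈
          , (λ q∈ → compat q∈ (F₁∈ (∈-map⁺ proj₁ p∈))) , (λ q∈ → compat q∈ (G₁∈ (∈-map⁺ proj₂ p∈))))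
        module R = Ratio R

        nv-↭ : ∀ {n H H′} → H ↭ H′ → All (NonVanishing n) H → All (NonVanishing n) H′
        nv-↭ r a = All.tabulate λ q∈ → All.lookup a (∈-resp-↭ (↭-sym r) q∈)

        nvF₁ : ∀ n → All (NonVanishing n) F₁
        nvF₁ n = All++⁻ˡ F₁ (nv-↭ M.F↭ (nvF n))
        nvF′ : ∀ n → All (NonVanishing n) M.F′
        nvF′ n = All++⁻ʳ F₁ (nv-↭ M.F↭ (nvF n))

        -- `g` may have positive integer zeros, but from the first one on its partial products
        -- vanish, which a hit with nonzero `T` excludes.
        nvG : ∀ n → Hit n → All (NonVanishing n) G
        nvG n h = nonVanishing {g} {G} sg n (partialProduct≢0⁻ g n λ e → *-≢0 (X≢0 n) T≢0 (trans h (cong (_* U) e)))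
        nvG′ : ∀ n → Hit n → All (NonVanishing n) M.G′
        nvG′ n h = All++⁻ʳ G₁ (nv-↭ M.G↭ (nvG n h))

        κ≢0 : R.κ ≢ 0ℤ
        κ≢0 = R.κ≢0 nvF₁

        c₁ c₂ : ℤ
        c₁ = T * T * R.κ
        c₂ = U * U * R.λ′

        c₁≢0 : c₁ ≢ 0ℤ
        c₁≢0 = *-≢0 (*-≢0 T≢0 T≢0) κ≢0

        SqHit Reduced : ℕ → Set
        SqHit n = risings F n * (T * T) ≡ risings G n * (U * U)
        Reduced n = c₁ * values R.A (+ n) * risings M.F′ n ≡ c₂ * values R.B (+ n) * risings M.G′ n

        square-hit : ∀ n → Hit n → SqHit n
        square-hit n h = trans (cong (_* (T * T)) (sym (partialProduct-sq {f} {F} sf n)))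
            (trans (l (partialProduct f n) T)
            (trans (cong (λ z → z * z) h) (trans (sym (l (partialProduct g n) U))
                (cong (_* (U * U)) (partialProduct-sq {g} {G} sg n)))))
          where l : ∀ x t → x * x * (t * t) ≡ (x * t) * (x * t)
                l = solve-∀

        rF : ∀ n → risings F n ≡ risings F₁ n * risings M.F′ n
        rF n = trans (risings-↭ n M.F↭) (risings-++ F₁ M.F′ n)
        rG : ∀ n → risings G n ≡ risings G₁ n * risings M.G′ n
        rG n = trans (risings-↭ n M.G↭) (risings-++ G₁ M.G′ n)

        left : ∀ n → risings F n * (T * T) * (R.κ * values R.A (+ n)) ≡ risings F₁ n *
            (c₁ * values R.A (+ n) * risings M.F′ n)
        left n = trans (cong (λ z → z * (T * T) * (R.κ * values R.A (+ n))) (rF n))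
            (l (risings F₁ n) (risings M.F′ n) T R.κ (values R.A (+ n)))
          where l : ∀ x y t k a → x * y * (t * t) * (k * a) ≡ x * (t * t * k * a * y)
                l = solve-∀
        right : ∀ n → risings G n * (U * U) * (R.κ * values R.A (+ n)) ≡ risings F₁ n *
            (c₂ * values R.B (+ n) * risings M.G′ n)
        right n = trans (cong (λ z → z * (U * U) * (R.κ * values R.A (+ n))) (rG n))
            (trans (l₁ (risings G₁ n) (risings M.G′ n) U (R.κ * values R.A (+ n)))
                (trans (cong (λ z → z * (U * U) * risings M.G′ n) (R.ratio n))
              (l₂ (risings F₁ n) (risings M.G′ n) U R.λ′ (values R.B (+ n)))))
          where
            l₁ : ∀ x y t k → x * y * (t * t) * k ≡ x * k * (t * t) * y
            l₁ = solve-∀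
            l₂ : ∀ x y t k a → x * (k * a) * (t * t) * y ≡ x * (t * t * k * a * y)
            l₂ = solve-∀

        reduce : ∀ n → SqHit n → Reduced n
        reduce n h = *-cancelˡ-≡ (risings F₁ n) _ _ {{≢-nonZero (risings≢0 F₁ n (nvF₁ n))}}
          (trans (sym (left n)) (trans (cong (_* (R.κ * values R.A (+ n))) h) (right n)))

        -- Going back divides by κ A(n), so `n` has to lie beyond the zeros of `A`.
        unreduce : ∀ n → suc (weights R.A) ℕ.≤ n → Reduced n → SqHit n
        unreduce n hn h = *-cancelʳ-≡ _ _ (R.κ * values R.A (+ n))
            {{≢-nonZero (*-≢0 κ≢0 (values-eventually≢0 R.A n hn))}}
          (trans (left n) (trans (cong (risings F₁ n *_) h) (sym (right n))))

        Goal : Set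
        Goal = Eventually (λ n → Hit (suc n) → Hit n)

        never : Eventually (λ n → ¬ Hit n) → Goal
        never (K , h) = K , λ n le hit → ⊥-elim (h (suc n) (ℕ.m≤n⇒m≤1+n le) hit)

        never-reduced : Eventually (λ n → All (NonVanishing n) M.F′ → All (NonVanishing n) M.G′ → ¬ Reduced n) → Goal
        never-reduced e = never (mapᵉ (λ {n} h hit → h (nvF′ n) (nvG′ n hit) (reduce n (square-hit n hit))) e)

        pos-sq : ∀ {x y} → 0ℤ < x → 0ℤ < y → x * x ≡ y * y → x ≡ y
        pos-sq {x} {y} hx hy e with *≡0⇒ (x - y) (x + y) (trans (l x y) (i≡j⇒i-j≡0 e))
          where l : ∀ x y → (x - y) * (x + y) ≡ x * x - y * y
                l = solve-∀
        ... | inj₁ h = i-j≡0⇒i≡j x y h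
        ... | inj₂ h = ⊥-elim (<-irrefl (sym h) (+-mono-< hx hy))

        -- All large n solve the squared equation, but a hit at n is known only up to sign.
        -- Comparing the squared equations at n and n + 1 gives f² = g² at n + 1; both values are
        -- positive, hence equal, and cancelling them turns the hit at n + 1 into one at n.
        identical : (∀ n → Reduced n) → Goal
        identical red = mapᵉ (λ {n} ((fp , gp) , hn) hit → step n (fp (suc n) (ℕ.n≤1+n n)) (gp (suc n) (ℕ.n≤1+n n)) hn
            hit) ((both (evalℤ f) f>0 ∧ᵉ both (evalℤ g) g>0) ∧ᵉ (suc (weights R.A) , λ k h → h))
          where
            both : ∀ φ → EventuallyPositive φ → Eventually (λ n → ∀ k → n ℕ.≤ k → 0ℤ < φ (+ k))
            both φ (K , h) = K , λ n le k le′ → h k (ℕ.≤-trans le le′)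
            step : ∀ n → 0ℤ < evalℤ f (+ suc n) → 0ℤ < evalℤ g (+ suc n) → suc (weights R.A) ℕ.≤ n → Hit (suc n) → Hit
                n
            step n fp gp hn hit = *-cancelʳ-≡ _ _ (evalℤ f (+ suc n)) {{≢-nonZero (nz (suc n))}}
                (trans (l (partialProduct f n) T (evalℤ f (+ suc n)))
                    (trans hit (trans (sym (l (partialProduct g n) U (evalℤ g (+ suc n))))
                    (cong (partialProduct g n * U *_) (sym f≡g)))))
              where
                l : ∀ x t y → x * t * y ≡ x * y * t
                l = solve-∀
                h₀ : SqHit n
                h₀ = unreduce n hn (red n)
                h₁ : risings F n * (T * T) * values F (+ suc n) ≡ risings F n * (T * T) * values G (+ suc n)
                h₁ = trans (l (risings F n) (T * T) (values F (+ suc n)))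
                    (trans (cong (_* (T * T)) (sym (risings-suc F n)))
                  (trans (square-hit (suc n) hit)
                      (trans (cong (_* (U * U)) (risings-suc G n))
                      (trans (sym (l (risings G n) (U * U) (values G (+ suc n))))
                      (cong (_* values G (+ suc n)) (sym h₀))))))
                F≡G : values F (+ suc n) ≡ values G (+ suc n)
                F≡G = *-cancelˡ-≡ (risings F n * (T * T)) _ _
                    {{≢-nonZero (*-≢0 (risings≢0 F n (nvF n)) (*-≢0 T≢0 T≢0))}} h₁
                f≡g : evalℤ f (+ suc n) ≡ evalℤ g (+ suc n)
                f≡g = pos-sq fp gp (trans (sf (suc n)) (trans F≡G (sym (sg (suc n)))))

        both-empty : M.F′ ≡ [] → M.G′ ≡ [] → Goal
        both-empty eF eG = go (poly-zero-or-eventually≢0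
            ((const-poly c₁ *ᵖ values-poly R.A) -ᵖ (const-poly c₂ *ᵖ values-poly R.B)))
          where
            strip : ∀ n → Reduced n → c₁ * values R.A (+ n) ≡ c₂ * values R.B (+ n)
            strip n h = trans (sym (*-identityʳ _))
                (trans (subst₂ (λ F G → c₁ * values R.A (+ n) * risings F n ≡ c₂ * values R.B (+ n) * risings G n) eF
                eG h) (*-identityʳ _))
            unstrip : ∀ n → c₁ * values R.A (+ n) ≡ c₂ * values R.B (+ n) → Reduced n
            unstrip n h = subst₂ (λ F G → c₁ * values R.A (+ n) * risings F n ≡ c₂ * values R.B (+ n) * risings G n)
                (sym eF) (sym eG) (trans (*-identityʳ _) (trans h (sym (*-identityʳ _))))
            go : (∀ x → c₁ * values R.A x - c₂ * values R.B x ≡ 0ℤ) ⊎ Eventually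
                (λ k → c₁ * values R.A (+ k) - c₂ * values R.B (+ k) ≢ 0ℤ) → Goal
            go (inj₁ z) = identical λ n → unstrip n (i-j≡0⇒i≡j _ _ (z (+ n)))
            go (inj₂ e) = never-reduced (mapᵉ (λ {n} h _ _ red → h (i≡j⇒i-j≡0 (strip n red))) e)

        -- Discriminants left on opposite sides differ, and in one square class equal absolute
        -- values would make them equal. So minimality is strict across the sides, as `gap`
        -- requires.
        bigger : ∀ {q₀ H q} → (∀ {r} → r ∈ H → r ∈ F ++ G) → q₀ ∈ F ++ G → disc q₀ ≢ 0ℤ → (q ∈ H → disc q₀ ≢ disc q) →
          q ∈ H → disc q ≡ 0ℤ ⊎ ∣ disc q₀ ∣ ℕ.≤ ∣ disc q ∣ → disc q ≡ 0ℤ ⊎ ∣ disc q₀ ∣ ℕ.< ∣ disc q ∣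
        bigger H∈ q₀∈ h d q∈ (inj₁ e) = inj₁ e
        bigger {q₀} {H} {q} H∈ q₀∈ h d q∈ (inj₂ le) with ℕ.m≤n⇒m<n∨m≡n le
        ... | inj₁ lt = inj₂ lt
        ... | inj₂ e  = ⊥-elim (d q∈ (same-abs (compat q₀∈ (H∈ q∈)) h e))

        not-square : ∀ {q} → q ∈ F ++ G → disc q ≢ 0ℤ → ¬ IsSquare (disc q)
        not-square q∈ h with irr q∈
        ... | inj₁ e = ⊥-elim (h e)
        ... | inj₂ n = n

        -- `prime-case` expects `q₀` on the left. If it lies in `G′` the equation is reversed, and
        -- `c₁` becomes the constant that must be nonzero.
        minimal-case : c₂ ≢ 0ℤ → ∀ q₀ → MinimalDisc (M.F′ ++ M.G′) q₀ → Goal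
        minimal-case c₂≢0 q₀ (q₀∈ , h , m) with ∈-++⁻ M.F′ q₀∈
        ... | inj₁ q∈ = never-reduced (mapᵉ (λ p _ nv red → p nv red)
            (prime-case q₀ R.B M.G′ (weight q₀ ℕ.+ (weights R.B ℕ.+ weights M.G′)) (ℕ.m≤m+n _ _)
                (ℕ.≤-trans (ℕ.m≤m+n _ _) (ℕ.m≤n+m _ (weight q₀)))
                (ℕ.≤-trans (ℕ.m≤n+m _ (weights R.B)) (ℕ.m≤n+m _ (weight q₀)))
              h (All.map (λ p → p (F′∈ q∈)) R.B-disc) (All.tabulate λ r∈ → compat (F′∈ q∈) (G′∈ r∈))
              (All.tabulate λ r∈ → bigger {q₀} {M.G′} G′∈ (F′∈ q∈) h (λ r∈ → M.disjoint q∈ r∈) r∈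
                  (m (∈-++⁺ʳ M.F′ r∈)))
              R.A M.F′ c₁ c₂ q∈ (not-square (F′∈ q∈) h) c₂≢0))
        ... | inj₂ q∈ = never-reduced (mapᵉ (λ p nv _ red → p nv (sym red))
            (prime-case q₀ R.A M.F′ (weight q₀ ℕ.+ (weights R.A ℕ.+ weights M.F′)) (ℕ.m≤m+n _ _)
                (ℕ.≤-trans (ℕ.m≤m+n _ _) (ℕ.m≤n+m _ (weight q₀)))
                (ℕ.≤-trans (ℕ.m≤n+m _ (weights R.A)) (ℕ.m≤n+m _ (weight q₀)))
              h (All.map (λ p → p (G′∈ q∈)) R.A-disc) (All.tabulate λ r∈ → compat (G′∈ q∈) (F′∈ r∈))
              (All.tabulate λ r∈ → bigger {q₀} {M.F′} F′∈ (G′∈ q∈) h (λ r∈ e → M.disjoint r∈ q∈ (sym e)) r∈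
                  (m (∈-++⁺ˡ r∈)))
              R.B M.G′ c₂ c₁ q∈ (not-square (G′∈ q∈) h) c₁≢0))

        nonzero-case : c₂ ≢ 0ℤ → Goal
        nonzero-case c₂≢0 = go M.F′ M.G′ refl refl
          where
            go : ∀ F′ G′ → M.F′ ≡ F′ → M.G′ ≡ G′ → Goal
            go []       []       eF eG = both-empty eF eG
            go (q ∷ F″) []       eF eG = never-reduced
                (mapᵉ (λ {n} p nv _ red → p (subst (All (NonVanishing n)) eF nv)
                (trans (subst₂ (λ F G → c₁ * values R.A (+ n) * risings F n ≡ c₂ * values R.B (+ n) * risings G n) eF
                    eG red) (*-identityʳ _)))
                (growth-case q F″ R.A R.B c₁ c₂ c₁≢0))
            go []       (q ∷ G″) eF eG = never-reduced
                (mapᵉ (λ {n} p _ nv red → p (subst (All (NonVanishing n)) eG nv)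
                (trans (sym (subst₂ (λ F G → c₁ * values R.A (+ n) * risings F n ≡ c₂ * values R.B (+ n) * risings G
                    n) eF eG red)) (*-identityʳ _)))
                (growth-case q G″ R.B R.A c₂ c₁ c₂≢0))
            go (q ∷ F″) (q′ ∷ G″) eF eG = minimal (minimal-disc (M.F′ ++ M.G′))
              where
                q∈ : q ∈ M.F′
                q∈ = subst (q ∈_) (sym eF) (here refl)
                q′∈ : q′ ∈ M.G′
                q′∈ = subst (q′ ∈_) (sym eG) (here refl)
                minimal : (∀ {q} → q ∈ M.F′ ++ M.G′ → disc q ≡ 0ℤ) ⊎ ∃ (MinimalDisc (M.F′ ++ M.G′)) → Goal
                -- If all remaining discriminants were 0, the two sides would share one.
                minimal (inj₁ z) = ⊥-elim (M.disjoint q∈ q′∈ (trans (z (∈-++⁺ˡ q∈)) (sym (z (∈-++⁺ʳ M.F′ q′∈)))))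
                minimal (inj₂ (q₀ , h)) = minimal-case c₂≢0 q₀ h

      hereditary-nonzero : Eventually (λ n → Hit (suc n) → Hit n)
      hereditary-nonzero = go (c₂ ≟ 0ℤ)
        where
          go : Dec (c₂ ≡ 0ℤ) → Eventually (λ n → Hit (suc n) → Hit n)
          go (no h)  = nonzero-case h
          -- `c₂` is 0 only through `λ′`, that is, through a positive integer zero of a paired
          -- quadratic of `G`. The left-hand side is nonzero for large n.
          go (yes e) = never-reduced (suc (weights R.A) , λ n hn nv _ red →
            *-≢0 (*-≢0 c₁≢0 (values-eventually≢0 R.A n hn)) (risings≢0 M.F′ n nv)
                (trans red (cong (λ z → z * values R.B (+ n) * risings M.G′ n) e)))

    -- If `U` is 0, a hit amounts to `T` being 0, at any index. If only `T` is 0, a hit is a zero of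
    -- the partial product of `g`; once `g` is positive, the last factor is not its source, so the
    -- zero is already there one index earlier.
    hereditary : Eventually (λ n → Hit (suc n) → Hit n)
    hereditary = go (T ≟ 0ℤ) (U ≟ 0ℤ)
      where
        go : Dec (T ≡ 0ℤ) → Dec (U ≡ 0ℤ) → Eventually (λ n → Hit (suc n) → Hit n)
        go (no T≢0) (no U≢0)   = hereditary-nonzero T≢0 U≢0
        go _ (yes refl) = 0 , λ n _ hit → zero-target n
            (*≡0⇒ (partialProduct f (suc n)) T (trans hit (*-zeroʳ (partialProduct g (suc n)))))
          where
            zero-target : ∀ n → partialProduct f (suc n) ≡ 0ℤ ⊎ T ≡ 0ℤ → partialProduct f n * T ≡ partialProduct g n *
                0ℤ
            zero-target n (inj₁ e) = ⊥-elim (X≢0 (suc n) e)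
            zero-target n (inj₂ e) = trans (cong (partialProduct f n *_) e)
                (trans (*-zeroʳ (partialProduct f n)) (sym (*-zeroʳ (partialProduct g n))))
        go (yes refl) (no U≢0) = proj₁ g>0 , λ n hn hit → vanish n hn
            (*≡0⇒ (partialProduct g n * evalℤ g (+ suc n)) U (trans (sym hit) (*-zeroʳ (partialProduct f (suc n)))))
          where
            vanish : ∀ n → proj₁ g>0 ℕ.≤ n → partialProduct g (suc n) ≡ 0ℤ ⊎ U ≡ 0ℤ → partialProduct f n * 0ℤ ≡
                partialProduct g n * U
            vanish n hn (inj₂ e) = ⊥-elim (U≢0 e)
            vanish n hn (inj₁ e) with *≡0⇒ (partialProduct g n) (evalℤ g (+ suc n)) e
            ... | inj₁ z = trans (*-zeroʳ (partialProduct f n)) (cong (_* U) (sym z))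
            ... | inj₂ z = ⊥-elim (<-irrefl (sym z) (proj₂ g>0 (suc n) (ℕ.m≤n⇒m≤1+n hn)))

-- Integrality of rational numbers.

module RatInt where

  open import Data.Nat.Coprimality as C using (Coprime; coprime-divisor)
  open Factor using (n≤2^n)
  open import Data.Integer as ℤ using (ℤ; +_; -[1+_])
  open import Data.Rational
  open import Data.Rational.Properties
  import Data.Rational.Unnormalised as ℚᵘ
  import Data.Rational.Unnormalised.Properties as ℚᵘ
  open import Data.Rational.Solver using (module +-*-Solver)
  open +-*-Solver using (solve; _:=_; _:*_; :-_; _:-_)

  -- Exposes an integer as a normalised fraction, on which the rational operations compute.
  toℚ≡ : ∀ z → toℚ z ≡ mkℚ z 0 (C.sym (C.1-coprimeTo ℤ.∣ z ∣))
  toℚ≡ z = ↥p/↧p≡p (mkℚ z 0 (C.sym (C.1-coprimeTo ℤ.∣ z ∣)))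

  toℚ-injective : ∀ {a b} → toℚ a ≡ toℚ b → a ≡ b
  toℚ-injective {a} {b} e = cong ↥_ (trans (sym (toℚ≡ a)) (trans e (toℚ≡ b)))

  toℚ-+ : ∀ a b → toℚ (a ℤ.+ b) ≡ toℚ a + toℚ b
  toℚ-+ a b = sym (trans (cong₂ _+_ (toℚ≡ a) (toℚ≡ b)) (cong toℚ (cong₂ ℤ._+_ (ℤ.*-identityʳ a) (ℤ.*-identityʳ b))))

  toℚ-* : ∀ a b → toℚ (a ℤ.* b) ≡ toℚ a * toℚ b
  toℚ-* a b = sym (cong₂ _*_ (toℚ≡ a) (toℚ≡ b))

  toℚ-neg : ∀ a → toℚ (ℤ.- a) ≡ - toℚ a
  toℚ-neg (+ zero)    = refl
  toℚ-neg (+ suc n)   = refl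
  toℚ-neg (-[1+ n ])  = sym (solve 1 (λ x → :- (:- x) := x) refl (toℚ (+ suc n)))

  *-denominator : ∀ q → q * toℚ (↧ q) ≡ toℚ (↥ q)
  *-denominator q@record{} = toℚᵘ-injective (ℚᵘ.≃-trans (toℚᵘ-homo-* q (toℚ (↧ q)))
      (ℚᵘ.≃-trans (ℚᵘ.*-congˡ {toℚᵘ q} (toℚᵘ-cong (toℚ≡ (↧ q))))
          (ℚᵘ.≃-trans (ℚᵘ.*≡* (trans (ℤ.*-identityʳ _) (cong (↥ q ℤ.*_) (cong +_ (sym (ℕ.*-identityʳ (↧ₙ q)))))))
          (ℚᵘ.≃-sym (toℚᵘ-cong (toℚ≡ (↥ q)))))))

  Integral : ℚ → Set
  Integral q = ∃ λ z → q ≡ toℚ z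

  integral-+ : ∀ {p q} → Integral p → Integral q → Integral (p + q)
  integral-+ (a , refl) (b , refl) = a ℤ.+ b , sym (toℚ-+ a b)

  integral-* : ∀ {p q} → Integral p → Integral q → Integral (p * q)
  integral-* (a , refl) (b , refl) = a ℤ.* b , sym (toℚ-* a b)

  integral-neg : ∀ {p} → Integral p → Integral (- p)
  integral-neg (a , refl) = ℤ.- a , sym (toℚ-neg a)

  infixr 8 _^ℚ_
  _^ℚ_ : ℚ → ℕ → ℚ
  q ^ℚ zero  = 1ℚ
  q ^ℚ suc j = q * q ^ℚ j

  ^ℚ-distrib : ∀ p q j → (p * q) ^ℚ j ≡ p ^ℚ j * q ^ℚ j
  ^ℚ-distrib p q zero    = refl
  ^ℚ-distrib p q (suc j) = trans (cong (p * q *_) (^ℚ-distrib p q j))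
    (solve 4 (λ p q x y → p :* q :* (x :* y) := (p :* x) :* (q :* y)) refl p q (p ^ℚ j) (q ^ℚ j))

  toℚ-^ : ∀ z j → toℚ z ^ℚ j ≡ toℚ (z ℤ.^ j)
  toℚ-^ z zero    = refl
  toℚ-^ z (suc j) = trans (cong (toℚ z *_) (toℚ-^ z j)) (sym (toℚ-* z (z ℤ.^ j)))

  abs-^ : ∀ z j → ℤ.∣ z ℤ.^ j ∣ ≡ ℤ.∣ z ∣ ℕ.^ j
  abs-^ z zero    = refl
  abs-^ z (suc j) = trans (ℤ.abs-* z (z ℤ.^ j)) (cong (ℤ.∣ z ∣ ℕ.*_) (abs-^ z j))

  coprime-^ˡ : ∀ {a b} j → Coprime a b → Coprime (a ℕ.^ j) b
  coprime-^ˡ zero    c (d∣1 , _) = ℕ.∣1⇒≡1 d∣1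
  coprime-^ˡ {a} (suc j) c (d∣ , d∣b) = coprime-^ˡ j c
      (coprime-divisor (λ (e∣d , e∣a) → c (e∣a , ℕ.∣-trans e∣d d∣b)) d∣ , d∣b)

  lowest-terms : ∀ q → Coprime (↧ₙ q) ℤ.∣ ↥ q ∣
  lowest-terms (mkℚ n d c) = C.sym (C.recompute c)

  -- For ν = u / v in lowest terms, vʲ divides M uʲ and hence M, for every j. If v ≥ 2, the power
  -- with j = M + 1 exceeds M.
  bounded-denominators⇒integral : ∀ ν M → 1 ℕ.≤ M → (∀ j → Integral (toℚ (+ M) * ν ^ℚ j)) → Integral ν
  bounded-denominators⇒integral ν M hM h = go (↧ₙ ν) refl
    where
      u = ↥ ν
      cop : Coprime (↧ₙ ν) ℤ.∣ u ∣
      cop = lowest-terms ν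
      cleared : ∀ j → M ℕ.* ℤ.∣ u ∣ ℕ.^ j ≡ ℤ.∣ proj₁ (h j) ∣ ℕ.* ↧ₙ ν ℕ.^ j
      cleared j = trans (cong (M ℕ.*_) (sym (abs-^ u j)))
          (trans (sym (ℤ.abs-* (+ M) (u ℤ.^ j)))
          (trans (cong ℤ.∣_∣ (toℚ-injective {+ M ℤ.* u ℤ.^ j} {proj₁ (h j) ℤ.* (↧ ν) ℤ.^ j} eq))
          (trans (ℤ.abs-* m ((↧ ν) ℤ.^ j)) (cong (ℤ.∣ m ∣ ℕ.*_) (abs-^ (↧ ν) j)))))
        where
          m = proj₁ (h j)
          eq : toℚ (+ M ℤ.* u ℤ.^ j) ≡ toℚ (m ℤ.* (↧ ν) ℤ.^ j)
          eq = trans (toℚ-* (+ M) (u ℤ.^ j))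
              (trans (cong (toℚ (+ M) *_) (trans (sym (toℚ-^ u j))
              (trans (cong (_^ℚ j) (sym (*-denominator ν))) (^ℚ-distrib ν (toℚ (↧ ν)) j))))
            (trans (sym (*-assoc (toℚ (+ M)) (ν ^ℚ j) _))
                (trans (cong₂ _*_ (proj₂ (h j)) (toℚ-^ (↧ ν) j)) (sym (toℚ-* m ((↧ ν) ℤ.^ j))))))
      v^∣M : ∀ j → ↧ₙ ν ℕ.^ j ℕ.∣ M
      v^∣M j = coprime-divisor {↧ₙ ν ℕ.^ j} {ℤ.∣ u ∣ ℕ.^ j} (coprime-^ˡ j (C.sym (coprime-^ˡ j (C.sym cop))))
        (ℕ.divides ℤ.∣ proj₁ (h j) ∣ (trans (ℕ.*-comm (ℤ.∣ u ∣ ℕ.^ j) M) (cleared j)))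
      go : ∀ v → ↧ₙ ν ≡ v → Integral ν
      go zero () 
      go (suc zero) e = u , trans (sym (*-identityʳ ν)) (trans (cong (λ z → ν * toℚ (+ z)) (sym e)) (*-denominator ν))
      go (suc (suc v)) e = ⊥-elim (ℕ.<⇒≱
          (ℕ.≤-trans (n≤2^n (suc M)) (ℕ.^-monoˡ-≤ (suc M) {2} {suc (suc v)} (s≤s (s≤s z≤n))))
          (ℕ.∣⇒≤ {{ℕ.>-nonZero hM}} (subst (λ w → w ℕ.^ suc M ℕ.∣ M) e (v^∣M (suc M)))))

  -- If ρ² is an integer then the powers of ρ have bounded denominators.
  square-integral⇒integral : ∀ ρ → Integral (ρ * ρ) → Integral ρ
  square-integral⇒integral ρ h = bounded-denominators⇒integral ρ (↧ₙ ρ) (ℕ.>-nonZero⁻¹ (↧ₙ ρ)) go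
    where
      go : ∀ j → Integral (toℚ (↧ ρ) * ρ ^ℚ j)
      go zero          = ↧ ρ , *-identityʳ _
      go (suc zero)    = ↥ ρ , trans (cong (toℚ (↧ ρ) *_) (*-identityʳ ρ)) (trans (*-comm _ ρ) (*-denominator ρ))
      go (suc (suc j)) = subst Integral
          (solve 3 (λ v r x → (v :* x) :* (r :* r) := v :* (r :* (r :* x))) refl (toℚ (↧ ρ)) ρ (ρ ^ℚ j))
          (integral-* (go j) h)

-- Roots in ℚ(√d), their norms, and the resulting integer quadratics.

module Splitting (d : ℚ) where

  open RatInt
  open Quad
  open PrimeCase using (IsSquare)
  open import Data.Integer as ℤ using (ℤ; +_)
  open import Data.Rational
  open import Data.Rational.Properties
  open import Data.Rational.Solver using (module +-*-Solver)
  open +-*-Solver using (solve; _:=_; _:+_; _:*_; :-_; _:-_; con)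
  open import Data.List using (length; _∷ʳ_)

  open QuadField d renaming (_+K_ to infixl 6 _+K_; _*K_ to infixl 7 _*K_)

  evalK : List K → K → K
  evalK []      x = 0K
  evalK (a ∷ p) x = a +K x *K evalK p x

  +K-identityˡ : ∀ z → 0K +K z ≡ z
  +K-identityˡ (a , b) = cong₂ _,_ (+-identityˡ a) (+-identityˡ b)

  +K-identityʳ : ∀ z → z +K 0K ≡ z
  +K-identityʳ (a , b) = cong₂ _,_ (+-identityʳ a) (+-identityʳ b)

  *K-zeroʳ : ∀ z → z *K 0K ≡ 0K
  *K-zeroʳ (a , b) = cong₂ _,_ (solve 3 (λ d a b → a :* con 0ℚ :+ d :* (b :* con 0ℚ) := con 0ℚ) refl d a b)
    (solve 2 (λ a b → a :* con 0ℚ :+ b :* con 0ℚ := con 0ℚ) refl a b)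

  *K-zeroˡ : ∀ z → 0K *K z ≡ 0K
  *K-zeroˡ (a , b) = cong₂ _,_ (solve 3 (λ d a b → con 0ℚ :* a :+ d :* (con 0ℚ :* b) := con 0ℚ) refl d a b)
    (solve 2 (λ a b → con 0ℚ :* b :+ con 0ℚ :* a := con 0ℚ) refl a b)

  *K-identityˡ : ∀ z → 1K *K z ≡ z
  *K-identityˡ (a , b) = cong₂ _,_ (solve 3 (λ d a b → con 1ℚ :* a :+ d :* (con 0ℚ :* b) := a) refl d a b)
    (solve 2 (λ a b → con 1ℚ :* b :+ con 0ℚ :* a := b) refl a b)

  *K-identityʳ : ∀ z → z *K 1K ≡ z
  *K-identityʳ (a , b) = cong₂ _,_ (solve 3 (λ d a b → a :* con 1ℚ :+ d :* (b :* con 0ℚ) := a) refl d a b)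
    (solve 2 (λ a b → a :* con 0ℚ :+ b :* con 1ℚ := b) refl a b)

  *K-assoc : ∀ x y z → (x *K y) *K z ≡ x *K (y *K z)
  *K-assoc (a , b) (c , e) (p , q) = cong₂ _,_
    (solve 7 (λ d a b c e p q → (a :* c :+ d :* (b :* e)) :* p :+ d :* ((a :* e :+ b :* c) :* q) := a :*
        (c :* p :+ d :* (e :* q)) :+ d :* (b :* (c :* q :+ e :* p))) refl d a b c e p q)
    (solve 7 (λ d a b c e p q → (a :* c :+ d :* (b :* e)) :* q :+ (a :* e :+ b :* c) :* p := a :* (c :* q :+ e :* p)
        :+ b :* (c :* p :+ d :* (e :* q))) refl d a b c e p q)

  *K-comm : ∀ x y → x *K y ≡ y *K x
  *K-comm (a , b) (c , e) = cong₂ _,_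
    (solve 5 (λ d a b c e → a :* c :+ d :* (b :* e) := c :* a :+ d :* (e :* b)) refl d a b c e)
    (solve 4 (λ a b c e → a :* e :+ b :* c := c :* b :+ e :* a) refl a b c e)

  *K-distribˡ : ∀ x y z → x *K (y +K z) ≡ x *K y +K x *K z
  *K-distribˡ (a , b) (c , e) (p , q) = cong₂ _,_
    (solve 7 (λ d a b c e p q → a :* (c :+ p) :+ d :* (b :* (e :+ q)) := (a :* c :+ d :* (b :* e)) :+
        (a :* p :+ d :* (b :* q))) refl d a b c e p q)
    (solve 6 (λ a b c e p q → a :* (e :+ q) :+ b :* (c :+ p) := (a :* e :+ b :* c) :+ (a :* q :+ b :* p)) refl a b c e
        p q)

  *K-distribʳ : ∀ z x y → (x +K y) *K z ≡ x *K z +K y *K z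
  *K-distribʳ z x y = trans (*K-comm (x +K y) z) (trans (*K-distribˡ z x y) (cong₂ _+K_ (*K-comm z x) (*K-comm z y)))

  +K-interchange : ∀ x y z w → (x +K y) +K (z +K w) ≡ (x +K z) +K (y +K w)
  +K-interchange (a , a′) (b , b′) (c , c′) (e , e′) = cong₂ _,_ (l a b c e) (l a′ b′ c′ e′)
    where l : ∀ a b c e → (a + b) + (c + e) ≡ (a + c) + (b + e)
          l = solve 4 (λ a b c e → (a :+ b) :+ (c :+ e) := (a :+ c) :+ (b :+ e)) refl

  eval-padd : ∀ p q x → evalK (padd p q) x ≡ evalK p x +K evalK q x
  eval-padd []      q       x = sym (+K-identityˡ (evalK q x))
  eval-padd (a ∷ p) []      x = sym (+K-identityʳ (evalK (a ∷ p) x))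
  eval-padd (a ∷ p) (b ∷ q) x = trans (cong (λ z → (a +K b) +K x *K z) (eval-padd p q x))
    (trans (cong ((a +K b) +K_) (*K-distribˡ x (evalK p x) (evalK q x)))
        (+K-interchange a b (x *K evalK p x) (x *K evalK q x)))

  *K-swap : ∀ x y z → x *K (y *K z) ≡ y *K (x *K z)
  *K-swap x y z = trans (sym (*K-assoc x y z)) (trans (cong (_*K z) (*K-comm x y)) (*K-assoc y x z))

  eval-pscale : ∀ c p x → evalK (pscale c p) x ≡ c *K evalK p x
  eval-pscale c []      x = sym (*K-zeroʳ c)
  eval-pscale c (a ∷ p) x = trans (cong (λ z → c *K a +K x *K z) (eval-pscale c p x))
    (trans (cong (c *K a +K_) (*K-swap x c (evalK p x))) (sym (*K-distribˡ c a (x *K evalK p x))))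

  eval-pmul : ∀ p q x → evalK (pmul p q) x ≡ evalK p x *K evalK q x
  eval-pmul []      q x = sym (*K-zeroˡ (evalK q x))
  eval-pmul (a ∷ p) q x = trans (eval-padd (pscale a q) (0K ∷ pmul p q) x)
    (trans (cong₂ _+K_ (eval-pscale a q x)
        (trans (+K-identityˡ _) (trans (cong (x *K_) (eval-pmul p q x)) (sym (*K-assoc x (evalK p x) (evalK q x))))))
      (sym (*K-distribʳ (evalK q x) a (x *K evalK p x))))

  rootProduct : List K → K → K
  rootProduct []       x = 1K
  rootProduct (r ∷ rs) x = (x +K (-K r)) *K rootProduct rs x

  eval-prodLin : ∀ rs x → evalK (prodLin rs) x ≡ rootProduct rs x
  eval-prodLin []       x = trans (cong (1K +K_) (*K-zeroʳ x)) (+K-identityʳ 1K)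
  eval-prodLin (r ∷ rs) x = trans (eval-pmul ((-K r) ∷ 1K ∷ []) (prodLin rs) x)
    (cong₂ _*K_ (trans (cong (λ z → (-K r) +K x *K (1K +K z)) (*K-zeroʳ x))
        (trans (cong (λ z → (-K r) +K x *K z) (+K-identityʳ 1K))
        (trans (cong ((-K r) +K_) (*K-identityʳ x)) (+K-comm (-K r) x))))
      (eval-prodLin rs x))
    where
      +K-comm : ∀ x y → x +K y ≡ y +K x
      +K-comm (a , b) (c , e) = cong₂ _,_ (+-comm a c) (+-comm b e)

  root-vanishes : ∀ {r rs} → r ∈ rs → rootProduct rs r ≡ 0K
  root-vanishes {r} {_ ∷ rs} (here refl) = trans (cong (_*K rootProduct rs r) (cancel r))
      (*K-zeroˡ (rootProduct rs r))
    where cancel : ∀ r → r +K (-K r) ≡ 0K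
          cancel (a , b) = cong₂ _,_ (+-inverseʳ a) (+-inverseʳ b)
  root-vanishes {r} {s ∷ rs} (there r∈) = trans (cong ((r +K (-K s)) *K_) (root-vanishes r∈)) (*K-zeroʳ (r +K (-K s)))

  ι : ℤ → K
  ι z = toℚ z , 0ℚ

  eval-embed : ∀ f k → evalK (embed f) (ι k) ≡ ι (evalℤ f k)
  eval-embed []      k = refl
  eval-embed (a ∷ f) k = trans (cong (λ z → ι a +K ι k *K z) (eval-embed f k)) (cong₂ _,_
    (trans (solve 4 (λ d a k e → a :+ (k :* e :+ d :* (con 0ℚ :* con 0ℚ)) := a :+ k :* e) refl d (toℚ a) (toℚ k)
        (toℚ (evalℤ f k)))
      (trans (cong (λ z → toℚ a + z) (sym (toℚ-* k (evalℤ f k)))) (sym (toℚ-+ a (k ℤ.* evalℤ f k)))))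
    (solve 2 (λ k e → con 0ℚ :+ (k :* con 0ℚ :+ con 0ℚ :* e) := con 0ℚ) refl (toℚ k) (toℚ (evalℤ f k))))

  norm : K → ℚ
  norm (a , b) = a * a - d * (b * b)

  norm-* : ∀ x y → norm (x *K y) ≡ norm x * norm y
  norm-* (a , b) (c , e) = solve 5
      (λ d a b c e → (a :* c :+ d :* (b :* e)) :* (a :* c :+ d :* (b :* e)) :- d :*
      ((a :* e :+ b :* c) :* (a :* e :+ b :* c))
    := (a :* a :- d :* (b :* b)) :* (c :* c :- d :* (e :* e))) refl d a b c e

  norm-ι : ∀ z → norm (ι z) ≡ toℚ (z ℤ.* z)
  norm-ι z = trans (solve 2 (λ d z → z :* z :- d :* (con 0ℚ :* con 0ℚ) := z :* z) refl d (toℚ z)) (sym (toℚ-* z z))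

  infixr 8 _^K_
  _^K_ : K → ℕ → K
  z ^K zero  = 1K
  z ^K suc j = z *K z ^K j

  norm-^ : ∀ z j → norm (z ^K j) ≡ norm z ^ℚ j
  norm-^ z zero    = solve 1 (λ d → con 1ℚ :* con 1ℚ :- d :* (con 0ℚ :* con 0ℚ) := con 1ℚ) refl d
  norm-^ z (suc j) = trans (norm-* z (z ^K j)) (cong (norm z *_) (norm-^ z j))

  IntegralAt : ℕ → K → Set
  IntegralAt N (a , b) = Integral (toℚ (+ N) * a) × Integral (toℚ (+ N) * b)

  module _ (N : ℕ) where

    integralAt-+ : ∀ {x y} → IntegralAt N x → IntegralAt N y → IntegralAt N (x +K y)
    integralAt-+ {a , b} {c , e} (ia , ib) (ic , ie) = subst Integral (sym (*-distribˡ-+ (toℚ (+ N)) a c))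
        (integral-+ ia ic)
      , subst Integral (sym (*-distribˡ-+ (toℚ (+ N)) b e)) (integral-+ ib ie)

    integralAt-neg : ∀ {x} → IntegralAt N x → IntegralAt N (-K x)
    integralAt-neg {a , b} (ia , ib) = subst Integral
        (solve 2 (λ n a → :- (n :* a) := n :* (:- a)) refl (toℚ (+ N)) a) (integral-neg ia)
      , subst Integral (solve 2 (λ n a → :- (n :* a) := n :* (:- a)) refl (toℚ (+ N)) b) (integral-neg ib)

    integralAt-ι* : ∀ z {x} → IntegralAt N x → IntegralAt N (ι z *K x)
    integralAt-ι* z {a , b} (ia , ib) =
        subst Integral (solve 5 (λ n d z a b → z :* (n :* a) := n :* (z :* a :+ d :* (con 0ℚ :* b))) refl (toℚ (+ N))
            d (toℚ z) a b) (integral-* (z , refl) ia)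
      , subst Integral (solve 4 (λ n z a b → z :* (n :* b) := n :* (z :* b :+ con 0ℚ :* a)) refl (toℚ (+ N)) (toℚ z) a
          b) (integral-* (z , refl) ib)

    integralAt-norm : ∀ x → IntegralAt N x → Integral (toℚ (+ (N ℕ.* N ℕ.* ↧ₙ d)) * norm x)
    integralAt-norm (a , b) (ia , ib) = subst Integral (trans
        (solve 5 (λ n d v a b → v :* ((n :* a) :* (n :* a)) :+ (:- ((d :* v) :* ((n :* b) :* (n :* b)))) :=
            (n :* n :* v) :* (a :* a :- d :* (b :* b))) refl (toℚ (+ N)) d (toℚ (↧ d)) a b)
        (cong (_* (a * a - d * (b * b))) scale))
            (integral-+ (integral-* (↧ d , refl) (integral-* ia ia))
            (integral-neg (integral-* (↥ d , *-denominator d) (integral-* ib ib))))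
      where
        scale : toℚ (+ N) * toℚ (+ N) * toℚ (↧ d) ≡ toℚ (+ (N ℕ.* N ℕ.* ↧ₙ d))
        scale = trans (cong (_* toℚ (↧ d)) (sym (toℚ-* (+ N) (+ N))))
            (trans (sym (toℚ-* (+ N ℤ.* + N) (↧ d)))
            (cong toℚ (trans (cong (ℤ._* ↧ d) (sym (ℤ.pos-* N N))) (sym (ℤ.pos-* (N ℕ.* N) (↧ₙ d))))))

    integralAt-0 : IntegralAt N 0K
    integralAt-0 = (+ 0 , *-zeroʳ (toℚ (+ N))) , (+ 0 , *-zeroʳ (toℚ (+ N)))

  integralAt-multiple : ∀ N M {x} → IntegralAt N x → IntegralAt (N ℕ.* M) x
  integralAt-multiple N M {a , b} (ia , ib) = go a ia , go b ib
    where
      go : ∀ a → Integral (toℚ (+ N) * a) → Integral (toℚ (+ (N ℕ.* M)) * a)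
      go a ia = subst Integral (trans
          (solve 3 (λ n m a → m :* (n :* a) := n :* m :* a) refl (toℚ (+ N)) (toℚ (+ M)) a)
        (cong (_* a) (trans (sym (toℚ-* (+ N) (+ M))) (cong toℚ (sym (ℤ.pos-* N M)))))) (integral-* (+ M , refl) ia)

  common-denominator : (φ : ℕ → K) → ∀ n → ∃ λ N → 1 ℕ.≤ N × (∀ j → j ℕ.< n → IntegralAt N (φ j))
  common-denominator φ zero    = 1 , s≤s z≤n , λ j ()
  common-denominator φ (suc n) = go (common-denominator φ n)
    where
      v w : ℕ
      v = ↧ₙ proj₁ (φ n)
      w = ↧ₙ proj₂ (φ n)
      single : ∀ q → Integral (toℚ (+ ↧ₙ q) * q)
      single q = ↥ q , trans (*-comm _ q) (*-denominator q)
      at : ∀ N → IntegralAt (N ℕ.* (v ℕ.* w)) (φ n)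
      at N = subst (λ z → Integral (toℚ (+ z) * proj₁ (φ n))) (l₁ v w N)
          (times (w ℕ.* N) v (proj₁ (φ n)) (single (proj₁ (φ n))))
           , subst (λ z → Integral (toℚ (+ z) * proj₂ (φ n))) (l₂ v w N)
               (times (v ℕ.* N) w (proj₂ (φ n)) (single (proj₂ (φ n))))
        where
          open import Data.Nat.Tactic.RingSolver using (solve-∀)
          times : ∀ M v q → Integral (toℚ (+ v) * q) → Integral (toℚ (+ (v ℕ.* M)) * q)
          times M v q h = proj₁ (integralAt-multiple v M {q , q} (h , h))
          l₁ : ∀ v w N → v ℕ.* (w ℕ.* N) ≡ N ℕ.* (v ℕ.* w)
          l₁ = solve-∀
          l₂ : ∀ v w N → w ℕ.* (v ℕ.* N) ≡ N ℕ.* (v ℕ.* w)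
          l₂ = solve-∀
      go : (∃ λ N → 1 ℕ.≤ N × (∀ j → j ℕ.< n → IntegralAt N (φ j))) → ∃ λ N → 1 ℕ.≤ N ×
          (∀ j → j ℕ.< suc n → IntegralAt N (φ j))
      go (N , hN , h) = N ℕ.* (v ℕ.* w) , ℕ.*-mono-≤ hN (ℕ.*-mono-≤ (ℕ.>-nonZero⁻¹ v) (ℕ.>-nonZero⁻¹ w)) , λ j j<sn →
          pick j (ℕ.m≤n⇒m<n∨m≡n (ℕ.s≤s⁻¹ j<sn))
        where
          pick : ∀ j → j ℕ.< n ⊎ j ≡ n → IntegralAt (N ℕ.* (v ℕ.* w)) (φ j)
          pick j (inj₁ j<n)  = integralAt-multiple N (v ℕ.* w) {φ j} (h j j<n)
          pick j (inj₂ refl) = at N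

  -- A root of a monic integer polynomial: its powers have a common denominator, hence so have
  -- the powers of k - r, and the powers of the rational number norm (k - r).
  module MonicRoot (cs : List ℤ) (r : K) (root : evalK (embed (cs ∷ʳ + 1)) r ≡ 0K) where

    private
      n = length cs

    module _ (N : ℕ) (low : ∀ j → j ℕ.< n → IntegralAt N (r ^K j)) where

      -- The relation f(r) = 0 times rᵐ expresses a higher power through lower ones with integer
      -- coefficients. Coefficients are removed from the low end; this destroys vanishing but not
      -- integrality at `N`, so only the latter is assumed of the whole.
      next-power : ∀ cs m → (∀ i → i ℕ.< length cs → IntegralAt N (r ^K (m ℕ.+ i))) →
        IntegralAt N (r ^K m *K evalK (embed (cs ∷ʳ + 1)) r) → IntegralAt N (r ^K (m ℕ.+ length cs))
      next-power [] m h whole = subst (IntegralAt N)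
          (trans (cong (r ^K m *K_) (trans (cong (1K +K_) (*K-zeroʳ r)) (+K-identityʳ 1K)))
        (trans (*K-identityʳ (r ^K m)) (cong (r ^K_) (sym (ℕ.+-identityʳ m))))) whole
      next-power (a ∷ cs) m h whole = subst (λ z → IntegralAt N (r ^K z)) (sym (ℕ.+-suc m (length cs)))
          (next-power cs (suc m) (λ i i< → subst (λ z → IntegralAt N (r ^K z)) (ℕ.+-suc m i) (h (suc i) (s≤s i<)))
            (subst (IntegralAt N) (trans (cong (_+K (-K (ι a *K r ^K m))) expand) (cancel (ι a *K r ^K m) _))
                (integralAt-+ N whole (integralAt-neg N (integralAt-ι* N a h₀)))))
        where
          E = evalK (embed (cs ∷ʳ + 1)) r
          h₀ : IntegralAt N (r ^K m)
          h₀ = subst (λ z → IntegralAt N (r ^K z)) (ℕ.+-identityʳ m) (h 0 (s≤s z≤n))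
          expand : r ^K m *K (ι a +K r *K E) ≡ ι a *K r ^K m +K (r *K r ^K m) *K E
          expand = trans (*K-distribˡ (r ^K m) (ι a) (r *K E))
              (cong₂ _+K_ (*K-comm (r ^K m) (ι a))
              (trans (sym (*K-assoc (r ^K m) r E)) (cong (_*K E) (*K-comm (r ^K m) r))))
          cancel : ∀ x y → (x +K y) +K (-K x) ≡ y
          cancel (a , b) (c , e) = cong₂ _,_ (l a c) (l b e)
            where l : ∀ a c → (a + c) + - a ≡ c
                  l = solve 2 (λ a c → (a :+ c) :+ (:- a) := c) refl

      powers : ∀ j → IntegralAt N (r ^K j)
      powers j = go cs refl
        where
          whole : ∀ m → IntegralAt N (r ^K m *K evalK (embed (cs ∷ʳ + 1)) r)
          whole m = subst (IntegralAt N) (sym (trans (cong (r ^K m *K_) root) (*K-zeroʳ (r ^K m)))) (integralAt-0 N)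
          windows : ∀ m i → i ℕ.< n → IntegralAt N (r ^K (m ℕ.+ i))
          windows zero    i i<n = low i i<n
          windows (suc m) i i<n = pick (ℕ.m≤n⇒m<n∨m≡n i<n)
            where
              pick : suc i ℕ.< n ⊎ suc i ≡ n → IntegralAt N (r ^K (suc m ℕ.+ i))
              pick (inj₁ lt) = subst (λ z → IntegralAt N (r ^K z)) (ℕ.+-suc m i) (windows m (suc i) lt)
              pick (inj₂ e)  = subst (λ z → IntegralAt N (r ^K z)) (trans (cong (m ℕ.+_) (sym e)) (ℕ.+-suc m i))
                  (next-power cs m (windows m) (whole m))
          go : ∀ cs′ → cs ≡ cs′ → IntegralAt N (r ^K j)
          -- For the constant polynomial 1 the window of known powers is empty, and `next-power`
          -- yields each power by itself.
          go [] e = subst (λ z → IntegralAt N (r ^K z)) (trans (cong (λ z → j ℕ.+ length z) e) (ℕ.+-identityʳ j))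
            (next-power cs j (windows j) (whole j))
          go (a ∷ cs′) e = subst (λ z → IntegralAt N (r ^K z)) (ℕ.+-identityʳ j)
              (windows j 0 (subst (λ z → 1 ℕ.≤ length z) (sym e) (s≤s z≤n)))

      linear : ℤ → K
      linear k = ι k +K (-K r)

      -- Multiplication by `z` keeps the ring generated by `r` within denominator `N`. As this
      -- property survives multiplication by k - r, all powers of k - r have the same denominator
      -- bound.
      Stable : K → Set
      Stable z = ∀ j → IntegralAt N (z *K r ^K j)

      stable-linear : ∀ z k → Stable z → Stable (linear k *K z)
      stable-linear z k h j = subst (IntegralAt N) (sym eq)
          (integralAt-+ N (integralAt-ι* N k (h j)) (integralAt-neg N (h (suc j))))
        where
          minus : ∀ r z p → ((-K r) *K z) *K p ≡ -K (z *K (r *K p))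
          minus (a , b) (c , e) (p , q) = cong₂ _,_
            (solve 7 (λ d a b c e p q → ((:- a) :* c :+ d :* ((:- b) :* e)) :* p :+ d :*
                (((:- a) :* e :+ (:- b) :* c) :* q) := :-
                (c :* (a :* p :+ d :* (b :* q)) :+ d :* (e :* (a :* q :+ b :* p)))) refl d a b c e p q)
            (solve 7 (λ d a b c e p q → ((:- a) :* c :+ d :* ((:- b) :* e)) :* q :+ ((:- a) :* e :+ (:- b) :* c) :* p
                := :- (c :* (a :* q :+ b :* p) :+ e :* (a :* p :+ d :* (b :* q)))) refl d a b c e p q)
          eq : (linear k *K z) *K r ^K j ≡ ι k *K (z *K r ^K j) +K (-K (z *K (r *K r ^K j)))
          eq = trans (cong (_*K r ^K j) (*K-distribʳ z (ι k) (-K r)))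
              (trans (*K-distribʳ (r ^K j) (ι k *K z) ((-K r) *K z))
              (cong₂ _+K_ (*K-assoc (ι k) z (r ^K j)) (minus r z (r ^K j))))

      stable-power : ∀ k j → Stable (linear k ^K j)
      stable-power k zero    j = subst (IntegralAt N) (sym (*K-identityˡ (r ^K j))) (powers j)
      stable-power k (suc i) = stable-linear (linear k ^K i) k (stable-power k i)

      linear-power : ∀ k j → IntegralAt N (linear k ^K j)
      linear-power k j = subst (IntegralAt N) (*K-identityʳ (linear k ^K j)) (stable-power k j 0)

      norm-linear : 1 ℕ.≤ N → ∀ k → Integral (norm (linear k))
      norm-linear hN k = bounded-denominators⇒integral (norm (linear k)) (N ℕ.* N ℕ.* ↧ₙ d)
          (ℕ.*-mono-≤ (ℕ.*-mono-≤ hN hN) (ℕ.>-nonZero⁻¹ (↧ₙ d)))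
        λ j → subst (λ z → Integral (toℚ (+ (N ℕ.* N ℕ.* ↧ₙ d)) * z)) (norm-^ (linear k) j)
            (integralAt-norm N (linear k ^K j) (linear-power k j))

    norm-integral : ∀ k → Integral (norm (ι k +K (-K r)))
    norm-integral k = go (common-denominator (r ^K_) n)
      where
        go : (∃ λ N → 1 ℕ.≤ N × (∀ j → j ℕ.< n → IntegralAt N (r ^K j))) → Integral (norm (ι k +K (-K r)))
        go (N , hN , low) = norm-linear N low hN k

  -- A root α + β√d gives the discriminant 4 d β²: zero if the root is rational, otherwise in the
  -- square class of `d`.
  DiscForm : Quad → Set
  DiscForm q = ∃ λ β → toℚ (disc q) ≡ toℚ (+ 4) * d * (β * β)

  -- The norm of x - r is x² + b x + c. Its values at 0 and 1 are c and 1 + b + c, so integrality of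
  -- these two makes `b` and `c` integers.
  minimal-quad : ∀ r → (∀ k → Integral (norm (ι k +K (-K r)))) → ∃ λ q → (∀ k → toℚ (q at k) ≡ norm (ι k +K (-K r))) ×
      DiscForm q
  minimal-quad (a , β) h = go (h (+ 0)) (h (+ 1))
    where
      go : Integral (norm (ι (+ 0) +K (-K (a , β)))) → Integral (norm (ι (+ 1) +K (-K (a , β)))) → _
      go (z₀ , e₀) (z₁ , e₁) = (b , z₀) , at≡ , β , disc≡
        where
          b = z₁ ℤ.- z₀ ℤ.- + 1
          b≡ : toℚ b ≡ - (toℚ (+ 2) * a)
          b≡ = trans (toℚ-+ (z₁ ℤ.- z₀) (ℤ.- + 1))
              (trans (cong (_+ toℚ (ℤ.- + 1))
              (trans (toℚ-+ z₁ (ℤ.- z₀)) (cong₂ _+_ (sym e₁) (trans (toℚ-neg z₀) (cong -_ (sym e₀))))))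
            (solve 3 (λ d a β → ((con 1ℚ :+ (:- a)) :* (con 1ℚ :+ (:- a)) :- d :*
                ((con 0ℚ :+ (:- β)) :* (con 0ℚ :+ (:- β)))) :+
                (:- ((con 0ℚ :+ (:- a)) :* (con 0ℚ :+ (:- a)) :- d :* ((con 0ℚ :+ (:- β)) :* (con 0ℚ :+ (:- β))))) :+
                con (toℚ (ℤ.- + 1)) := :- (con (toℚ (+ 2)) :* a)) refl d a β))
          c≡ : toℚ z₀ ≡ a * a - d * (β * β)
          c≡ = trans (sym e₀) (solve 3 (λ d a β → (con 0ℚ :+ (:- a)) :* (con 0ℚ :+ (:- a)) :- d :*
              ((con 0ℚ :+ (:- β)) :* (con 0ℚ :+ (:- β))) := a :* a :- d :* (β :* β)) refl d a β)
          at≡ : ∀ k → toℚ ((b , z₀) at k) ≡ norm (ι k +K (-K (a , β)))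
          at≡ k = trans (toℚ-+ (k ℤ.* k ℤ.+ b ℤ.* k) z₀)
              (trans (cong₂ _+_ (trans (toℚ-+ (k ℤ.* k) (b ℤ.* k))
              (cong₂ _+_ (toℚ-* k k) (trans (toℚ-* b k) (cong (_* toℚ k) b≡)))) c≡)
            (solve 4 (λ d a β k → k :* k :+ (:- (con (toℚ (+ 2)) :* a)) :* k :+ (a :* a :- d :* (β :* β)) :=
                (k :+ (:- a)) :* (k :+ (:- a)) :- d :* ((con 0ℚ :+ (:- β)) :* (con 0ℚ :+ (:- β)))) refl d a β
                (toℚ k)))
          disc≡ : toℚ (disc (b , z₀)) ≡ toℚ (+ 4) * d * (β * β)
          disc≡ = trans (toℚ-+ (b ℤ.* b) (ℤ.- (+ 4 ℤ.* z₀)))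
              (trans (cong₂ _+_ (trans (toℚ-* b b) (cong₂ _*_ b≡ b≡))
              (trans (toℚ-neg (+ 4 ℤ.* z₀)) (cong -_ (trans (toℚ-* (+ 4) z₀) (cong (toℚ (+ 4) *_) c≡)))))
            (solve 3 (λ d a β → (:- (con (toℚ (+ 2)) :* a)) :* (:- (con (toℚ (+ 2)) :* a)) :+
                (:- (con (toℚ (+ 4)) :* (a :* a :- d :* (β :* β)))) := con (toℚ (+ 4)) :* d :* (β :* β)) refl d a β))

  QuadFactors : List K → Set
  QuadFactors rs = ∃ λ F → length F ≡ length rs × (∀ k → toℚ (values F k) ≡ norm (rootProduct rs (ι k))) × All
      DiscForm F

  quad-factors : ∀ rs → (∀ {r} → r ∈ rs → ∀ k → Integral (norm (ι k +K (-K r)))) → QuadFactors rs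
  quad-factors [] h = [] , refl ,
      (λ k → sym (solve 1 (λ d → con 1ℚ :* con 1ℚ :- d :* (con 0ℚ :* con 0ℚ) := con 1ℚ) refl d)) , []
  quad-factors (r ∷ rs) h = go (minimal-quad r (h (here refl))) (quad-factors rs (λ r∈ → h (there r∈)))
    where
      go : (∃ λ q → (∀ k → toℚ (q at k) ≡ norm (ι k +K (-K r))) × DiscForm q) → QuadFactors rs → QuadFactors (r ∷ rs)
      go (q , at≡ , df) (F , len , vals , dfs) = q ∷ F , cong suc len
        , (λ k → trans (toℚ-* (q at k) (values F k))
            (trans (cong₂ _*_ (at≡ k) (vals k)) (sym (norm-* (ι k +K (-K r)) (rootProduct rs (ι k))))))
        , df ∷ dfs

  length-padd : ∀ p q → length (padd p q) ≡ length p ℕ.⊔ length q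
  length-padd []      q       = refl
  length-padd (a ∷ p) []      = refl
  length-padd (a ∷ p) (b ∷ q) = cong suc (length-padd p q)

  -- The number of roots is the degree; it fixes the length of the lists to be searched.
  length-prodLin : ∀ rs → length (prodLin rs) ≡ suc (length rs)
  length-prodLin []       = refl
  length-prodLin (r ∷ rs) = trans (go (prodLin rs) (length-prodLin rs)) (cong suc (length-prodLin rs))
    where
      open import Data.List.Properties using (length-map)
      go : ∀ q → length q ≡ suc (length rs) → length (pmul ((-K r) ∷ 1K ∷ []) q) ≡ suc (length q)
      go (a ∷ q) _ = cong suc (trans (length-padd (pscale (-K r) q) _)
          (trans (cong₂ ℕ._⊔_ (length-map _ q)
          (trans (cong suc (trans (length-padd (pscale 1K q) [])
          (trans (cong (ℕ._⊔ 0) (length-map _ q)) (ℕ.⊔-identityʳ (length q))))) refl))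
        (ℕ.m≤n⇒m⊔n≡n (ℕ.n≤1+n (length q)))))

  splits⇒quad-factors : ∀ {f} → Monic f → SplitsOver f →
    ∃ λ F → suc (length F) ≡ length f × (∀ k → evalℤ f k ℤ.* evalℤ f k ≡ values F k) × All DiscForm F
  splits⇒quad-factors {f} (cs , refl) (rs , e) = go (quad-factors rs λ {r} r∈ → MonicRoot.norm-integral cs r
      (trans (cong (λ p → evalK p r) e) (trans (eval-prodLin rs r) (root-vanishes r∈))))
    where
      open import Data.List.Properties using (length-map)
      go : QuadFactors rs → ∃ λ F → suc (length F) ≡ length f × (∀ k → evalℤ f k ℤ.* evalℤ f k ≡ values F k) × All
          DiscForm F
      go (F , len , vals , dfs) = F , trans (cong suc len)
          (trans (sym (length-prodLin rs)) (trans (cong length (sym e)) (length-map _ f)))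
        , (λ k → toℚ-injective {evalℤ f k ℤ.* evalℤ f k} {values F k}
            (trans (sym (norm-ι (evalℤ f k)))
            (trans (cong norm (trans (sym (eval-embed f k))
            (trans (cong (λ p → evalK p (ι k)) e) (eval-prodLin rs (ι k))))) (sym (vals k)))))
        , dfs

  -- The product is the square of 4 d β β′, a rational number with integer square, hence an integer.
  discForm-compatible : ∀ {q q′} → DiscForm q → DiscForm q′ → IsSquare (disc q ℤ.* disc q′)
  discForm-compatible {q} {q′} (β , e) (β′ , e′) = go (square-integral⇒integral ρ (disc q ℤ.* disc q′ , sq))
    where
      ρ = toℚ (+ 4) * d * β * β′
      sq : ρ * ρ ≡ toℚ (disc q ℤ.* disc q′)
      sq = trans (solve 4 (λ f d b c → (f :* d :* b :* c) :* (f :* d :* b :* c) := (f :* d :* (b :* b)) :*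
          (f :* d :* (c :* c))) refl (toℚ (+ 4)) d β β′)
        (trans (cong₂ _*_ (sym e) (sym e′)) (sym (toℚ-* (disc q) (disc q′))))
      go : Integral ρ → IsSquare (disc q ℤ.* disc q′)
      go (z , ρ≡) = z , toℚ-injective {z ℤ.* z} {disc q ℤ.* disc q′}
          (trans (toℚ-* z z) (trans (cong₂ _*_ (sym ρ≡) (sym ρ≡)) sq))

  -- If β ≠ 0 and 4 d β² = z², then `d` is the square of z / (2β).
  discForm-irreducible : NonSquare d → ∀ {q} → DiscForm q → disc q ≡ + 0 ⊎ ¬ IsSquare (disc q)
  discForm-irreducible nsq {q} (β , e) = go (β ≟ 0ℚ)
    where
      go : Dec (β ≡ 0ℚ) → disc q ≡ + 0 ⊎ ¬ IsSquare (disc q)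
      go (yes refl) = inj₁ (toℚ-injective {disc q} {+ 0}
          (trans e (solve 2 (λ f d → f :* d :* (con 0ℚ :* con 0ℚ) := con 0ℚ) refl (toℚ (+ 4)) d)))
      go (no β≢0) = inj₂ λ (z , zz) → nsq (toℚ z * (½ * i)) (trans
          (trans (solve 3 (λ z h i → (z :* (h :* i)) :* (z :* (h :* i)) := (z :* z) :* (h :* h) :* (i :* i)) refl
              (toℚ z) ½ i)
            (cong (λ x → x * (½ * ½) * (i * i)) (trans (sym (toℚ-* z z)) (trans (cong toℚ zz) e))))
          (trans (solve 5 (λ f d b h i → f :* d :* (b :* b) :* (h :* h) :* (i :* i) := (f :* (h :* h)) :* d :*
              ((b :* i) :* (b :* i))) refl (toℚ (+ 4)) d β ½ i)
            (trans (cong (λ y → toℚ (+ 4) * (½ * ½) * d * (y * y)) (*-inverseʳ β))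
                (solve 1 (λ d → con (toℚ (+ 4)) :* (con ½ :* con ½) :* d :* (con 1ℚ :* con 1ℚ) := d) refl d))))
        where
          instance _ = ≢-nonZero β≢0
          i = 1/ β

-- Recovering the quadratic factors by a finite search.

module Candidates where

  open IntDiv
  open Quad
  open PrimeCase using (IsSquare)
  open PolyZ
  open Hereditary using (SquareFactors; Irreducible⊎Zero)
  open Splitting using (splits⇒quad-factors; discForm-compatible; discForm-irreducible; DiscForm)
  open import Data.Integer hiding (suc; pred; _≤?_; _<?_)
  open import Data.Integer.Properties hiding (_≤?_; _<?_)
  open import Data.Integer.Divisibility.Signed renaming (_∣_ to _∥_; _∣?_ to _∥?_)
  open import Data.Integer.Tactic.RingSolver using (solve-∀)
  open import Data.List using (map; _++_; upTo; length; cartesianProduct; cartesianProductWith; initLast; _∷ʳ′_)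
  open import Data.List.Properties using (∷ʳ-injectiveʳ)
  open import Data.List.Relation.Unary.All.Properties using (++⁺)
  open import Data.List.Relation.Unary.Any using (Any; any?)
  open import Data.List.Membership.Propositional using (find; lose)
  open import Data.List.Membership.Propositional.Properties using
      (∈-cartesianProduct⁺; ∈-cartesianProductWith⁺; ∈-map⁺; ∈-upTo⁺)
  open import Relation.Nullary.Decidable using (_×-dec_; _⊎-dec_; map′; recompute)

  monic? : ∀ p → Dec (Monic p)
  monic? p with initLast p
  ... | []       = no λ { ([] , ()) ; (_ ∷ _ , ()) }
  ... | cs ∷ʳ′ a with a ≟ + 1
  ...   | yes refl = yes (cs , refl)
  ...   | no a≢1   = no λ (cs′ , e) → a≢1 (∷ʳ-injectiveʳ cs cs′ e)

  isSquare? : ∀ z → Dec (IsSquare z)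
  isSquare? z = map′ (λ (n , _ , e) → + n , e)
      (λ (e , ee) → ∣ e ∣ , s≤s (bound e ee) , trans (sym (pos-* ∣ e ∣ ∣ e ∣)) (trans (∣i∣²≡i² e) ee))
      (ℕ.anyUpTo? (λ n → + n * + n ≟ z) (suc ∣ z ∣))
    where
      square-≥ : ∀ n → n ℕ.≤ n ℕ.* n
      square-≥ zero    = z≤n
      square-≥ (suc n) = ℕ.m≤m*n (suc n) (suc n)
      bound : ∀ e → e * e ≡ z → ∣ e ∣ ℕ.≤ ∣ z ∣
      bound e refl = ℕ.≤-trans (square-≥ ∣ e ∣) (ℕ.≤-reflexive (sym (abs-* e e)))

  -- An identity at all natural numbers can be decided because a polynomial either vanishes
  -- identically or is nonzero from a computed point on.
  squareFactors? : ∀ f F → Dec (SquareFactors f F)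
  squareFactors? f F = go (poly-zero-or-eventually≢0 (((f , λ _ → refl) *ᵖ (f , λ _ → refl)) -ᵖ values-poly F))
    where
      φ : ℤ → ℤ
      φ x = evalℤ f x * evalℤ f x - values F x
      go : (∀ x → φ x ≡ 0ℤ) ⊎ Eventually (λ k → φ (+ k) ≢ 0ℤ) → Dec (SquareFactors f F)
      go (inj₁ z)       = yes λ k → i-j≡0⇒i≡j (evalℤ f (+ k) * evalℤ f (+ k)) (values F (+ k)) (z (+ k))
      go (inj₂ (K , h)) = no λ sf → h K ℕ.≤-refl (i≡j⇒i-j≡0 (sf K))

  -- All that `hereditary` asks of the quadratics, in a decidable form that mentions no field.
  Valid : Polyℤ → Polyℤ → List Quad × List Quad → Set
  Valid f g (F , G) = SquareFactors f F × SquareFactors g G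
    × All (λ q → All (λ q′ → IsSquare (disc q * disc q′)) (F ++ G)) (F ++ G) × All Irreducible⊎Zero (F ++ G)

  valid? : ∀ f g FG → Dec (Valid f g FG)
  valid? f g (F , G) = squareFactors? f F ×-dec squareFactors? g G
    ×-dec All.all? (λ q → All.all? (λ q′ → isSquare? (disc q * disc q′)) (F ++ G)) (F ++ G)
    ×-dec All.all? (λ q → (disc q ≟ 0ℤ) ⊎-dec (¬? (isSquare? (disc q)))) (F ++ G)

  interval : ℕ → List ℤ
  interval B = map (λ i → + i - + B) (upTo (suc (B ℕ.+ B)))

  ∈-interval : ∀ {B} z → ∣ z ∣ ℕ.≤ B → z ∈ interval B
  ∈-interval {B} z h with recentre {B} z h
  ... | a , a< , refl = ∈-map⁺ (λ i → + i - + B) (∈-upTo⁺ a<)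

  -- The monic quadratic with value `v` at `k` and `w` at `k + 1`.
  interpolate : ℤ → ℤ → ℤ → Quad
  interpolate k v w = b , v - k * k - b * k
    where b = w - v - + 2 * k - + 1

  interpolate-at : ∀ k q → interpolate k (q at k) (q at (+ 1 + k)) ≡ q
  interpolate-at k (b , c) = cong₂ _,_ (l₁ k b c)
      (trans (cong (λ z → ((b , c) at k) - k * k - z * k) (l₁ k b c)) (l₂ k b c))
    where
      l₁ : ∀ k b c → ((+ 1 + k) * (+ 1 + k) + b * (+ 1 + k) + c) - (k * k + b * k + c) - + 2 * k - + 1 ≡ b
      l₁ = solve-∀
      l₂ : ∀ k b c → (k * k + b * k + c) - k * k - b * k ≡ c
      l₂ = solve-∀

  listsOver : ∀ {A : Set} → List A → ℕ → List (List A)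
  listsOver xs zero    = [] ∷ []
  listsOver xs (suc n) = cartesianProductWith _∷_ xs (listsOver xs n)

  ∈-listsOver : ∀ {A : Set} {xs : List A} ys → All (_∈ xs) ys → ys ∈ listsOver xs (length ys)
  ∈-listsOver []       []       = here refl
  ∈-listsOver (y ∷ ys) (h ∷ hs) = ∈-cartesianProductWith⁺ _∷_ h (∈-listsOver ys hs)

  -- A quadratic factor of f² is determined by its values at k and k + 1, which divide the nonzero f²(k) and f²(k + 1).
  quadCandidates : Polyℤ → ℕ → List Quad
  quadCandidates f k = cartesianProductWith (interpolate (+ k)) (interval (∣ evalℤ f (+ k) * evalℤ f (+ k) ∣))
      (interval (∣ evalℤ f (+ suc k) * evalℤ f (+ suc k) ∣))

  factorCandidates : Polyℤ → ℕ → List (List Quad)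
  factorCandidates f k = listsOver (quadCandidates f k) (ℕ.pred (length f))

  at∥values : ∀ {q F} x → q ∈ F → q at x ∥ values F x
  at∥values {F = q ∷ F} x (here refl) = ∣m⇒∣m*n (values F x) ∣-refl
  at∥values {F = q ∷ F} x (there q∈)  = ∣n⇒∣m*n (q at x) (at∥values x q∈)

  ∈-factorCandidates : ∀ {f F} → SquareFactors f F → suc (length F) ≡ length f → (e : EventuallyPositive (evalℤ f)) →
      F ∈ factorCandidates f (proj₁ e)
  ∈-factorCandidates {f} {F} sf len (k , pos) = subst (λ n → F ∈ listsOver (quadCandidates f k) n) (cong ℕ.pred len)
      (∈-listsOver F (All.tabulate λ {q} q∈ → subst (_∈ quadCandidates f k) (interpolate-at (+ k) q)
        (∈-cartesianProductWith⁺ (interpolate (+ k)) (small k ℕ.≤-refl q∈) (small (suc k) (ℕ.n≤1+n k) q∈))))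
    where
      small : ∀ {q} j → k ℕ.≤ j → q ∈ F → q at + j ∈ interval (∣ evalℤ f (+ j) * evalℤ f (+ j) ∣)
      small {q} j h q∈ = ∈-interval (q at + j)
          (ℕ.∣⇒≤ {{ℕ.>-nonZero (≢0⇒abs≥1 (*-≢0 f≢0 f≢0))}}
          (∣⇒∣ᵤ (subst (q at + j ∥_) (sym (sf j)) (at∥values (+ j) q∈))))
        where
          f≢0 : evalℤ f (+ j) ≢ 0ℤ
          f≢0 z = <-irrefl (sym z) (pos j h)

  module _ (f g : Polyℤ) (f>0 : EventuallyPositive (evalℤ f)) (g>0 : EventuallyPositive (evalℤ g)) where

    candidates : List (List Quad × List Quad)
    candidates = cartesianProduct (factorCandidates f (proj₁ f>0)) (factorCandidates g (proj₁ g>0))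

    -- The splitting hypothesis guarantees that the search succeeds; the roots themselves enter no
    -- computation.
    some-valid : Monic f → Monic g → SplitOverCommonQuadratic f g → Any (Valid f g) candidates
    some-valid mf mg (d , nsq , sf , sg) = go (splits⇒quad-factors d mf sf) (splits⇒quad-factors d mg sg)
      where
        Factorised : Polyℤ → Set
        Factorised f = ∃ λ F → suc (length F) ≡ length f × (∀ k → evalℤ f k * evalℤ f k ≡ values F k) × All
            (DiscForm d) F
        go : Factorised f → Factorised g → Any (Valid f g) candidates
        go (F , lenF , vF , dF) (G , lenG , vG , dG) = lose
            (∈-cartesianProduct⁺ (∈-factorCandidates {f} {F} (λ k → vF (+ k)) lenF f>0)
                (∈-factorCandidates {g} {G} (λ k → vG (+ k)) lenG g>0))
            ((λ k → vF (+ k)) , (λ k → vG (+ k))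
            , All.map (λ {q} h → All.map (λ {q′} h′ → discForm-compatible d {q} {q′} h h′) dFG) dFG , All.map
                (λ {q} → discForm-irreducible d nsq {q}) dFG)
          where dFG = ++⁺ dF dG

    -- The hypotheses are irrelevant, so the factors are found by a finite search.
    recompute-factors : .(Monic f) → .(Monic g) → .(SplitOverCommonQuadratic f g) → ∃ (Valid f g)
    recompute-factors mf mg sp = go (find (recompute (any? (valid? f g) candidates) (some-valid mf mg sp)))
      where
        go : (∃ λ x → x ∈ candidates × Valid f g x) → ∃ (Valid f g)
        go (FG , _ , v) = FG , v

-- Closed form of the sequence, and the decision procedure.

open PolyZ
open Hereditary
open Candidates
open RatInt
open import Data.Integer as ℤ using (ℤ; +_)
open import Data.Rational
open import Data.Rational.Properties
open import Data.Rational.Solver using (module +-*-Solver)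
open +-*-Solver using (solve; _:=_; _:*_)
open import Relation.Nullary.Decidable using (map′; recompute)

*-cancelˡ-≢0 : ∀ r {p q} → r ≢ 0ℚ → r * p ≡ r * q → p ≡ q
*-cancelˡ-≢0 r {p} {q} r≢0 e = trans (unit p) (trans (cong (1/ r *_) e) (sym (unit q)))
  where
    instance _ = ≢-nonZero r≢0
    unit : ∀ p → p ≡ 1/ r * (r * p)
    unit p = trans (sym (*-identityˡ p)) (trans (cong (_* p) (sym (*-inverseˡ r))) (*-assoc (1/ r) r p))

toℚ≢0 : ∀ {z} → z ≢ + 0 → toℚ z ≢ 0ℚ
toℚ≢0 {z} h e = h (toℚ-injective {z} {+ 0} e)

hyperSeq-step : ∀ f g u₀ n → evalℤ f (+ suc n) ≢ + 0 →
  toℚ (evalℤ f (+ suc n)) * hyperSeq f g u₀ (suc n) ≡ toℚ (evalℤ g (+ suc n)) * hyperSeq f g u₀ n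
hyperSeq-step f g u₀ n h with toℚ (evalℤ f (+ suc n)) ≟ 0ℚ
... | yes e  = ⊥-elim (toℚ≢0 {evalℤ f (+ suc n)} h e)
... | no f≢0 = trans (solve 3 (λ a b c → a :* (b :* c) := b :* (a :* c)) refl a b (1/ a))
    (trans (cong (b *_) (*-inverseʳ a)) (*-identityʳ b))
  where
    a = toℚ (evalℤ f (+ suc n))
    b = toℚ (evalℤ g (+ suc n)) * hyperSeq f g u₀ n
    instance _ = ≢-nonZero f≢0

-- The recurrence telescopes. With f(1) ... f(n) kept on the left, clearing the denominators of `t`
-- and `u₀` turns uₙ = t into an equation between integers.
hyperSeq-closed : ∀ f g u₀ → NoNatZeros f → ∀ n → toℚ (partialProduct f n) * hyperSeq f g u₀ n ≡ toℚ
    (partialProduct g n) * u₀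
hyperSeq-closed f g u₀ nz zero    = refl
hyperSeq-closed f g u₀ nz (suc n) = begin
  toℚ (X ℤ.* a) * hyperSeq f g u₀ (suc n)       ≡⟨ cong (_* hyperSeq f g u₀ (suc n)) (toℚ-* X a) ⟩
  toℚ X * toℚ a * hyperSeq f g u₀ (suc n)       ≡⟨ *-assoc (toℚ X) (toℚ a) _ ⟩
  toℚ X * (toℚ a * hyperSeq f g u₀ (suc n))     ≡⟨ cong (toℚ X *_) (hyperSeq-step f g u₀ n (nz (suc n))) ⟩
  toℚ X * (toℚ b * hyperSeq f g u₀ n)           ≡⟨ solve 3 (λ x b h → x :* (b :* h) := (x :* h) :* b) refl (toℚ X)
      (toℚ b) (hyperSeq f g u₀ n) ⟩
  toℚ X * hyperSeq f g u₀ n * toℚ b             ≡⟨ cong (_* toℚ b) (hyperSeq-closed f g u₀ nz n) ⟩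
  toℚ Y * u₀ * toℚ b                            ≡⟨ solve 3 (λ y u b → y :* u :* b := (y :* b) :* u) refl (toℚ Y) u₀
      (toℚ b) ⟩
  toℚ Y * toℚ b * u₀                            ≡⟨ cong (_* u₀) (sym (toℚ-* Y b)) ⟩
  toℚ (Y ℤ.* b) * u₀                            ∎
  where
    open ≡-Reasoning
    X = partialProduct f n
    Y = partialProduct g n
    a = evalℤ f (+ suc n)
    b = evalℤ g (+ suc n)

module _ (f g : Polyℤ) (u₀ t : ℚ) (nz : NoNatZeros f) where

  private
    T = ↥ t ℤ.* ↧ u₀
    U = ↥ u₀ ℤ.* ↧ t
    δ = toℚ (↧ t) * toℚ (↧ u₀)

    toℚ-clear : ∀ X p q → toℚ (X ℤ.* (↥ p ℤ.* ↧ q)) ≡ toℚ X * p * (toℚ (↧ p) * toℚ (↧ q))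
    toℚ-clear X p q = trans (toℚ-* X (↥ p ℤ.* ↧ q))
        (trans (cong (toℚ X *_) (trans (toℚ-* (↥ p) (↧ q)) (cong (_* toℚ (↧ q)) (sym (*-denominator p)))))
      (solve 4 (λ x p v w → x :* (p :* v :* w) := x :* p :* (v :* w)) refl (toℚ X) p (toℚ (↧ p)) (toℚ (↧ q))))

    δ≢0 : δ ≢ 0ℚ
    δ≢0 e = toℚ≢0 {↧ t ℤ.* ↧ u₀} (λ ()) (trans (toℚ-* (↧ t) (↧ u₀)) e)

    X≢0 : ∀ n → toℚ (partialProduct f n) ≢ 0ℚ
    X≢0 n = toℚ≢0 {partialProduct f n} (partialProduct≢0 f n (λ k _ _ → nz k))

    right : ∀ n → toℚ (partialProduct g n ℤ.* U) ≡ toℚ (partialProduct f n) * hyperSeq f g u₀ n * δ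
    right n = trans (toℚ-clear (partialProduct g n) u₀ t)
        (cong₂ _*_ (sym (hyperSeq-closed f g u₀ nz n)) (*-comm (toℚ (↧ u₀)) (toℚ (↧ t))))

  term⇒hit : ∀ n → hyperSeq f g u₀ n ≡ t → partialProduct f n ℤ.* T ≡ partialProduct g n ℤ.* U
  term⇒hit n e = toℚ-injective {partialProduct f n ℤ.* T} {partialProduct g n ℤ.* U}
    (trans (toℚ-clear (partialProduct f n) t u₀)
        (trans (cong (λ z → toℚ (partialProduct f n) * z * δ) (sym e)) (sym (right n))))

  hit⇒term : ∀ n → partialProduct f n ℤ.* T ≡ partialProduct g n ℤ.* U → hyperSeq f g u₀ n ≡ t
  hit⇒term n e = *-cancelˡ-≢0 (toℚ (partialProduct f n)) (X≢0 n) (*-cancelˡ-≢0 δ δ≢0 (trans (*-comm δ _)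
    (trans (sym (right n)) (trans (cong toℚ (sym e)) (trans (toℚ-clear (partialProduct f n) t u₀) (*-comm _ δ))))))

-- A witness above `N` descends step by step to one that is at most `N`, so searching up to `N` is
-- enough.
decide-hereditary : ∀ {P : ℕ → Set} → (∀ n → Dec (P n)) → Eventually (λ n → P (suc n) → P n) → Dec (∃[ n ] P n)
decide-hereditary {P} P? (N , down) = map′ (λ (n , _ , p) → n , p) (λ (n , p) → descend n p) (ℕ.anyUpTo? P? (suc N))
  where
    descend : ∀ n → P n → ∃ λ m → m ℕ.< suc N × P m
    descend zero    p = zero , s≤s z≤n , p
    descend (suc n) p with N ℕ.≤? n
    ... | yes h = descend n (down n h p)
    ... | no ¬h = suc n , s≤s (ℕ.≰⇒> ¬h) , p

theorem5p2 : (f g : Polyℤ) (u₀ t : ℚ)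
    → .(Monic f) → .(Monic g) → .(NoNatZeros f)
    → .(SplitOverCommonQuadratic f g)
    → Dec (∃[ n ] hyperSeq f g u₀ n ≡ t)
theorem5p2 f g u₀ t mf mg nz sp = map′ (λ (n , h) → n , hit⇒term f g u₀ t nz′ n h)
    (λ (n , e) → n , term⇒hit f g u₀ t nz′ n e)
    (decide (recompute-factors f g f>0 g>0 mf mg sp))
  where
    -- Each instance of the irrelevant hypothesis is a decidable inequality and can be recomputed
    -- pointwise.
    nz′ : NoNatZeros f
    nz′ n = recompute (¬? (evalℤ f (+ n) ℤ.≟ + 0)) (nz n)
    f>0 = monic-positive {f} (recompute (monic? f) mf)
    g>0 = monic-positive {g} (recompute (monic? g) mg)
    T = ↥ t ℤ.* ↧ u₀
    U = ↥ u₀ ℤ.* ↧ t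
    decide : ∃ (Valid f g) → Dec (∃[ n ] partialProduct f n ℤ.* T ≡ partialProduct g n ℤ.* U)
    decide ((F , G) , sf , sg , compat , irr) = decide-hereditary
        (λ n → partialProduct f n ℤ.* T ℤ.≟ partialProduct g n ℤ.* U)
      (hereditary {f} {g} {F} {G} sf sg nz′ f>0 g>0 (λ q∈ q′∈ → All.lookup (All.lookup compat q∈) q′∈)
          (All.lookup irr) {T} {U})
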